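{- Let $k\ge a\ge1$ be integers and let $H_{k,a}(n)$ be the number of lattice paths (as described in the context) satisfying the special $(k,a)$-conditions, with major index $n$, all of whose peaks have even parity. Then \[ \sum_{n\ge0}H_{k,a}(n)q^n=\sum_{n_1,\ldots,n_{k-1}\ge0}\frac{q^{N_1(N_1+1)/2+N_2^2+\cdots+N_{k-1}^2+\sum_{j\ge0,\ a+1+2j\le k-1}2N_{a+1+2j}}\,(-q)_{N_1}}{(q^2;q^2)_{n_1}\cdots(q^2;q^2)_{n_{k-1}}}, \] where $N_i=n_i+n_{i+1}+\cdots+n_{k-1}$ for $1\le i\le k-1$.
   Context: Notation: $(a;q)_n=\prod_{i=0}^{n-1}(1-aq^i)$, $(a)_n=(a;q)_n$. Lattice paths: paths in the first quadrant starting on the $y$-axis and ending on the $x$-axis, using unit steps NE $(x,y)\to(x+1,y+1)$, SE $(x,y)\to(x+1,y-1)$, N $(x,y-1)\to(x,y)$, and E $(x,0)\to(x+1,0)$ (E steps only at height $0$). Height = $y$-coordinate, weight = $x$-coordinate. A peak is a vertex preceded by an NE step (NESE peak) or an N step (NSE peak) and followed by an SE step. Paths are empty or end with an SE step; as stated in the paper, if the leftmost peak is an NSE peak, the path must start with an NE step, except when it starts at $(0,0)$ with an E step. Major index = sum of weights of peaks. Special $(k,a)$-conditions: the path starts at height $k-a$ and all heights are $<k$. The relative height of a peak $(x,y)$ is the largest integer $h$ for which there are two vertices $(x',y-h)$ and $(x'',y-h)$ of the path with $x'\le x<x''$ such that between these two vertices there is no peak of height $>y$ and every peak of height $y$ has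 abscissa $\ge x$. $W(x)$ is the number of NSE peaks with weight $\le x$. The parity of a peak $(x,y)$ of relative height $r$ is the opposite of the parity of $x-r-W(x)$ (the peak is even iff $x-r-W(x)$ is odd).
   Formalization: Path class corrected, since the identity fails as described (e.g. k=2, a=1, n=1): every N step must be immediately followed by an SE step, and the rule for paths whose leftmost peak is an NSE peak is replaced by "the path does not start with an N step". -}

module Defs where

open import Data.Nat as ℕ using (ℕ; zero; suc; _+_; _*_; _∸_; _≡ᵇ_; _<ᵇ_; _≤ᵇ_)
open import Data.Nat.DivMod using (_/_; _%_)
open import Data.Integer as ℤ using (ℤ; +_)
open import Data.Bool using (Bool; true; false; _∧_; _∨_; not; if_then_else_; T)
open import Data.List as List using (List; []; _∷_; _++_; map; upTo; concatMap; drop; zipWith; foldr; length)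
open import Data.Bool.ListAction using (all; any)
open import Data.Maybe using (Maybe; just; nothing)
open import Data.Product using (Σ; _×_; _,_; proj₁; proj₂)

data Step : Set where
  NE SE N E : Step

Vertex : Set
Vertex = ℕ × ℕ    -- (x , y) = (weight , height)

walk : ℕ → ℕ → List Step → Maybe (List Vertex)
walk x y [] = just ((x , y) ∷ [])
walk x y (NE ∷ s) = Data.Maybe.map ((x , y) ∷_) (walk (suc x) (suc y) s)
walk x zero (SE ∷ s) = nothing
walk x (suc y) (SE ∷ s) = Data.Maybe.map ((x , suc y) ∷_) (walk (suc x) y s)
walk x y (N ∷ s) = Data.Maybe.map ((x , y) ∷_) (walk x (suc y) s)
walk x zero (E ∷ s) = Data.Maybe.map ((x , zero) ∷_) (walk (suc x) zero s)
walk x (suc y) (E ∷ s) = nothing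

isSE : Step → Bool
isSE SE = true
isSE _  = false

isN : Step → Bool
isN N = true
isN _ = false

isUp : Step → Bool
isUp NE = true
isUp N  = true
isUp _  = false

record Peak : Set where
  constructor peak
  field
    idx : ℕ      -- position of the peak vertex in the vertex list
    px  : ℕ
    py  : ℕ
    nse : Bool   -- true: NSE peak, false: NESE peak
open Peak public

-- Peaks: vertex v_{j+1} is a peak iff step j is NE or N and step j+1 is SE.
-- (step i goes from vertex v_i to vertex v_{i+1})
peaksFrom : ℕ → List Step → List Vertex → List Peak
peaksFrom j (s ∷ t ∷ ss) (v ∷ (wx , wy) ∷ vs) =
  (if isUp s ∧ isSE t then peak (suc j) wx wy (isN s) ∷ [] else [])
  ++ peaksFrom (suc j) (t ∷ ss) ((wx , wy) ∷ vs)
peaksFrom j _ _ = []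

peaks : List Step → List Vertex → List Peak
peaks = peaksFrom 0

sumℕ : List ℕ → ℕ
sumℕ = foldr _+_ 0

majorIndex : List Peak → ℕ
majorIndex ps = sumℕ (map px ps)

indexed : List Vertex → List (ℕ × Vertex)
indexed vs = List.zip (upTo (length vs)) vs

largest : ℕ → (ℕ → Bool) → ℕ
largest zero P = 0
largest (suc b) P = if P (suc b) then suc b else largest b P

-- The condition in the definition of relative height, for the peak p
-- and a candidate h (1 ≤ h ≤ height of p): there are vertices
-- v' = (x' , y - h) and v'' = (x'' , y - h) of the path, v' before v'',
-- with x' ≤ x < x'' such that no peak strictly between them has height
-- > y and every peak of height y strictly between them has abscissa ≥ x.
relOK : List Vertex → List Peak → Peak → ℕ → Bool
relOK vs ps p h =
  any (λ { (i , (x₁ , y₁)) →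
    any (λ { (i' , (x₂ , y₂)) →
      (i <ᵇ i') ∧ (y₁ ≡ᵇ (py p ∸ h)) ∧ (y₂ ≡ᵇ (py p ∸ h))
      ∧ (x₁ ≤ᵇ px p) ∧ (px p <ᵇ x₂)
      ∧ all (λ q → not ((i <ᵇ idx q) ∧ (idx q <ᵇ i'))
                   ∨ ((py q ≤ᵇ py p) ∧ (not (py q ≡ᵇ py p) ∨ (px p ≤ᵇ px q)))) ps })
      (indexed vs) })
    (indexed vs)

-- relative height of a peak (h ranges over 0 … y since heights are ≥ 0)
relHeight : List Vertex → List Peak → Peak → ℕ
relHeight vs ps p = largest (py p) (relOK vs ps p)

W : List Peak → ℕ → ℕ
W ps x = length (List.filter (λ q → Data.Bool._≟_ (nse q ∧ (px q ≤ᵇ x)) true) ps)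

isEvenPeak : List Vertex → List Peak → Peak → Bool
isEvenPeak vs ps p =
  (ℤ.∣ (+ px p) ℤ.- (+ relHeight vs ps p) ℤ.- (+ W ps (px p)) ∣ % 2) ≡ᵇ 1

lastIsSE : List Step → Bool
lastIsSE [] = true
lastIsSE (s ∷ []) = isSE s
lastIsSE (_ ∷ t ∷ ss) = lastIsSE (t ∷ ss)

nFollowedBySE : List Step → Bool
nFollowedBySE [] = true
nFollowedBySE (N ∷ []) = false
nFollowedBySE (N ∷ t ∷ ss) = isSE t ∧ nFollowedBySE (t ∷ ss)
nFollowedBySE (_ ∷ ss) = nFollowedBySE ss

notStartN : List Step → Bool
notStartN (N ∷ _) = false
notStartN _ = true

finalHeight0 : List Vertex → Bool
finalHeight0 [] = false
finalHeight0 ((_ , y) ∷ []) = y ≡ᵇ 0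
finalHeight0 (_ ∷ w ∷ ws) = finalHeight0 (w ∷ ws)

-- The path given by the step list s, starting at (0 , k - a), satisfies
-- the special (k,a)-conditions, has major index n and all peaks even.
isH : ℕ → ℕ → ℕ → List Step → Bool
isH k a n s with walk 0 (k ∸ a) s
... | nothing = false
... | just vs =
  let ps = peaks s vs in
  finalHeight0 vs ∧ lastIsSE s ∧ nFollowedBySE s ∧ notStartN s
  ∧ all (λ v → proj₂ v <ᵇ k) vs
  ∧ (majorIndex ps ≡ᵇ n)
  ∧ all (isEvenPeak vs ps) ps

HPaths : ℕ → ℕ → ℕ → Set
HPaths k a n = Σ (List Step) (λ s → T (isH k a n s))

-- Formal power series with integer coefficients, as coefficient functions

Series : Set
Series = ℕ → ℤ

sumℤ : List ℤ → ℤ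
sumℤ = foldr ℤ._+_ (+ 0)

mono : ℕ → Series
mono e m = if m ≡ᵇ e then + 1 else + 0

one : Series
one = mono 0

_⊛_ : Series → Series → Series
(f ⊛ g) n = sumℤ (map (λ i → f i ℤ.* g (n ∸ i)) (upTo (suc n)))
infixl 7 _⊛_

oneMinus : ℤ → ℕ → Series
oneMinus c e = λ m → one m ℤ.- (c ℤ.* mono e m)

qPoch : ℤ → ℕ → ℕ → ℕ → Series
qPoch c d b zero = one
qPoch c d b (suc n) = qPoch c d b n ⊛ oneMinus c (d + b * n)

-- reciprocal of a series with constant term 1:
-- g_0 = 1, g_m = - Σ_{i=1}^{m} f_i g_{m-i};  invRev f m = [g_m , … , g_0]
invRev : Series → ℕ → List ℤ
invRev f zero = + 1 ∷ []
invRev f (suc m) =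
  let gs = invRev f m in
  (ℤ.- sumℤ (zipWith ℤ._*_ (map (λ i → f (suc i)) (upTo (suc m))) gs)) ∷ gs

headℤ : List ℤ → ℤ
headℤ [] = + 0
headℤ (z ∷ _) = z

inv : Series → Series
inv f m = headℤ (invRev f m)

-- N_i = n_i + … + n_{k-1}   for the tuple ns = (n_1 , … , n_{k-1}), i ≥ 1
Nof : List ℕ → ℕ → ℕ
Nof ns i = sumℕ (drop (i ∸ 1) ns)

fromTo : ℕ → ℕ → List ℕ
fromTo lo hi = map (λ i → lo + i) (upTo (suc hi ∸ lo))

exponent : ℕ → ℕ → List ℕ → ℕ
exponent k a ns =
  (Nof ns 1 * suc (Nof ns 1)) / 2
  + sumℕ (map (λ i → Nof ns i * Nof ns i) (fromTo 2 (k ∸ 1)))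
  + sumℕ (map (λ j → if (a + 1 + 2 * j) ≤ᵇ (k ∸ 1) then 2 * Nof ns (a + 1 + 2 * j) else 0)
              (upTo k))

summand : ℕ → ℕ → List ℕ → Series
summand k a ns =
  mono (exponent k a ns) ⊛ qPoch (ℤ.- (+ 1)) 1 1 (Nof ns 1)
  ⊛ foldr (λ nᵢ acc → inv (qPoch (+ 1) 2 2 nᵢ) ⊛ acc) one ns

tuples : ℕ → ℕ → List (List ℕ)
tuples zero B = [] ∷ []
tuples (suc m) B = concatMap (λ i → map (i ∷_) (tuples m B)) (upTo (suc B))

-- coefficient of q^n in the right-hand side.  Summands with some n_i > n
-- are O(q^{n+1}) (their exponent is ≥ N_1 ≥ n_i), so only tuples with all
-- n_i ≤ n contribute to this coefficient.
rhsCoeff : ℕ → ℕ → ℕ → ℤ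
rhsCoeff k a n = sumℤ (map (λ ns → summand k a ns n) (tuples (k ∸ 1) n))

{-# OPTIONS --safe #-}
module Submission where

-- A peak of relative height r over base level y - r has x - r - W odd exactly
-- when the number of steps before its base is odd, since x + W counts the steps
-- before the peak and y changes parity with every step above the axis.
-- Every peak has its base at the start of an ascent, and every ascent starts at
-- the base of some peak (of the highest peaks of the two excursions separated by
-- that vertex, the lower one), so all peaks are even iff every ascent starts at a
-- vertex of odd index.
--
-- This local condition is read off step by step.  Splitting by the number N of
-- peaks and by the first step gives a linear q-recurrence for the paths from
-- height h, whose solution is q^(N(N-1)/2) (-q;q)_N β ℓ c N with ℓ = k - 1 and
-- c + h + 1 = ℓ, where β ℓ c is the inner multisum over N₂, N₃, … with N₁ = N.
-- On the multisum side the recurrence follows by induction on ℓ from commutation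
-- relations between the operator
--   Λ f N = Σ_{M ≤ N} q^(M²) f M / (q²;q²)_{N-M}
-- that adds one summation and the multipliers and shifts
--   θ f N = q^(2N) f N,   σ f N = f (N-1),   κ f N = q^(2N-1) f (N-1).

-- An ascent may start only at an odd index, and the first vertex has index 0. The forced first step
-- moves all N peaks to the right and contributes q^N, which turns q^(N(N-1)/2) into the
-- q^(N(N+1)/2) of the multisum. When a < k it leads from height k - a to k - a - 1, where c + h + 1
-- = ℓ reads c = a - 1. From then on the recurrence looks at odd indices only: two steps without an
-- ascent cost q^(2N), the multiplier θ, and lower h by 2, so they raise c by 2. On the other side c
-- + 2 is the first index i whose 2 N_i occurs in the exponent. The floor h = 0 is c = ℓ - 1, where
-- that index lies beyond N_ℓ and β stops depending on c; this absorbs the E steps. The commutation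
-- relations really involve 1 - σ. The solver for series works over a commutative semiring, so every
-- relation is stated with the negative term moved to the other side, and differences are removed by
-- adding a common series and cancelling it coefficientwise.

open import Algebra.Bundles using (CommutativeSemiring; AbelianGroup)
open import Data.Bool using (Bool; true; false; if_then_else_; T; not; _∧_; _∨_)
open import Data.Bool.ListAction using (all; any)
import Data.Bool.Properties as Bool
open import Data.Empty using (⊥; ⊥-elim)
open import Data.Fin as Fin using (Fin)
import Data.Fin.Properties as Fin
open import Data.Integer as ℤ using (ℤ; +_)
import Data.Integer.Properties as ℤ
open import Data.List as List
  using (List; []; _∷_; _++_; map; upTo; applyUpTo; zipWith; length; concatMap; drop; foldr)
import Data.List.Properties as List
open import Data.Maybe using (just)
open import Data.Nat as ℕ using (ℕ; zero; suc; _≤_; _<_; z≤n; s≤s; _∸_; _≡ᵇ_; _<ᵇ_; _≤ᵇ_)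
open import Data.Nat.DivMod using (_/_; _%_; +-distrib-/-∣ʳ; m*n/n≡m)
open import Data.Nat.Divisibility using (divides)
open import Data.Nat.Induction using (<-rec)
import Data.Nat.Properties as ℕ
open import Data.Product using (Σ; _×_; _,_; proj₁; proj₂)
open import Data.Sum using (_⊎_; inj₁; inj₂)
open import Data.Sum.Function.Propositional using (_⊎-↔_)
open import Data.Unit using (tt)
open import Defs
open import Function.Base using (_∘_; id)
open import Function.Bundles using (_↔_; mk↔ₛ′; Equivalence)
open import Function.Properties.Inverse using (↔-trans; ↔-sym)
open import Level using (0ℓ)
open import Relation.Binary.PropositionalEquality
  using (_≡_; _≢_; refl; sym; trans; cong; cong₂; subst; module ≡-Reasoning)
open import Relation.Nullary using (¬_; Dec; yes; no; contradiction)
open import Algebra.Properties.Group (AbelianGroup.group ℤ.+-0-abelianGroup)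
  using () renaming (∙-cancelʳ to ℤ-cancelʳ)
import Algebra.Solver.Ring.NaturalCoefficients.Default
import Data.Integer.Tactic.RingSolver
import Data.Nat.Tactic.RingSolver
import Relation.Binary.Reasoning.Setoid

-- Formal power series

∑ : ℕ → (ℕ → ℤ) → ℤ
∑ zero    f = + 0
∑ (suc n) f = f 0 ℤ.+ ∑ n (f ∘ suc)

sumℤ-applyUpTo : ∀ {A : Set} (f : A → ℤ) (g : ℕ → A) n →
                 sumℤ (map f (applyUpTo g n)) ≡ ∑ n (f ∘ g)
sumℤ-applyUpTo f g zero    = refl
sumℤ-applyUpTo f g (suc n) = cong (λ z → f (g 0) ℤ.+ z) (sumℤ-applyUpTo f (g ∘ suc) n)

∑-cong< : ∀ n {f g : ℕ → ℤ} → (∀ i → i < n → f i ≡ g i) → ∑ n f ≡ ∑ n g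
∑-cong< zero    eq = refl
∑-cong< (suc n) eq = cong₂ ℤ._+_ (eq 0 (s≤s z≤n)) (∑-cong< n (λ i i<n → eq (suc i) (s≤s i<n)))

∑-cong : ∀ n {f g : ℕ → ℤ} → (∀ i → f i ≡ g i) → ∑ n f ≡ ∑ n g
∑-cong n eq = ∑-cong< n (λ i _ → eq i)

∑-zero : ∀ n → ∑ n (λ _ → + 0) ≡ + 0
∑-zero zero    = refl
∑-zero (suc n) = trans (ℤ.+-identityˡ _) (∑-zero n)

+-interchange : ∀ a b c d → (a ℤ.+ b) ℤ.+ (c ℤ.+ d) ≡ (a ℤ.+ c) ℤ.+ (b ℤ.+ d)
+-interchange = Data.Integer.Tactic.RingSolver.solve-∀

∑-+ : ∀ n (f g : ℕ → ℤ) → ∑ n (λ i → f i ℤ.+ g i) ≡ ∑ n f ℤ.+ ∑ n g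
∑-+ zero    f g = refl
∑-+ (suc n) f g = trans (cong (λ z → f 0 ℤ.+ g 0 ℤ.+ z) (∑-+ n (f ∘ suc) (g ∘ suc)))
                        (+-interchange (f 0) (g 0) _ _)

∑-*ˡ : ∀ n c (f : ℕ → ℤ) → ∑ n (λ i → c ℤ.* f i) ≡ c ℤ.* ∑ n f
∑-*ˡ zero    c f = sym (ℤ.*-zeroʳ c)
∑-*ˡ (suc n) c f = trans (cong (λ z → c ℤ.* f 0 ℤ.+ z) (∑-*ˡ n c (f ∘ suc)))
                         (sym (ℤ.*-distribˡ-+ c (f 0) _))

∑-last : ∀ n (f : ℕ → ℤ) → ∑ (suc n) f ≡ ∑ n f ℤ.+ f n
∑-last zero    f = ℤ.+-comm (f 0) (+ 0)
∑-last (suc n) f = trans (cong (λ z → f 0 ℤ.+ z) (∑-last n (f ∘ suc)))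
                         (sym (ℤ.+-assoc (f 0) _ _))

∑-swap : ∀ m n (f : ℕ → ℕ → ℤ) → ∑ m (λ i → ∑ n (f i)) ≡ ∑ n (λ j → ∑ m (λ i → f i j))
∑-swap zero    n f = sym (∑-zero n)
∑-swap (suc m) n f = trans (cong (λ z → ∑ n (f 0) ℤ.+ z) (∑-swap m n (f ∘ suc)))
                           (sym (∑-+ n (f 0) (λ j → ∑ m (λ i → f (suc i) j))))

infix 4 _≈_
-- A record, so that unification recovers `f` and `g` from a proof; a bare function type over
-- coefficients would not determine them.
record _≈_ (f g : Series) : Set where
  constructor pointwise
  field at : ∀ n → f n ≡ g n
open _≈_ public

≈-refl : ∀ {f} → f ≈ f
≈-refl = pointwise (λ _ → refl)

≈-sym : ∀ {f g} → f ≈ g → g ≈ f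
≈-sym p = pointwise (λ n → sym (at p n))

≈-trans : ∀ {f g h} → f ≈ g → g ≈ h → f ≈ h
≈-trans p q = pointwise (λ n → trans (at p n) (at q n))

≈-reflexive : ∀ {f g} → f ≡ g → f ≈ g
≈-reflexive refl = ≈-refl

infixl 6 _+ˢ_
_+ˢ_ : Series → Series → Series
(f +ˢ g) n = f n ℤ.+ g n

𝟘 : Series
𝟘 _ = + 0

conv : Series → Series → Series
conv f g n = ∑ (suc n) (λ i → f i ℤ.* g (n ∸ i))

⊛-conv : ∀ f g n → (f ⊛ g) n ≡ conv f g n
⊛-conv f g n = sumℤ-applyUpTo (λ i → f i ℤ.* g (n ∸ i)) id (suc n)

⊛-suc : ∀ f g n → (f ⊛ g) (suc n) ≡ f 0 ℤ.* g (suc n) ℤ.+ ((f ∘ suc) ⊛ g) n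
⊛-suc f g n = trans (⊛-conv f g (suc n))
                    (cong (λ z → f 0 ℤ.* g (suc n) ℤ.+ z) (sym (⊛-conv (f ∘ suc) g n)))

⊛-cong : ∀ {f f′ g g′} → f ≈ f′ → g ≈ g′ → f ⊛ g ≈ f′ ⊛ g′
⊛-cong {f} {f′} {g} {g′} p q = pointwise λ n → begin
  (f ⊛ g) n    ≡⟨ ⊛-conv f g n ⟩
  conv f g n   ≡⟨ ∑-cong (suc n) (λ i → cong₂ ℤ._*_ (at p i) (at q (n ∸ i))) ⟩
  conv f′ g′ n ≡⟨ ⊛-conv f′ g′ n ⟨
  (f′ ⊛ g′) n  ∎
  where open ≡-Reasoning

⊛-suc′ : ∀ f g n → (f ⊛ g) (suc n) ≡ (f ⊛ (g ∘ suc)) n ℤ.+ f (suc n) ℤ.* g 0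
⊛-suc′ f g n = begin
  (f ⊛ g) (suc n)
    ≡⟨ ⊛-conv f g (suc n) ⟩
  conv f g (suc n)
    ≡⟨ ∑-last (suc n) (λ i → f i ℤ.* g (suc n ∸ i)) ⟩
  ∑ (suc n) (λ i → f i ℤ.* g (suc n ∸ i)) ℤ.+ f (suc n) ℤ.* g (n ∸ n)
    ≡⟨ cong₂ ℤ._+_ (∑-cong< (suc n) λ { i (s≤s i≤n) →
                      cong (λ m → f i ℤ.* g m) (ℕ.+-∸-assoc 1 i≤n) })
                   (cong (λ m → f (suc n) ℤ.* g m) (ℕ.n∸n≡0 n)) ⟩
  conv f (g ∘ suc) n ℤ.+ f (suc n) ℤ.* g 0
    ≡⟨ cong (ℤ._+ f (suc n) ℤ.* g 0) (sym (⊛-conv f (g ∘ suc) n)) ⟩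
  (f ⊛ (g ∘ suc)) n ℤ.+ f (suc n) ℤ.* g 0 ∎
  where open ≡-Reasoning

-- Induction on the coefficient index for all pairs at once: splitting the first term off one
-- product and the last term off the other leaves the same two series, with one of them shifted.
⊛-comm-at : ∀ n f g → (f ⊛ g) n ≡ (g ⊛ f) n
⊛-comm-at zero    f g = cong (ℤ._+ + 0) (ℤ.*-comm (f 0) (g 0))
⊛-comm-at (suc n) f g = begin
  (f ⊛ g) (suc n)                                ≡⟨ ⊛-suc f g n ⟩
  f 0 ℤ.* g (suc n) ℤ.+ ((f ∘ suc) ⊛ g) n        ≡⟨ ℤ.+-comm (f 0 ℤ.* g (suc n)) _ ⟩
  ((f ∘ suc) ⊛ g) n ℤ.+ f 0 ℤ.* g (suc n)        ≡⟨ cong₂ ℤ._+_ (⊛-comm-at n (f ∘ suc) g) (ℤ.*-comm (f 0) _) ⟩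
  (g ⊛ (f ∘ suc)) n ℤ.+ g (suc n) ℤ.* f 0        ≡⟨ ⊛-suc′ g f n ⟨
  (g ⊛ f) (suc n)                                ∎
  where open ≡-Reasoning

⊛-comm : ∀ f g → f ⊛ g ≈ g ⊛ f
⊛-comm f g = pointwise (λ n → ⊛-comm-at n f g)

⊛-distribʳ : ∀ h f g → (f +ˢ g) ⊛ h ≈ (f ⊛ h) +ˢ (g ⊛ h)
⊛-distribʳ h f g = pointwise λ n → begin
  ((f +ˢ g) ⊛ h) n
    ≡⟨ ⊛-conv (f +ˢ g) h n ⟩
  conv (f +ˢ g) h n
    ≡⟨ ∑-cong (suc n) (λ i → ℤ.*-distribʳ-+ (h (n ∸ i)) (f i) (g i)) ⟩
  ∑ (suc n) (λ i → f i ℤ.* h (n ∸ i) ℤ.+ g i ℤ.* h (n ∸ i))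
    ≡⟨ ∑-+ (suc n) (λ i → f i ℤ.* h (n ∸ i)) (λ i → g i ℤ.* h (n ∸ i)) ⟩
  conv f h n ℤ.+ conv g h n
    ≡⟨ cong₂ ℤ._+_ (⊛-conv f h n) (⊛-conv g h n) ⟨
  ((f ⊛ h) +ˢ (g ⊛ h)) n ∎
  where open ≡-Reasoning

⊛-distribˡ : ∀ h f g → h ⊛ (f +ˢ g) ≈ (h ⊛ f) +ˢ (h ⊛ g)
⊛-distribˡ h f g = ≈-trans (⊛-comm h (f +ˢ g)) (≈-trans (⊛-distribʳ h f g)
  (pointwise λ n → cong₂ ℤ._+_ (⊛-comm-at n f h) (⊛-comm-at n g h)))

scale : ℤ → Series → Series
scale c f n = c ℤ.* f n

scale-⊛ : ∀ c f g n → (scale c f ⊛ g) n ≡ c ℤ.* (f ⊛ g) n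
scale-⊛ c f g n = begin
  (scale c f ⊛ g) n                               ≡⟨ ⊛-conv (scale c f) g n ⟩
  ∑ (suc n) (λ i → c ℤ.* f i ℤ.* g (n ∸ i))       ≡⟨ ∑-cong (suc n) (λ i → ℤ.*-assoc c (f i) (g (n ∸ i))) ⟩
  ∑ (suc n) (λ i → c ℤ.* (f i ℤ.* g (n ∸ i)))     ≡⟨ ∑-*ˡ (suc n) c (λ i → f i ℤ.* g (n ∸ i)) ⟩
  c ℤ.* conv f g n                                ≡⟨ cong (c ℤ.*_) (⊛-conv f g n) ⟨
  c ℤ.* (f ⊛ g) n                                 ∎
  where open ≡-Reasoning

-- The shift `_∘ suc` obeys a product rule: the shift of `f ⊛ g` is `f 0` times the shift of `g`
-- plus the shift of `f` times `g`. Induction on the coefficient index, with this rule applied to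
-- the left factor.
⊛-assoc-at : ∀ n f g h → ((f ⊛ g) ⊛ h) n ≡ (f ⊛ (g ⊛ h)) n
⊛-assoc-at zero    f g h = assoc₀ (f 0) (g 0) (h 0)
  where
  assoc₀ : ∀ a b c → (a ℤ.* b ℤ.+ + 0) ℤ.* c ℤ.+ + 0 ≡ a ℤ.* (b ℤ.* c ℤ.+ + 0) ℤ.+ + 0
  assoc₀ = Data.Integer.Tactic.RingSolver.solve-∀
⊛-assoc-at (suc n) f g h = begin
  ((f ⊛ g) ⊛ h) (suc n)
    ≡⟨ ⊛-suc (f ⊛ g) h n ⟩
  (f ⊛ g) 0 ℤ.* h (suc n) ℤ.+ (((f ⊛ g) ∘ suc) ⊛ h) n
    ≡⟨ cong (λ z → (f ⊛ g) 0 ℤ.* h (suc n) ℤ.+ z)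
         (at (⊛-cong {g = h} (pointwise (⊛-suc f g)) ≈-refl) n) ⟩
  (f ⊛ g) 0 ℤ.* h (suc n) ℤ.+ ((scale (f 0) (g ∘ suc) +ˢ ((f ∘ suc) ⊛ g)) ⊛ h) n
    ≡⟨ cong (λ z → (f ⊛ g) 0 ℤ.* h (suc n) ℤ.+ z) (at (⊛-distribʳ h (scale (f 0) (g ∘ suc)) ((f ∘ suc) ⊛ g)) n) ⟩
  (f ⊛ g) 0 ℤ.* h (suc n) ℤ.+ ((scale (f 0) (g ∘ suc) ⊛ h) n ℤ.+ (((f ∘ suc) ⊛ g) ⊛ h) n)
    ≡⟨ cong (λ z → (f ⊛ g) 0 ℤ.* h (suc n) ℤ.+ z)
         (cong₂ ℤ._+_ (scale-⊛ (f 0) (g ∘ suc) h n) (⊛-assoc-at n (f ∘ suc) g h)) ⟩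
  (f 0 ℤ.* g 0 ℤ.+ + 0) ℤ.* h (suc n)
    ℤ.+ (f 0 ℤ.* ((g ∘ suc) ⊛ h) n ℤ.+ ((f ∘ suc) ⊛ (g ⊛ h)) n)
    ≡⟨ regroup (f 0) (g 0) (h (suc n)) _ _ ⟩
  f 0 ℤ.* (g 0 ℤ.* h (suc n) ℤ.+ ((g ∘ suc) ⊛ h) n) ℤ.+ ((f ∘ suc) ⊛ (g ⊛ h)) n
    ≡⟨ cong (λ z → f 0 ℤ.* z ℤ.+ ((f ∘ suc) ⊛ (g ⊛ h)) n) (⊛-suc g h n) ⟨
  f 0 ℤ.* (g ⊛ h) (suc n) ℤ.+ ((f ∘ suc) ⊛ (g ⊛ h)) n
    ≡⟨ ⊛-suc f (g ⊛ h) n ⟨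
  (f ⊛ (g ⊛ h)) (suc n) ∎
  where
  open ≡-Reasoning
  regroup : ∀ a b c d e →
            (a ℤ.* b ℤ.+ + 0) ℤ.* c ℤ.+ (a ℤ.* d ℤ.+ e) ≡ a ℤ.* (b ℤ.* c ℤ.+ d) ℤ.+ e
  regroup = Data.Integer.Tactic.RingSolver.solve-∀

⊛-zeroˡ : ∀ f → 𝟘 ⊛ f ≈ 𝟘
⊛-zeroˡ f = pointwise λ n → trans (⊛-conv 𝟘 f n) (∑-zero (suc n))

⊛-identityˡ : ∀ f → one ⊛ f ≈ f
⊛-identityˡ f = pointwise λ
  { zero    → trans (ℤ.+-identityʳ _) (ℤ.*-identityˡ (f 0))
  ; (suc n) → trans (⊛-suc one f n) (trans (cong₂ ℤ._+_ (ℤ.*-identityˡ (f (suc n)))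
                (at (⊛-zeroˡ f) n)) (ℤ.+-identityʳ _)) }

open import Algebra.Structures (_≈_) using (IsCommutativeSemiring)

+ˢ-⊛-isCommutativeSemiring : IsCommutativeSemiring _+ˢ_ _⊛_ 𝟘 one
+ˢ-⊛-isCommutativeSemiring = record
  { isSemiring = record
    { isSemiringWithoutAnnihilatingZero = record
      { +-isCommutativeMonoid = record
        { isMonoid = record
          { isSemigroup = record
            { isMagma = record
              { isEquivalence = record { refl = ≈-refl ; sym = ≈-sym ; trans = ≈-trans }
              ; ∙-cong = λ p q → pointwise (λ n → cong₂ ℤ._+_ (at p n) (at q n)) }
            ; assoc = λ f g h → pointwise (λ n → ℤ.+-assoc (f n) (g n) (h n)) }
          ; identity = (λ f → pointwise (λ n → ℤ.+-identityˡ (f n)))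
                     , (λ f → pointwise (λ n → ℤ.+-identityʳ (f n))) }
        ; comm = λ f g → pointwise (λ n → ℤ.+-comm (f n) (g n)) }
      ; *-cong = ⊛-cong
      ; *-assoc = λ f g h → pointwise (λ n → ⊛-assoc-at n f g h)
      ; *-identity = ⊛-identityˡ , (λ f → ≈-trans (⊛-comm f one) (⊛-identityˡ f))
      ; distrib = ⊛-distribˡ , ⊛-distribʳ }
    ; zero = ⊛-zeroˡ , (λ f → ≈-trans (⊛-comm f 𝟘) (⊛-zeroˡ f)) }
  ; *-comm = ⊛-comm }

-- Series are functions, so unification would unfold both operations at an
-- argument; the abstract copies keep f and g recoverable from f ⊕ g and f ⊗ g.
infixl 6 _⊕_
infixl 7 _⊗_
abstract
  _⊕_ _⊗_ : Series → Series → Series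
  _⊕_ = _+ˢ_
  _⊗_ = _⊛_

  ⊕-⊗-isCommutativeSemiring : IsCommutativeSemiring _⊕_ _⊗_ 𝟘 one
  ⊕-⊗-isCommutativeSemiring = +ˢ-⊛-isCommutativeSemiring

  ⊕-at : ∀ f g n → (f ⊕ g) n ≡ f n ℤ.+ g n
  ⊕-at f g n = refl

  ⊗-⊛ : ∀ f g → f ⊗ g ≈ f ⊛ g
  ⊗-⊛ f g = ≈-refl

seriesSemiring : CommutativeSemiring 0ℓ 0ℓ
seriesSemiring = record { isCommutativeSemiring = ⊕-⊗-isCommutativeSemiring }

open CommutativeSemiring seriesSemiring public
  using () renaming (+-cong to ⊕-cong; +-assoc to ⊕-assoc; +-comm to ⊕-comm;
    +-identityˡ to ⊕-identityˡ; +-identityʳ to ⊕-identityʳ;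
    *-cong to ⊗-cong; *-assoc to ⊗-assoc; *-identityˡ to ⊗-identityˡ;
    *-identityʳ to ⊗-identityʳ; zeroʳ to ⊗-zeroʳ; distribˡ to ⊗-distribˡ)
module ≈-Reasoning = Relation.Binary.Reasoning.Setoid (CommutativeSemiring.setoid seriesSemiring)
module Solver = Algebra.Solver.Ring.NaturalCoefficients.Default seriesSemiring

⊕-cancelʳ : ∀ {f g} h → f ⊕ h ≈ g ⊕ h → f ≈ g
⊕-cancelʳ {f} {g} h p = pointwise λ n → ℤ-cancelʳ (h n) (f n) (g n)
  (trans (sym (⊕-at f h n)) (trans (at p n) (⊕-at g h n)))

mono-⊗-suc : ∀ e f n → (mono (suc e) ⊗ f) (suc n) ≡ (mono e ⊗ f) n
mono-⊗-suc e f n = begin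
  (mono (suc e) ⊗ f) (suc n)            ≡⟨ at (⊗-⊛ (mono (suc e)) f) (suc n) ⟩
  (mono (suc e) ⊛ f) (suc n)            ≡⟨ ⊛-suc (mono (suc e)) f n ⟩
  + 0 ℤ.* f (suc n) ℤ.+ (mono e ⊛ f) n  ≡⟨ ℤ.+-identityˡ _ ⟩
  (mono e ⊛ f) n                        ≡⟨ at (⊗-⊛ (mono e) f) n ⟨
  (mono e ⊗ f) n                        ∎
  where open ≡-Reasoning

mono-⊗ : ∀ e f n → e ≤ n → (mono e ⊗ f) n ≡ f (n ∸ e)
mono-⊗ zero    f n       _         = at (⊗-identityˡ f) n
mono-⊗ (suc e) f (suc n) (s≤s e≤n) = trans (mono-⊗-suc e f n) (mono-⊗ e f n e≤n)

mono-⊗-< : ∀ e f n → n < e → (mono e ⊗ f) n ≡ + 0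
mono-⊗-< (suc e) f zero    _         = at (⊗-⊛ (mono (suc e)) f) 0
mono-⊗-< (suc e) f (suc n) (s≤s n<e) = trans (mono-⊗-suc e f n) (mono-⊗-< e f n n<e)

mono-+ : ∀ a b → mono a ⊗ mono b ≈ mono (a ℕ.+ b)
mono-+ a b = pointwise (lemma a)
  where
  lemma : ∀ a n → (mono a ⊗ mono b) n ≡ mono (a ℕ.+ b) n
  lemma zero    n       = at (⊗-identityˡ (mono b)) n
  lemma (suc a) zero    = at (⊗-⊛ (mono (suc a)) (mono b)) 0
  lemma (suc a) (suc n) = trans (mono-⊗-suc a (mono b) n) (lemma a n)

-- `invRev` lists the coefficients of the inverse from the highest index down, so zipping it with
-- ascending coefficients already gives a convolution. `g` is free because `upTo` unfolds to
-- `applyUpTo` with a shifted index map.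
sum-zipWith-invRev : ∀ f m {A : Set} (F : A → ℤ) (g : ℕ → A) →
  sumℤ (zipWith ℤ._*_ (map F (applyUpTo g (suc m))) (invRev f m))
  ≡ ∑ (suc m) (λ i → F (g i) ℤ.* inv f (m ∸ i))
sum-zipWith-invRev f zero    F g = refl
sum-zipWith-invRev f (suc m) F g =
  cong (λ z → F (g 0) ℤ.* inv f (suc m) ℤ.+ z) (sum-zipWith-invRev f m F (g ∘ suc))

inv-inverse : ∀ f → f 0 ≡ + 1 → f ⊗ inv f ≈ one
inv-inverse f f₀ = ≈-trans (⊗-⊛ f (inv f)) (pointwise λ
  { zero    → trans (ℤ.+-identityʳ _) (trans (cong (ℤ._* + 1) f₀) refl)
  ; (suc m) → begin
      (f ⊛ inv f) (suc m)
        ≡⟨ ⊛-suc f (inv f) m ⟩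
      f 0 ℤ.* inv f (suc m) ℤ.+ ((f ∘ suc) ⊛ inv f) m
        ≡⟨ cong₂ (λ x y → x ℤ.* inv f (suc m) ℤ.+ y) f₀ (⊛-conv (f ∘ suc) (inv f) m) ⟩
      + 1 ℤ.* inv f (suc m) ℤ.+ conv (f ∘ suc) (inv f) m
        ≡⟨ cong (λ z → z ℤ.+ conv (f ∘ suc) (inv f) m) (ℤ.*-identityˡ (inv f (suc m))) ⟩
      ℤ.- sumℤ (zipWith ℤ._*_ (map (f ∘ suc) (upTo (suc m))) (invRev f m))
        ℤ.+ conv (f ∘ suc) (inv f) m
        ≡⟨ cong (λ z → ℤ.- z ℤ.+ conv (f ∘ suc) (inv f) m)
             (sum-zipWith-invRev f m (f ∘ suc) id) ⟩
      ℤ.- conv (f ∘ suc) (inv f) m ℤ.+ conv (f ∘ suc) (inv f) m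
        ≡⟨ ℤ.+-inverseˡ (conv (f ∘ suc) (inv f) m) ⟩
      + 0 ∎ })
  where open ≡-Reasoning

-- The multisum and its recurrence

∑ˢ : ℕ → (ℕ → Series) → Series
∑ˢ zero    F = 𝟘
∑ˢ (suc n) F = F 0 ⊕ ∑ˢ n (F ∘ suc)

∑ˢ-at : ∀ n F m → ∑ˢ n F m ≡ ∑ n (λ i → F i m)
∑ˢ-at zero    F m = refl
∑ˢ-at (suc n) F m = trans (⊕-at (F 0) (∑ˢ n (F ∘ suc)) m)
                          (cong (λ z → F 0 m ℤ.+ z) (∑ˢ-at n (F ∘ suc) m))

∑ˢ-cong< : ∀ n {F G} → (∀ i → i < n → F i ≈ G i) → ∑ˢ n F ≈ ∑ˢ n G
∑ˢ-cong< zero    eq = ≈-refl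
∑ˢ-cong< (suc n) eq = ⊕-cong (eq 0 (s≤s z≤n)) (∑ˢ-cong< n λ i i<n → eq (suc i) (s≤s i<n))

∑ˢ-cong : ∀ n {F G} → (∀ i → F i ≈ G i) → ∑ˢ n F ≈ ∑ˢ n G
∑ˢ-cong n eq = ∑ˢ-cong< n (λ i _ → eq i)

∑ˢ-⊕ : ∀ n F G → ∑ˢ n (λ i → F i ⊕ G i) ≈ ∑ˢ n F ⊕ ∑ˢ n G
∑ˢ-⊕ zero    F G = ≈-sym (⊕-identityˡ 𝟘)
∑ˢ-⊕ (suc n) F G = ≈-trans (⊕-cong ≈-refl (∑ˢ-⊕ n (F ∘ suc) (G ∘ suc)))
  (solve 4 (λ a b c d → (a :+ b) :+ (c :+ d) := (a :+ c) :+ (b :+ d)) ≈-refl (F 0) (G 0) _ _)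
  where open Solver

∑ˢ-⊗ : ∀ n h F → ∑ˢ n (λ i → h ⊗ F i) ≈ h ⊗ ∑ˢ n F
∑ˢ-⊗ zero    h F = ≈-sym (⊗-zeroʳ h)
∑ˢ-⊗ (suc n) h F = ≈-trans (⊕-cong ≈-refl (∑ˢ-⊗ n h (F ∘ suc)))
                           (≈-sym (⊗-distribˡ h (F 0) (∑ˢ n (F ∘ suc))))

∑ˢ-last : ∀ n F → ∑ˢ (suc n) F ≈ ∑ˢ n F ⊕ F n
∑ˢ-last zero    F = ⊕-comm (F 0) 𝟘
∑ˢ-last (suc n) F = ≈-trans (⊕-cong ≈-refl (∑ˢ-last n (F ∘ suc)))
                            (≈-sym (⊕-assoc (F 0) (∑ˢ n (F ∘ suc)) (F (suc n))))

oneMinus-⊕-mono : ∀ e → oneMinus (+ 1) e ⊕ mono e ≈ one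
oneMinus-⊕-mono e = pointwise λ n →
  trans (⊕-at (oneMinus (+ 1) e) (mono e) n) (cancel (one n) (mono e n))
  where
  cancel : ∀ a b → a ℤ.- (+ 1) ℤ.* b ℤ.+ b ≡ a
  cancel = Data.Integer.Tactic.RingSolver.solve-∀

⊛-const : ∀ f g → f 0 ≡ + 1 → g 0 ≡ + 1 → (f ⊛ g) 0 ≡ + 1
⊛-const f g p q = cong₂ (λ x y → x ℤ.* y ℤ.+ + 0) p q

1/[q²] : ℕ → Series
1/[q²] n = inv (qPoch (+ 1) 2 2 n)

qPoch-const : ∀ n → qPoch (+ 1) 2 2 n 0 ≡ + 1
qPoch-const zero    = refl
qPoch-const (suc n) = ⊛-const (qPoch (+ 1) 2 2 n) (oneMinus (+ 1) (2 ℕ.+ 2 ℕ.* n)) (qPoch-const n) refl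

-- This is (1 - q^(2j+2)) / (q²;q²)_{j+1} = 1 / (q²;q²)_j with the negative term moved over.
1/[q²]-suc : ∀ j → 1/[q²] (suc j) ≈ (mono (2 ℕ.+ 2 ℕ.* j) ⊗ 1/[q²] (suc j)) ⊕ 1/[q²] j
1/[q²]-suc j = ≈-sym (begin
  (m ⊗ I₁) ⊕ I₀
    ≈⟨ ⊕-cong ≈-refl (≈-sym (⊗-identityʳ I₀)) ⟩
  (m ⊗ I₁) ⊕ (I₀ ⊗ one)
    ≈⟨ ⊕-cong ≈-refl (⊗-cong ≈-refl (≈-trans (⊗-cong (⊗-⊛ p d) ≈-refl) (inv-inverse (p ⊛ d) (qPoch-const (suc j))))) ⟨
  (m ⊗ I₁) ⊕ (I₀ ⊗ ((p ⊗ d) ⊗ I₁))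
    ≈⟨ solve 5 (λ m I₁ I₀ p d → (m :* I₁) :+ (I₀ :* ((p :* d) :* I₁))
                 := ((m :* I₁) :+ ((p :* I₀) :* (d :* I₁)))) ≈-refl m I₁ I₀ p d ⟩
  (m ⊗ I₁) ⊕ ((p ⊗ I₀) ⊗ (d ⊗ I₁))
    ≈⟨ ⊕-cong ≈-refl (⊗-cong (inv-inverse p (qPoch-const j)) ≈-refl) ⟩
  (m ⊗ I₁) ⊕ (one ⊗ (d ⊗ I₁))
    ≈⟨ solve 3 (λ m I₁ d → (m :* I₁) :+ (con 1 :* (d :* I₁)) := (d :+ m) :* I₁) ≈-refl m I₁ d ⟩
  (d ⊕ m) ⊗ I₁
    ≈⟨ ⊗-cong (oneMinus-⊕-mono (2 ℕ.+ 2 ℕ.* j)) ≈-refl ⟩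
  one ⊗ I₁
    ≈⟨ ⊗-identityˡ I₁ ⟩
  I₁ ∎)
  where
  open ≈-Reasoning
  open Solver
  m  = mono (2 ℕ.+ 2 ℕ.* j)
  I₀ = 1/[q²] j
  I₁ = 1/[q²] (suc j)
  p  = qPoch (+ 1) 2 2 j
  d  = oneMinus (+ 1) (2 ℕ.+ 2 ℕ.* j)

Family : Set
Family = ℕ → Series

infix 4 _≋_
_≋_ : Family → Family → Set
f ≋ g = ∀ n → f n ≈ g n

infixl 6 _⊞_
_⊞_ : Family → Family → Family
(f ⊞ g) n = f n ⊕ g n

θ σ κ Λ : Family → Family
θ f n       = mono (2 ℕ.* n) ⊗ f n
σ f zero    = 𝟘
σ f (suc n) = f n
κ f zero    = 𝟘
κ f (suc n) = mono (suc (2 ℕ.* n)) ⊗ f n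
Λ f n       = ∑ˢ (suc n) (λ M → mono (M ℕ.* M) ⊗ 1/[q²] (n ∸ M) ⊗ f M)

σ-cong : ∀ {f g} → f ≋ g → σ f ≋ σ g
σ-cong p zero    = ≈-refl
σ-cong p (suc n) = p n

θ-cong : ∀ {f g} → f ≋ g → θ f ≋ θ g
θ-cong p n = ⊗-cong ≈-refl (p n)

Λ-cong : ∀ {f g} → f ≋ g → Λ f ≋ Λ g
Λ-cong p n = ∑ˢ-cong (suc n) λ M → ⊗-cong {mono (M ℕ.* M) ⊗ 1/[q²] (n ∸ M)} ≈-refl (p M)

Λ-⊞ : ∀ f g → Λ (f ⊞ g) ≋ Λ f ⊞ Λ g
Λ-⊞ f g n = ≈-trans
  (∑ˢ-cong (suc n) λ M → ⊗-distribˡ (mono (M ℕ.* M) ⊗ 1/[q²] (n ∸ M)) (f M) (g M))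
  (∑ˢ-⊕ (suc n) (λ M → mono (M ℕ.* M) ⊗ 1/[q²] (n ∸ M) ⊗ f M)
                (λ M → mono (M ℕ.* M) ⊗ 1/[q²] (n ∸ M) ⊗ g M))

Λ-scale : ∀ c f → Λ (λ n → c ⊗ f n) ≋ (λ n → c ⊗ Λ f n)
Λ-scale c f n = ≈-trans
  (∑ˢ-cong (suc n) λ M → solve 4 (λ a b c d → a :* b :* (c :* d) := c :* (a :* b :* d)) ≈-refl
                           (mono (M ℕ.* M)) (1/[q²] (n ∸ M)) c (f M))
  (∑ˢ-⊗ (suc n) c (λ M → mono (M ℕ.* M) ⊗ 1/[q²] (n ∸ M) ⊗ f M))
  where open Solver

σ-⊞ : ∀ f g → σ (f ⊞ g) ≋ σ f ⊞ σ g
σ-⊞ f g zero    = ≈-sym (⊕-identityˡ 𝟘)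
σ-⊞ f g (suc n) = ≈-refl

σ-scale : ∀ c f → σ (λ n → c ⊗ f n) ≋ (λ n → c ⊗ σ f n)
σ-scale c f zero    = ≈-sym (⊗-zeroʳ c)
σ-scale c f (suc n) = ≈-refl

-- Termwise in M: q^(2n) = q^(2M) q^(2(n-M)), and `1/[q²]-suc` merges q^(2(n-M)) / (q²;q²)_{n-M}
-- with the 1 / (q²;q²)_{n-1-M} of the shifted sum. The top term M = n has no shifted partner and
-- agrees on both sides by itself.
θΛ-σΛθ : ∀ f → θ (Λ f) ⊞ σ (Λ (θ f)) ≋ Λ (θ f)
θΛ-σΛθ f zero = solve 2 (λ I a → con 1 :* (con 1 :* I :* a :+ con 0) :+ con 0
                               := con 1 :* I :* (con 1 :* a) :+ con 0) ≈-refl (1/[q²] 0) (f 0)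
  where open Solver
θΛ-σΛθ f (suc n) = begin
  m ⊗ ∑ˢ (suc (suc n)) F ⊕ ∑ˢ (suc n) G
    ≈⟨ ⊕-cong (⊗-cong ≈-refl (∑ˢ-last (suc n) F)) ≈-refl ⟩
  m ⊗ (∑ˢ (suc n) F ⊕ F (suc n)) ⊕ ∑ˢ (suc n) G
    ≈⟨ solve 4 (λ m a b c → m :* (a :+ b) :+ c := (m :* a :+ c) :+ m :* b) ≈-refl m _ _ _ ⟩
  (m ⊗ ∑ˢ (suc n) F ⊕ ∑ˢ (suc n) G) ⊕ m ⊗ F (suc n)
    ≈⟨ ⊕-cong (⊕-cong (∑ˢ-⊗ (suc n) m F) ≈-refl) ≈-refl ⟨
  (∑ˢ (suc n) (λ M → m ⊗ F M) ⊕ ∑ˢ (suc n) G) ⊕ m ⊗ F (suc n)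
    ≈⟨ ⊕-cong (∑ˢ-⊕ (suc n) (λ M → m ⊗ F M) G) ≈-refl ⟨
  ∑ˢ (suc n) (λ M → m ⊗ F M ⊕ G M) ⊕ m ⊗ F (suc n)
    ≈⟨ ⊕-cong (∑ˢ-cong< (suc n) (λ { M (s≤s M≤n) → termwise M M≤n }))
              (solve 4 (λ m a I b → m :* (a :* I :* b) := a :* I :* (m :* b)) ≈-refl
                 m (mono (suc n ℕ.* suc n)) (1/[q²] (n ∸ n)) (f (suc n))) ⟩
  ∑ˢ (suc n) H ⊕ H (suc n)
    ≈⟨ ∑ˢ-last (suc n) H ⟨
  ∑ˢ (suc (suc n)) H ∎
  where
  open ≈-Reasoning
  open Solver
  m = mono (2 ℕ.* suc n)
  F G H : ℕ → Series
  F M = mono (M ℕ.* M) ⊗ 1/[q²] (suc n ∸ M) ⊗ f M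
  G M = mono (M ℕ.* M) ⊗ 1/[q²] (n ∸ M) ⊗ θ f M
  H M = mono (M ℕ.* M) ⊗ 1/[q²] (suc n ∸ M) ⊗ θ f M
  split : ∀ M j → 2 ℕ.* suc (M ℕ.+ j) ≡ 2 ℕ.* M ℕ.+ (2 ℕ.+ 2 ℕ.* j)
  split = Data.Nat.Tactic.RingSolver.solve-∀
  termwise : ∀ M → M ≤ n → m ⊗ F M ⊕ G M ≈ H M
  termwise M M≤n rewrite ℕ.+-∸-assoc 1 M≤n = begin
    m ⊗ (a ⊗ I₁ ⊗ f M) ⊕ a ⊗ I₀ ⊗ (mono (2 ℕ.* M) ⊗ f M)
      ≈⟨ ⊕-cong (⊗-cong m-split ≈-refl) ≈-refl ⟩
    (t ⊗ u) ⊗ (a ⊗ I₁ ⊗ f M) ⊕ a ⊗ I₀ ⊗ (t ⊗ f M)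
      ≈⟨ solve 6 (λ t u a I₁ I₀ x → (t :* u) :* (a :* I₁ :* x) :+ a :* I₀ :* (t :* x)
                   := a :* (u :* I₁ :+ I₀) :* (t :* x)) ≈-refl t u a I₁ I₀ (f M) ⟩
    a ⊗ (u ⊗ I₁ ⊕ I₀) ⊗ (t ⊗ f M)
      ≈⟨ ⊗-cong (⊗-cong ≈-refl (1/[q²]-suc (n ∸ M))) ≈-refl ⟨
    a ⊗ I₁ ⊗ (t ⊗ f M) ∎
    where
    a  = mono (M ℕ.* M)
    t  = mono (2 ℕ.* M)
    u  = mono (2 ℕ.+ 2 ℕ.* (n ∸ M))
    I₀ = 1/[q²] (n ∸ M)
    I₁ = 1/[q²] (suc (n ∸ M))
    m-split : m ≈ t ⊗ u
    m-split = ≈-sym (≈-trans (mono-+ (2 ℕ.* M) (2 ℕ.+ 2 ℕ.* (n ∸ M))) (≈-reflexive (cong mono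
      (trans (sym (split M (n ∸ M))) (cong (λ n → 2 ℕ.* suc n) (ℕ.m+[n∸m]≡n M≤n))))))

-- Reindexing M to M + 1: the square (M+1)² = M² + 2M + 1 yields the factor q and one θ.
Λσ : ∀ f n → Λ (σ f) n ≈ mono 1 ⊗ σ (Λ (θ f)) n
Λσ f zero    = solve 2 (λ I m → con 1 :* I :* con 0 :+ con 0 := m :* con 0) ≈-refl (1/[q²] 0) (mono 1)
  where open Solver
Λσ f (suc n) = begin
  mono 0 ⊗ 1/[q²] (suc n) ⊗ 𝟘 ⊕ ∑ˢ (suc n) (λ M → mono (suc M ℕ.* suc M) ⊗ 1/[q²] (n ∸ M) ⊗ f M)
    ≈⟨ ⊕-cong (⊗-zeroʳ _) (∑ˢ-cong (suc n) termwise) ⟩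
  𝟘 ⊕ ∑ˢ (suc n) (λ M → mono 1 ⊗ (mono (M ℕ.* M) ⊗ 1/[q²] (n ∸ M) ⊗ θ f M))
    ≈⟨ ⊕-identityˡ _ ⟩
  ∑ˢ (suc n) (λ M → mono 1 ⊗ (mono (M ℕ.* M) ⊗ 1/[q²] (n ∸ M) ⊗ θ f M))
    ≈⟨ ∑ˢ-⊗ (suc n) (mono 1) (λ M → mono (M ℕ.* M) ⊗ 1/[q²] (n ∸ M) ⊗ θ f M) ⟩
  mono 1 ⊗ Λ (θ f) n ∎
  where
  open ≈-Reasoning
  open Solver
  square : ∀ M → suc M ℕ.* suc M ≡ suc (M ℕ.* M ℕ.+ 2 ℕ.* M)
  square = Data.Nat.Tactic.RingSolver.solve-∀
  termwise : ∀ M → mono (suc M ℕ.* suc M) ⊗ 1/[q²] (n ∸ M) ⊗ f M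
                 ≈ mono 1 ⊗ (mono (M ℕ.* M) ⊗ 1/[q²] (n ∸ M) ⊗ θ f M)
  termwise M = begin
    mono (suc M ℕ.* suc M) ⊗ 1/[q²] (n ∸ M) ⊗ f M
      ≈⟨ ⊗-cong (⊗-cong (≈-reflexive (cong mono (square M))) ≈-refl) ≈-refl ⟩
    mono (1 ℕ.+ (M ℕ.* M ℕ.+ 2 ℕ.* M)) ⊗ 1/[q²] (n ∸ M) ⊗ f M
      ≈⟨ ⊗-cong (⊗-cong (≈-trans (⊗-cong ≈-refl (mono-+ (M ℕ.* M) (2 ℕ.* M)))
                                 (mono-+ 1 (M ℕ.* M ℕ.+ 2 ℕ.* M))) ≈-refl) ≈-refl ⟨
    mono 1 ⊗ (mono (M ℕ.* M) ⊗ mono (2 ℕ.* M)) ⊗ 1/[q²] (n ∸ M) ⊗ f M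
      ≈⟨ solve 5 (λ q a t I x → q :* (a :* t) :* I :* x := q :* (a :* I :* (t :* x))) ≈-refl
           (mono 1) (mono (M ℕ.* M)) (mono (2 ℕ.* M)) (1/[q²] (n ∸ M)) (f M) ⟩
    mono 1 ⊗ (mono (M ℕ.* M) ⊗ 1/[q²] (n ∸ M) ⊗ θ f M) ∎

-- After `Λσ` this is q times `θΛ-σΛθ`, one index lower.
κΛ-σΛσ : ∀ f → κ (Λ f) ⊞ σ (Λ (σ f)) ≋ Λ (σ f)
κΛ-σΛσ f zero    = ≈-sym (≈-trans (Λσ f 0) (≈-trans (⊗-zeroʳ (mono 1)) (≈-sym (⊕-identityˡ 𝟘))))
κΛ-σΛσ f (suc n) = begin
  mono (suc (2 ℕ.* n)) ⊗ Λ f n ⊕ Λ (σ f) n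
    ≈⟨ ⊕-cong (⊗-cong (≈-sym (mono-+ 1 (2 ℕ.* n))) ≈-refl) (Λσ f n) ⟩
  mono 1 ⊗ mono (2 ℕ.* n) ⊗ Λ f n ⊕ mono 1 ⊗ σ (Λ (θ f)) n
    ≈⟨ solve 4 (λ q t x y → q :* t :* x :+ q :* y := q :* (t :* x :+ y)) ≈-refl
         (mono 1) (mono (2 ℕ.* n)) (Λ f n) (σ (Λ (θ f)) n) ⟩
  mono 1 ⊗ (θ (Λ f) n ⊕ σ (Λ (θ f)) n)
    ≈⟨ ⊗-cong ≈-refl (θΛ-σΛθ f n) ⟩
  mono 1 ⊗ Λ (θ f) n
    ≈⟨ Λσ f (suc n) ⟨
  Λ (σ f) (suc n) ∎
  where
  open ≈-Reasoning
  open Solver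

κ-σθ : ∀ f → κ f ≋ (λ n → mono 1 ⊗ σ (θ f) n)
κ-σθ f zero    = ≈-sym (⊗-zeroʳ (mono 1))
κ-σθ f (suc n) = ≈-trans (⊗-cong (≈-sym (mono-+ 1 (2 ℕ.* n))) ≈-refl)
                         (⊗-assoc (mono 1) (mono (2 ℕ.* n)) (f n))

θσ-κ : ∀ f → θ (σ f) ≋ (λ n → mono 1 ⊗ κ f n)
θσ-κ f zero    = ≈-trans (⊗-zeroʳ (mono 0)) (≈-sym (⊗-zeroʳ (mono 1)))
θσ-κ f (suc n) = ≈-trans
  (⊗-cong (≈-trans (≈-reflexive (cong mono (double n))) (≈-sym (mono-+ 1 (suc (2 ℕ.* n))))) ≈-refl)
  (⊗-assoc (mono 1) (mono (suc (2 ℕ.* n))) (f n))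
  where
  double : ∀ n → 2 ℕ.* suc n ≡ suc (suc (2 ℕ.* n))
  double = Data.Nat.Tactic.RingSolver.solve-∀

-- Since κ = q σθ and θσ = q κ, this is q times `κΛ-σΛσ` at `θ f`.
θσΛθ-σΛκ : ∀ f → θ (σ (Λ (θ f))) ⊞ σ (Λ (κ f)) ≋ Λ (κ f)
θσΛθ-σΛκ f n = begin
  θ (σ (Λ (θ f))) n ⊕ σ (Λ (κ f)) n
    ≈⟨ ⊕-cong (θσ-κ (Λ (θ f)) n)
         (≈-trans (σ-cong (λ M → ≈-trans (Λ-cong (κ-σθ f) M) (Λ-scale (mono 1) (σ (θ f)) M)) n)
                  (σ-scale (mono 1) (Λ (σ (θ f))) n)) ⟩
  mono 1 ⊗ κ (Λ (θ f)) n ⊕ mono 1 ⊗ σ (Λ (σ (θ f))) n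
    ≈⟨ ⊗-distribˡ (mono 1) (κ (Λ (θ f)) n) (σ (Λ (σ (θ f))) n) ⟨
  mono 1 ⊗ (κ (Λ (θ f)) n ⊕ σ (Λ (σ (θ f))) n)
    ≈⟨ ⊗-cong ≈-refl (κΛ-σΛσ (θ f) n) ⟩
  mono 1 ⊗ Λ (σ (θ f)) n
    ≈⟨ Λ-scale (mono 1) (σ (θ f)) n ⟨
  Λ (λ n → mono 1 ⊗ σ (θ f) n) n
    ≈⟨ Λ-cong (κ-σθ f) n ⟨
  Λ (κ f) n ∎
  where open ≈-Reasoning

-- Each unit of `ℓ` is one summation variable, and with no variable left only N = 0 survives. `c`
-- counts down to the next index carrying a linear term; its reset to 1 places these terms at every
-- second index.
β : ℕ → ℕ → Family
β zero    c       zero    = one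
β zero    c       (suc n) = 𝟘
β (suc ℓ) zero            = Λ (θ (β ℓ 1))
β (suc ℓ) (suc c)         = Λ (β ℓ c)

-- What an ascent of at most c + 1 steps contributes, up to `prefactor`: σ for a peak after one
-- step, κ for a peak after two, θ for two steps without a peak, after which the room left has
-- shrunk by two.
α : ℕ → ℕ → Family
α ℓ 0             = σ (β ℓ 0)
α ℓ 1             = σ (β ℓ 1) ⊞ κ (β ℓ 1)
α ℓ (suc (suc c)) = σ (β ℓ (suc (suc c))) ⊞ κ (β ℓ (suc (suc c))) ⊞ θ (α ℓ c)

-- The last hypothesis says X = (1 - σ) Λα. Adding σΛα to both sides of the conclusion makes the
-- hypotheses applicable without subtraction, and it is then cancelled.
cancel-σΛα : ∀ ℓ c (X : Family) →
  β ℓ c ≋ θ (β ℓ (2 ℕ.+ c)) ⊞ α ℓ c →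
  X ⊞ σ (Λ (α ℓ c)) ≋ Λ (α ℓ c) →
  σ (Λ (β ℓ c)) ⊞ X ≋ Λ (α ℓ c) ⊞ σ (Λ (θ (β ℓ (2 ℕ.+ c))))
cancel-σΛα ℓ c X rec eq n = ⊕-cancelʳ (σ Λα n) (begin
  (σ (Λ δ) n ⊕ X n) ⊕ σ Λα n
    ≈⟨ ⊕-assoc (σ (Λ δ) n) (X n) (σ Λα n) ⟩
  σ (Λ δ) n ⊕ (X n ⊕ σ Λα n)
    ≈⟨ ⊕-cong (σ-cong Λδ n) (eq n) ⟩
  σ (Λ (θ δ₂) ⊞ Λα) n ⊕ Λα n
    ≈⟨ ⊕-cong (σ-⊞ (Λ (θ δ₂)) Λα n) ≈-refl ⟩
  (σ (Λ (θ δ₂)) n ⊕ σ Λα n) ⊕ Λα n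
    ≈⟨ solve 3 (λ a b c → (a :+ b) :+ c := (c :+ a) :+ b) ≈-refl _ _ _ ⟩
  (Λα n ⊕ σ (Λ (θ δ₂)) n) ⊕ σ Λα n ∎)
  where
  open ≈-Reasoning
  open Solver
  δ  = β ℓ c
  δ₂ = β ℓ (2 ℕ.+ c)
  Λα = Λ (α ℓ c)
  Λδ : Λ δ ≋ Λ (θ δ₂) ⊞ Λα
  Λδ M = ≈-trans (Λ-cong rec M) (Λ-⊞ (θ δ₂) (α ℓ c) M)

-- Apply Λ to the recurrence for ℓ and move θ out through Λ by `θΛ-σΛθ`. The commutator σΛθβ that
-- this leaves is exactly what `α-rec` absorbs into α one level up. For c = 0 the commutation
-- relation is the recurrence itself.
β-rec : ∀ ℓ c → c < ℓ → β ℓ c ≋ θ (β ℓ (2 ℕ.+ c)) ⊞ α ℓ c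
-- By `cancel-σΛα` it suffices that the summands of α (ℓ+1) (c+1) other than the leading σ one add
-- up to (1 - σ) Λ (α ℓ c); each of them is handled by one commutation relation.
α-rec : ∀ ℓ c → c < ℓ →
        α (suc ℓ) (suc c) ≋ Λ (α ℓ c) ⊞ σ (Λ (θ (β ℓ (2 ℕ.+ c))))

β-rec (suc ℓ) zero    _         n = ≈-sym (θΛ-σΛθ (β ℓ 1) n)
β-rec (suc ℓ) (suc c) (s≤s c<ℓ) n = begin
  Λ (β ℓ c) n
    ≈⟨ Λ-cong (β-rec ℓ c c<ℓ) n ⟩
  Λ (θ δ₂ ⊞ α ℓ c) n
    ≈⟨ Λ-⊞ (θ δ₂) (α ℓ c) n ⟩
  Λ (θ δ₂) n ⊕ Λ (α ℓ c) n
    ≈⟨ ⊕-cong (θΛ-σΛθ δ₂ n) ≈-refl ⟨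
  (θ (Λ δ₂) n ⊕ σ (Λ (θ δ₂)) n) ⊕ Λ (α ℓ c) n
    ≈⟨ solve 3 (λ a b c → (a :+ b) :+ c := a :+ (c :+ b)) ≈-refl _ _ _ ⟩
  θ (Λ δ₂) n ⊕ (Λ (α ℓ c) n ⊕ σ (Λ (θ δ₂)) n)
    ≈⟨ ⊕-cong ≈-refl (α-rec ℓ c c<ℓ n) ⟨
  θ (Λ δ₂) n ⊕ α (suc ℓ) (suc c) n ∎
  where
  open ≈-Reasoning
  open Solver
  δ₂ = β ℓ (2 ℕ.+ c)

α-rec ℓ zero c<ℓ =
  cancel-σΛα ℓ 0 (κ (Λ (β ℓ 0))) (β-rec ℓ 0 c<ℓ) (κΛ-σΛσ (β ℓ 0))
α-rec ℓ (suc zero) c<ℓ n = ≈-trans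
  (⊕-assoc (σ (Λ δ) n) (κ (Λ δ) n) (θ (σ (Λ (θ δ))) n))
  (cancel-σΛα ℓ 1 (κ (Λ δ) ⊞ θ (σ (Λ (θ δ)))) (β-rec ℓ 1 c<ℓ) remainder n)
  where
  δ = β ℓ 1
  remainder : (κ (Λ δ) ⊞ θ (σ (Λ (θ δ)))) ⊞ σ (Λ (α ℓ 1)) ≋ Λ (α ℓ 1)
  remainder M = begin
    (κ (Λ δ) M ⊕ θ (σ (Λ (θ δ))) M) ⊕ σ (Λ (α ℓ 1)) M
      ≈⟨ ⊕-cong ≈-refl (≈-trans (σ-cong (Λ-⊞ (σ δ) (κ δ)) M) (σ-⊞ (Λ (σ δ)) (Λ (κ δ)) M)) ⟩
    (κ (Λ δ) M ⊕ θ (σ (Λ (θ δ))) M) ⊕ (σ (Λ (σ δ)) M ⊕ σ (Λ (κ δ)) M)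
      ≈⟨ solve 4 (λ a b c d → (a :+ b) :+ (c :+ d) := (a :+ c) :+ (b :+ d)) ≈-refl _ _ _ _ ⟩
    (κ (Λ δ) M ⊕ σ (Λ (σ δ)) M) ⊕ (θ (σ (Λ (θ δ))) M ⊕ σ (Λ (κ δ)) M)
      ≈⟨ ⊕-cong (κΛ-σΛσ δ M) (θσΛθ-σΛκ δ M) ⟩
    Λ (σ δ) M ⊕ Λ (κ δ) M
      ≈⟨ Λ-⊞ (σ δ) (κ δ) M ⟨
    Λ (α ℓ 1) M ∎
    where
    open ≈-Reasoning
    open Solver
α-rec ℓ (suc (suc c)) c<ℓ n = ≈-trans
  (⊕-assoc (σ (Λ δ) n) (κ (Λ δ) n) (θ (α (suc ℓ) (suc c)) n))
  (cancel-σΛα ℓ (2 ℕ.+ c) (κ (Λ δ) ⊞ θ (α (suc ℓ) (suc c))) (β-rec ℓ (2 ℕ.+ c) c<ℓ) remainder n)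
  where
  δ = β ℓ (2 ℕ.+ c)
  γ = α ℓ c
  -- The recursive call splits θα into θΛγ and θσΛθδ. Then κΛ pairs with Λσ, θσΛθ with Λκ and θΛ
  -- with Λθ, one pair for each summand of α ℓ (2 + c).
  remainder : (κ (Λ δ) ⊞ θ (α (suc ℓ) (suc c))) ⊞ σ (Λ (α ℓ (2 ℕ.+ c))) ≋ Λ (α ℓ (2 ℕ.+ c))
  remainder M = begin
    (κ (Λ δ) M ⊕ θ (α (suc ℓ) (suc c)) M) ⊕ σ (Λ (α ℓ (2 ℕ.+ c))) M
      ≈⟨ ⊕-cong (⊕-cong ≈-refl (θ-cong (α-rec ℓ c (ℕ.<-trans (ℕ.m≤n+m (suc c) 1) c<ℓ)) M))
                (≈-trans (σ-cong Λα M) (≈-trans (σ-⊞ (Λ (σ δ) ⊞ Λ (κ δ)) (Λ (θ γ)) M)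
                         (⊕-cong (σ-⊞ (Λ (σ δ)) (Λ (κ δ)) M) ≈-refl))) ⟩
    (κ (Λ δ) M ⊕ t ⊗ (Λ γ M ⊕ σ (Λ (θ δ)) M)) ⊕ ((σ (Λ (σ δ)) M ⊕ σ (Λ (κ δ)) M) ⊕ σ (Λ (θ γ)) M)
      ≈⟨ solve 7 (λ a t b c d e f → (a :+ t :* (b :+ c)) :+ ((d :+ e) :+ f)
                   := ((a :+ d) :+ (t :* c :+ e)) :+ (t :* b :+ f)) ≈-refl _ t _ _ _ _ _ ⟩
    ((κ (Λ δ) M ⊕ σ (Λ (σ δ)) M) ⊕ (θ (σ (Λ (θ δ))) M ⊕ σ (Λ (κ δ)) M))
      ⊕ (θ (Λ γ) M ⊕ σ (Λ (θ γ)) M)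
      ≈⟨ ⊕-cong (⊕-cong (κΛ-σΛσ δ M) (θσΛθ-σΛκ δ M)) (θΛ-σΛθ γ M) ⟩
    (Λ (σ δ) M ⊕ Λ (κ δ) M) ⊕ Λ (θ γ) M
      ≈⟨ Λα M ⟨
    Λ (α ℓ (2 ℕ.+ c)) M ∎
    where
    open ≈-Reasoning
    open Solver
    t = mono (2 ℕ.* M)
    Λα : Λ (α ℓ (2 ℕ.+ c)) ≋ Λ (σ δ) ⊞ Λ (κ δ) ⊞ Λ (θ γ)
    Λα K = ≈-trans (Λ-⊞ (σ δ ⊞ κ δ) (θ γ) K) (⊕-cong (Λ-⊞ (σ δ) (κ δ) K) ≈-refl)

-- The first linear index c + 2 lies beyond N_ℓ, so `c` is invisible. In the base case ℓ = 1 the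
-- factor q^(2 N₂) sits on a variable forced to be 0. For paths this is the floor: at height 0 an E
-- step replaces the fall and leaves h unchanged.
β-stable : ∀ ℓ c → ℓ ≤ suc c → β ℓ (suc c) ≋ β ℓ c
β-stable zero          c       _         zero    = ≈-refl
β-stable zero          c       _         (suc n) = ≈-refl
β-stable (suc ℓ)       (suc c) (s≤s ℓ≤c)         = Λ-cong (β-stable ℓ c ℓ≤c)
β-stable (suc zero)    zero    _                 = Λ-cong β₀-θβ₀
  where
  β₀-θβ₀ : β 0 0 ≋ θ (β 0 1)
  β₀-θβ₀ zero    = ≈-sym (⊗-identityˡ one)
  β₀-θβ₀ (suc n) = ≈-sym (⊗-zeroʳ (mono (2 ℕ.* suc n)))
β-stable (suc (suc ℓ)) zero    (s≤s ())

Λ-at-zero : ∀ f → Λ f 0 ≈ f 0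
Λ-at-zero f = ≈-trans (⊕-identityʳ _) (≈-trans (⊗-cong (⊗-identityˡ (1/[q²] 0)) ≈-refl)
  (≈-trans (⊗-cong inv-one ≈-refl) (⊗-identityˡ (f 0))))
  where
  inv-one : 1/[q²] 0 ≈ one
  inv-one = ≈-trans (≈-sym (⊗-identityˡ (1/[q²] 0))) (inv-inverse one refl)

β-zero : ∀ ℓ c → β ℓ c 0 ≈ one
β-zero zero    c       = ≈-refl
β-zero (suc ℓ) zero    = ≈-trans (Λ-at-zero (θ (β ℓ 1))) (≈-trans (⊗-identityˡ _) (β-zero ℓ 1))
β-zero (suc ℓ) (suc c) = ≈-trans (Λ-at-zero (β ℓ c)) (β-zero ℓ c)

-- Counting words accepted by the path automaton

-- Words of length at most `ℓ`, not exactly `ℓ`: beyond the longest accepted word the value no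
-- longer depends on `ℓ`, so the recurrences need not track lengths.
cnt : ℕ → (List Step → Bool) → ℕ
cnt zero    P = if P [] then 1 else 0
cnt (suc ℓ) P = (if P [] then 1 else 0) ℕ.+
  (cnt ℓ (P ∘ (NE ∷_)) ℕ.+ (cnt ℓ (P ∘ (SE ∷_)) ℕ.+ (cnt ℓ (P ∘ (N ∷_)) ℕ.+ cnt ℓ (P ∘ (E ∷_)))))

cnt-cong : ∀ ℓ {P Q : List Step → Bool} → (∀ s → P s ≡ Q s) → cnt ℓ P ≡ cnt ℓ Q
cnt-cong zero    eq rewrite eq [] = refl
cnt-cong (suc ℓ) eq rewrite eq [] | cnt-cong ℓ (eq ∘ (NE ∷_)) | cnt-cong ℓ (eq ∘ (SE ∷_))
  | cnt-cong ℓ (eq ∘ (N ∷_)) | cnt-cong ℓ (eq ∘ (E ∷_)) = refl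

cnt-false : ∀ ℓ → cnt ℓ (λ _ → false) ≡ 0
cnt-false zero    = refl
cnt-false (suc ℓ) rewrite cnt-false ℓ = refl

cnt-∧ : ∀ ℓ b P → cnt ℓ (λ s → b ∧ P s) ≡ (if b then cnt ℓ P else 0)
cnt-∧ ℓ true  P = refl
cnt-∧ ℓ false P = cnt-false ℓ

¬T⇒false : ∀ {b} → (T b → ⊥) → b ≡ false
¬T⇒false {false} _ = refl
¬T⇒false {true}  f = ⊥-elim (f tt)

cnt-only-[] : ∀ P → (∀ s → T (P s) → length s ≤ 0) → ∀ t → cnt 0 (P ∘ (t ∷_)) ≡ 0
cnt-only-[] P bound t =
  cnt-cong 0 {P ∘ (t ∷_)} {λ _ → false} (λ s → ¬T⇒false (λ p → ℕ.n≮0 (bound (t ∷ s) p)))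

cnt-suc : ∀ ℓ (P : List Step → Bool) → (∀ s → T (P s) → length s ≤ ℓ) → cnt (suc ℓ) P ≡ cnt ℓ P
cnt-suc zero P bound
  rewrite cnt-only-[] P bound NE | cnt-only-[] P bound SE | cnt-only-[] P bound N
        | cnt-only-[] P bound E = ℕ.+-identityʳ _
cnt-suc (suc ℓ) P bound
  rewrite cnt-suc ℓ (P ∘ (NE ∷_)) (λ s t → ℕ.s≤s⁻¹ (bound (NE ∷ s) t))
        | cnt-suc ℓ (P ∘ (SE ∷_)) (λ s t → ℕ.s≤s⁻¹ (bound (SE ∷ s) t))
        | cnt-suc ℓ (P ∘ (N ∷_)) (λ s t → ℕ.s≤s⁻¹ (bound (N ∷ s) t))
        | cnt-suc ℓ (P ∘ (E ∷_)) (λ s t → ℕ.s≤s⁻¹ (bound (E ∷ s) t)) = refl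

cnt-stable : ∀ {ℓ ℓ′} (P : List Step → Bool) → (∀ s → T (P s) → length s ≤ ℓ) → ℓ ≤ ℓ′ →
             cnt ℓ′ P ≡ cnt ℓ P
cnt-stable {ℓ} P bound ℓ≤ℓ′ with ℕ.≤⇒≤′ ℓ≤ℓ′
... | ℕ.≤′-refl           = refl
... | ℕ.≤′-step {n} ℓ≤′n = trans
  (cnt-suc n P (λ s t → ℕ.≤-trans (bound s t) (ℕ.≤′⇒≤ ℓ≤′n)))
  (cnt-stable P bound (ℕ.≤′⇒≤ ℓ≤′n))

data Mode : Set where
  fall flat rise jump : Mode

mayClimb : Mode → Bool → Bool
mayClimb fall b = b
mayClimb flat b = b
mayClimb rise _ = true
mayClimb jump _ = false

level : Mode → Bool
level fall = true
level flat = true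
level rise = false
level jump = false

final : Mode → Bool
final fall = true
final _    = false

-- Reads a path suffix starting at height h.  The mode is the kind of the previous
-- step (fall also at the start of the path), the flag b tells whether an ascent may
-- start at the current vertex, m is the number of remaining peaks and n their
-- major index relative to the current abscissa; so a step to the right lowers
-- n by the number of peaks after it.
acc : ℕ → Mode → ℕ → Bool → ℕ → ℕ → List Step → Bool
acc k md   h       b m       n []       = final md ∧ (h ≡ᵇ 0) ∧ (m ≡ᵇ 0) ∧ (n ≡ᵇ 0)
acc k md   h       b m       n (NE ∷ s) =
  (mayClimb md b ∧ (suc h <ᵇ k)) ∧ (m ≤ᵇ n) ∧ acc k rise (suc h) (not b) m (n ∸ m) s
acc k md   h       b m       n (N ∷ s)  =
  (mayClimb md b ∧ (suc h <ᵇ k)) ∧ acc k jump (suc h) (not b) m n s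
acc k md   (suc h) b m       n (E ∷ s)  = false
acc k md   zero    b m       n (E ∷ s)  = level md ∧ (m ≤ᵇ n) ∧ acc k flat zero (not b) m (n ∸ m) s
acc k md   zero    b m       n (SE ∷ s) = false
acc k flat (suc h) b m       n (SE ∷ s) = false
acc k fall (suc h) b m       n (SE ∷ s) = (m ≤ᵇ n) ∧ acc k fall h (not b) m (n ∸ m) s
acc k rise (suc h) b zero    n (SE ∷ s) = false
acc k jump (suc h) b zero    n (SE ∷ s) = false
acc k rise (suc h) b (suc m) n (SE ∷ s) = (m ≤ᵇ n) ∧ acc k fall h (not b) m (n ∸ m) s
acc k jump (suc h) b (suc m) n (SE ∷ s) = (m ≤ᵇ n) ∧ acc k fall h (not b) m (n ∸ m) s

T-∧ˡ : ∀ {a b} → T (a ∧ b) → T a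
T-∧ˡ {true} _ = tt

T-∧ʳ : ∀ {a b} → T (a ∧ b) → T b
T-∧ʳ {true} t = t

T-∧-intro : ∀ {a b} → T a → T b → T (a ∧ b)
T-∧-intro {true} _ t = t

data NotFall : Mode → Set where
  flat : NotFall flat
  rise : NotFall rise
  jump : NotFall jump

-- A path must end with SE, and the first SE after an E, NE or N step is preceded by an up step,
-- because E occurs only at height 0. So a peak is still to come.
acc-no-peak : ∀ {k md h b n} s → NotFall md → T (acc k md h b 0 n s) → ⊥
acc-no-peak []       flat ()
acc-no-peak []       rise ()
acc-no-peak []       jump ()
acc-no-peak {k} {md} {h} {b} (NE ∷ s) c t =
  acc-no-peak s rise (T-∧ʳ {mayClimb md b ∧ (suc h <ᵇ k)} t)
acc-no-peak {k} {md} {h} {b} (N ∷ s) c t =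
  acc-no-peak s jump (T-∧ʳ {mayClimb md b ∧ (suc h <ᵇ k)} t)
acc-no-peak {h = zero} {b} (E ∷ s) flat t = acc-no-peak s flat t
acc-no-peak {h = zero}  (SE ∷ s) flat ()
acc-no-peak {h = zero}  (SE ∷ s) rise ()
acc-no-peak {h = zero}  (SE ∷ s) jump ()
acc-no-peak {h = suc h} (SE ∷ s) flat ()
acc-no-peak {h = suc h} (SE ∷ s) rise ()
acc-no-peak {h = suc h} (SE ∷ s) jump ()

-- A potential for the remaining length. SE lowers h; NE raises h by one but lowers n, of weight 2,
-- by m ≥ 1; E lowers n. Only N raises the potential, by one; the SE forced after it is a peak and
-- removes 3 through m, and `lag` carries the debt of 2 from the N step to that peak.
lenBound : ℕ → ℕ → ℕ → ℕ
lenBound h m n = 3 ℕ.* m ℕ.+ 2 ℕ.* n ℕ.+ h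

lag : Mode → ℕ
lag jump = 2
lag _    = 0

lenBound-move : ∀ h m n → suc m ≤ n → suc (lenBound (suc h) (suc m) (n ∸ suc m)) ≤ lenBound h (suc m) n
lenBound-move h m (suc n) (s≤s m≤n) = begin
  suc (lenBound (suc h) (suc m) (n ∸ m))
    ≡⟨ regroup h m (n ∸ m) ⟩
  lenBound h (suc m) (suc (n ∸ m))
    ≤⟨ ℕ.+-monoˡ-≤ h (ℕ.+-monoʳ-≤ (3 ℕ.* suc m) (ℕ.*-monoʳ-≤ 2 (s≤s (ℕ.m∸n≤m n m)))) ⟩
  lenBound h (suc m) (suc n) ∎
  where
  open ℕ.≤-Reasoning
  regroup : ∀ h m d → suc (3 ℕ.* suc m ℕ.+ 2 ℕ.* d ℕ.+ suc h) ≡ 3 ℕ.* suc m ℕ.+ 2 ℕ.* suc d ℕ.+ h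
  regroup = Data.Nat.Tactic.RingSolver.solve-∀

lenBound-fall : ∀ h m n → suc (lenBound h m (n ∸ m)) ≤ lenBound (suc h) m n
lenBound-fall h m n = begin
  suc (lenBound h m (n ∸ m)) ≡⟨ ℕ.+-suc (3 ℕ.* m ℕ.+ 2 ℕ.* (n ∸ m)) h ⟨
  lenBound (suc h) m (n ∸ m) ≤⟨ ℕ.+-monoˡ-≤ (suc h) (ℕ.+-monoʳ-≤ (3 ℕ.* m) (ℕ.*-monoʳ-≤ 2 (ℕ.m∸n≤m n m))) ⟩
  lenBound (suc h) m n       ∎
  where open ℕ.≤-Reasoning

lenBound-peak : ∀ h m n → 3 ℕ.+ lenBound h m (n ∸ m) ≤ lenBound (suc h) (suc m) n
lenBound-peak h m n = begin
  3 ℕ.+ lenBound h m (n ∸ m)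
    ≤⟨ ℕ.n≤1+n _ ⟩
  4 ℕ.+ lenBound h m (n ∸ m)
    ≡⟨ regroup h m (n ∸ m) ⟩
  lenBound (suc h) (suc m) (n ∸ m)
    ≤⟨ ℕ.+-monoˡ-≤ (suc h) (ℕ.+-monoʳ-≤ (3 ℕ.* suc m) (ℕ.*-monoʳ-≤ 2 (ℕ.m∸n≤m n m))) ⟩
  lenBound (suc h) (suc m) n ∎
  where
  open ℕ.≤-Reasoning
  regroup : ∀ h m d → 4 ℕ.+ (3 ℕ.* m ℕ.+ 2 ℕ.* d ℕ.+ h) ≡ 3 ℕ.* suc m ℕ.+ 2 ℕ.* d ℕ.+ suc h
  regroup = Data.Nat.Tactic.RingSolver.solve-∀

climb-notJump : ∀ {md b c} → T (mayClimb md b ∧ c) → lag md ≡ 0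
climb-notJump {fall} _ = refl
climb-notJump {flat} _ = refl
climb-notJump {rise} _ = refl

level-notJump : ∀ {md c} → T (level md ∧ c) → lag md ≡ 0
level-notJump {fall} _ = refl
level-notJump {flat} _ = refl

acc-length : ∀ {k} md h b m n s → T (acc k md h b m n s) → lag md ℕ.+ length s ≤ lenBound h m n
acc-length fall h b m n [] t = z≤n
acc-length {k} md h b zero n (NE ∷ s) t = ⊥-elim (acc-no-peak s rise (T-∧ʳ {mayClimb md b ∧ (suc h <ᵇ k)} t))
acc-length {k} md h b (suc m) n (NE ∷ s) t
  rewrite climb-notJump {md} {b} {suc h <ᵇ k} (T-∧ˡ t) =
  ℕ.≤-trans (s≤s (acc-length rise (suc h) (not b) (suc m) (n ∸ suc m) s (T-∧ʳ {suc m ≤ᵇ n} t′)))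
            (lenBound-move h m n (ℕ.≤ᵇ⇒≤ (suc m) n (T-∧ˡ t′)))
  where t′ = T-∧ʳ {mayClimb md b ∧ (suc h <ᵇ k)} t
acc-length {k} md h b zero n (N ∷ s) t = ⊥-elim (acc-no-peak s jump (T-∧ʳ {mayClimb md b ∧ (suc h <ᵇ k)} t))
acc-length {k} md h b (suc m) n (N ∷ s) t
  rewrite climb-notJump {md} {b} {suc h <ᵇ k} (T-∧ˡ t) =
  ℕ.s≤s⁻¹ (ℕ.≤-trans (acc-length jump (suc h) (not b) (suc m) n s (T-∧ʳ {mayClimb md b ∧ (suc h <ᵇ k)} t))
                     (ℕ.≤-reflexive (ℕ.+-suc (3 ℕ.* suc m ℕ.+ 2 ℕ.* n) h)))
acc-length md zero b zero n (E ∷ s) t = ⊥-elim (acc-no-peak s flat (T-∧ʳ {level md} t))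
acc-length md zero b (suc m) n (E ∷ s) t rewrite level-notJump {md} {(suc m ≤ᵇ n) ∧ acc _ flat zero (not b) (suc m) (n ∸ suc m) s} t =
  ℕ.≤-trans (s≤s (ℕ.≤-trans (acc-length flat zero (not b) (suc m) (n ∸ suc m) s (T-∧ʳ {suc m ≤ᵇ n} t′))
                            (ℕ.+-monoʳ-≤ (3 ℕ.* suc m ℕ.+ 2 ℕ.* (n ∸ suc m)) (z≤n {1}))))
            (lenBound-move zero m n (ℕ.≤ᵇ⇒≤ (suc m) n (T-∧ˡ t′)))
  where t′ = T-∧ʳ {level md} t
acc-length flat zero    b m n (SE ∷ s) ()
acc-length fall (suc h) b m n (SE ∷ s) t =
  ℕ.≤-trans (s≤s (acc-length fall h (not b) m (n ∸ m) s (T-∧ʳ {m ≤ᵇ n} t))) (lenBound-fall h m n)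
acc-length rise zero    b zero n (SE ∷ s) ()
acc-length rise (suc h) b zero n (SE ∷ s) ()
acc-length jump zero    b zero n (SE ∷ s) ()
acc-length jump (suc h) b zero n (SE ∷ s) ()
acc-length rise (suc h) b (suc m) n (SE ∷ s) t =
  ℕ.≤-trans (s≤s (acc-length fall h (not b) m (n ∸ m) s (T-∧ʳ {m ≤ᵇ n} t)))
            (ℕ.≤-trans (ℕ.m≤n+m _ 2) (lenBound-peak h m n))
acc-length jump (suc h) b (suc m) n (SE ∷ s) t =
  ℕ.≤-trans (s≤s (s≤s (s≤s (acc-length fall h (not b) m (n ∸ m) s (T-∧ʳ {m ≤ᵇ n} t)))))
            (lenBound-peak h m n)

abstract
  num : ℕ → Mode → ℕ → Bool → ℕ → ℕ → ℕ
  num k md h b m n = cnt (lenBound h m n) (acc k md h b m n)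

  num-cnt : ∀ k md h b m n → cnt (lenBound h m n) (acc k md h b m n) ≡ num k md h b m n
  num-cnt k md h b m n = refl

cnt-acc : ∀ {ℓ} k md h b m n → lenBound h m n ≤ ℓ → cnt ℓ (acc k md h b m n) ≡ num k md h b m n
cnt-acc k md h b m n le = trans
  (cnt-stable (acc k md h b m n) (λ s t → ℕ.m+n≤o⇒n≤o (lag md) (acc-length md h b m n s t)) le)
  (num-cnt k md h b m n)

when : Bool → ℕ → ℕ
when b x = if b then x else 0

lenBound-mono : ∀ {h h′ m m′ n n′} → h ≤ h′ → m ≤ m′ → n ≤ n′ → lenBound h m n ≤ lenBound h′ m′ n′
lenBound-mono h≤h′ m≤m′ n≤n′ =
  ℕ.+-mono-≤ (ℕ.+-mono-≤ (ℕ.*-monoʳ-≤ 3 m≤m′) (ℕ.*-monoʳ-≤ 2 n≤n′)) h≤h′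

cnt-move : ∀ {ℓ} k md h b m n → lenBound h m n ≤ ℓ →
  cnt ℓ (λ s → (m ≤ᵇ n) ∧ acc k md h b m (n ∸ m) s) ≡ when (m ≤ᵇ n) (num k md h b m (n ∸ m))
cnt-move {ℓ} k md h b m n le = trans (cnt-∧ ℓ (m ≤ᵇ n) (acc k md h b m (n ∸ m)))
  (cong (when (m ≤ᵇ n)) (cnt-acc k md h b m (n ∸ m)
    (ℕ.≤-trans (lenBound-mono {h} ℕ.≤-refl (ℕ.≤-refl {m}) (ℕ.m∸n≤m n m)) le)))

numMove : ℕ → Mode → ℕ → Bool → ℕ → ℕ → ℕ
numMove k md h b m n = when (m ≤ᵇ n) (num k md h b m (n ∸ m))

-- The length budget is one more than `lenBound (suc h) m n`. What remains after the first step then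
-- covers every suffix, even the one after an N step, where h has grown while m and n are unchanged.
num-unfold : ∀ k md h b m n {e w x y z} →
  (if acc k md h b m n [] then 1 else 0) ≡ e →
  cnt (lenBound (suc h) m n) (acc k md h b m n ∘ (NE ∷_)) ≡ w →
  cnt (lenBound (suc h) m n) (acc k md h b m n ∘ (SE ∷_)) ≡ x →
  cnt (lenBound (suc h) m n) (acc k md h b m n ∘ (N ∷_)) ≡ y →
  cnt (lenBound (suc h) m n) (acc k md h b m n ∘ (E ∷_)) ≡ z →
  num k md h b m n ≡ e ℕ.+ (w ℕ.+ (x ℕ.+ (y ℕ.+ z)))
num-unfold k md h b m n refl refl refl refl refl = sym (cnt-acc k md h b m n
  (ℕ.m≤n⇒m≤1+n (lenBound-mono (ℕ.n≤1+n h) (ℕ.≤-refl {m}) (ℕ.≤-refl {n}))))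

cnt-NE : ∀ k h m n md b → cnt (lenBound (suc h) m n) (acc k md h b m n ∘ (NE ∷_))
       ≡ when (mayClimb md b ∧ (suc h <ᵇ k)) (numMove k rise (suc h) (not b) m n)
cnt-NE k h m n md b = trans
  (cnt-∧ (lenBound (suc h) m n) (mayClimb md b ∧ (suc h <ᵇ k))
         (λ s → (m ≤ᵇ n) ∧ acc k rise (suc h) (not b) m (n ∸ m) s))
  (cong (when (mayClimb md b ∧ (suc h <ᵇ k))) (cnt-move k rise (suc h) (not b) m n ℕ.≤-refl))

cnt-N : ∀ k h m n md b → cnt (lenBound (suc h) m n) (acc k md h b m n ∘ (N ∷_))
      ≡ when (mayClimb md b ∧ (suc h <ᵇ k)) (num k jump (suc h) (not b) m n)
cnt-N k h m n md b = trans
  (cnt-∧ (lenBound (suc h) m n) (mayClimb md b ∧ (suc h <ᵇ k)) (acc k jump (suc h) (not b) m n))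
  (cong (when (mayClimb md b ∧ (suc h <ᵇ k))) (cnt-acc k jump (suc h) (not b) m n ℕ.≤-refl))

numClimb : ℕ → ℕ → Bool → ℕ → ℕ → ℕ
numClimb k h b m n = when (suc h <ᵇ k)
  (numMove k rise (suc h) (not b) m n ℕ.+ num k jump (suc h) (not b) m n)

collect-E : ∀ a b x y z →
  when (a ∧ b) x ℕ.+ (0 ℕ.+ (when (a ∧ b) y ℕ.+ z)) ≡ z ℕ.+ when a (when b (x ℕ.+ y))
collect-E true  true  x y z = regroup x y z
  where
  regroup : ∀ x y z → x ℕ.+ (y ℕ.+ z) ≡ z ℕ.+ (x ℕ.+ y)
  regroup = Data.Nat.Tactic.RingSolver.solve-∀
collect-E true  false x y z = sym (ℕ.+-identityʳ z)
collect-E false b     x y z = sym (ℕ.+-identityʳ z)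

collect-SE : ∀ a b x y z →
  when (a ∧ b) x ℕ.+ (z ℕ.+ (when (a ∧ b) y ℕ.+ 0)) ≡ z ℕ.+ when a (when b (x ℕ.+ y))
collect-SE a b x y z = trans (regroup (when (a ∧ b) x) (when (a ∧ b) y) z) (collect-E a b x y z)
  where
  regroup : ∀ u v z → u ℕ.+ (z ℕ.+ (v ℕ.+ 0)) ≡ u ℕ.+ (0 ℕ.+ (v ℕ.+ z))
  regroup = Data.Nat.Tactic.RingSolver.solve-∀

when-zero : ∀ b → when b 0 ≡ 0
when-zero true  = refl
when-zero false = refl

num-fall-suc : ∀ k h b m n → num k fall (suc h) b m n
             ≡ numMove k fall h (not b) m n ℕ.+ when b (numClimb k (suc h) b m n)
num-fall-suc k h b m n = trans
  (num-unfold k fall (suc h) b m n refl (cnt-NE k (suc h) m n fall b)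
    (cnt-move k fall h (not b) m n (lenBound-mono (ℕ.m≤n+m h 2) (ℕ.≤-refl {m}) (ℕ.≤-refl {n})))
    (cnt-N k (suc h) m n fall b) (cnt-false (lenBound (2 ℕ.+ h) m n)))
  (collect-SE b (2 ℕ.+ h <ᵇ k) _ _ _)

num-rise-suc : ∀ k h b m n → num k rise (suc h) b (suc m) n
             ≡ numMove k fall h (not b) m n ℕ.+ numClimb k (suc h) b (suc m) n
num-rise-suc k h b m n = trans
  (num-unfold k rise (suc h) b (suc m) n refl (cnt-NE k (suc h) (suc m) n rise b)
    (cnt-move k fall h (not b) m n (lenBound-mono (ℕ.m≤n+m h 2) (ℕ.n≤1+n m) (ℕ.≤-refl {n})))
    (cnt-N k (suc h) (suc m) n rise b) (cnt-false (lenBound (2 ℕ.+ h) (suc m) n)))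
  (collect-SE true (2 ℕ.+ h <ᵇ k) _ _ _)

num-jump-suc : ∀ k h b m n → num k jump (suc h) b (suc m) n ≡ numMove k fall h (not b) m n
num-jump-suc k h b m n = trans
  (num-unfold k jump (suc h) b (suc m) n refl (cnt-NE k (suc h) (suc m) n jump b)
    (cnt-move k fall h (not b) m n (lenBound-mono (ℕ.m≤n+m h 2) (ℕ.n≤1+n m) (ℕ.≤-refl {n})))
    (cnt-N k (suc h) (suc m) n jump b) (cnt-false (lenBound (2 ℕ.+ h) (suc m) n)))
  (ℕ.+-identityʳ _)

num-fall-zero : ∀ k b m n → num k fall 0 b (suc m) n
              ≡ numMove k flat 0 (not b) (suc m) n ℕ.+ when b (numClimb k 0 b (suc m) n)
num-fall-zero k b m n = trans
  (num-unfold k fall 0 b (suc m) n refl (cnt-NE k 0 (suc m) n fall b)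
    (cnt-false (lenBound 1 (suc m) n)) (cnt-N k 0 (suc m) n fall b)
    (cnt-move k flat 0 (not b) (suc m) n (lenBound-mono (z≤n {1}) (ℕ.≤-refl {suc m}) (ℕ.≤-refl {n}))))
  (collect-E b (1 <ᵇ k) _ _ _)

-- At height 0 the two modes differ only on the empty word, and with a peak still to come neither
-- accepts it.
num-flat-fall : ∀ k b m n → num k flat 0 b (suc m) n ≡ num k fall 0 b (suc m) n
num-flat-fall k b m n = trans (sym (num-cnt k flat 0 b (suc m) n))
  (trans (cnt-cong (lenBound 0 (suc m) n) same) (num-cnt k fall 0 b (suc m) n))
  where
  same : ∀ s → acc k flat 0 b (suc m) n s ≡ acc k fall 0 b (suc m) n s
  same []       = refl
  same (NE ∷ s) = refl
  same (SE ∷ s) = refl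
  same (N ∷ s)  = refl
  same (E ∷ s)  = refl

num-no-peak : ∀ k md h b n → NotFall md → num k md h b 0 n ≡ 0
num-no-peak k md h b n c = trans (sym (num-cnt k md h b 0 n)) (trans
  (cnt-cong (lenBound h 0 n) {Q = λ _ → false} (λ s → ¬T⇒false (acc-no-peak s c)))
  (cnt-false (lenBound h 0 n)))

numClimb-no-peak : ∀ k h b n → numClimb k h b 0 n ≡ 0
numClimb-no-peak k h b n
  rewrite num-no-peak k rise (suc h) (not b) n rise | num-no-peak k jump (suc h) (not b) n jump
  with suc h <ᵇ k
... | true  = refl
... | false = refl

num-fall-no-peak : ∀ k h b n → num k fall h b 0 n ≡ (if n ≡ᵇ 0 then 1 else 0)
num-fall-no-peak k zero b n = trans
  (num-unfold k fall 0 b 0 n refl (cnt-NE k 0 0 n fall b)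
    (cnt-false (lenBound 1 0 n)) (cnt-N k 0 0 n fall b)
    (cnt-move k flat 0 (not b) 0 n (lenBound-mono (z≤n {1}) (ℕ.≤-refl {0}) (ℕ.≤-refl {n}))))
  (trans (cong (λ x → (if n ≡ᵇ 0 then 1 else 0) ℕ.+ x) (trans (collect-E b (1 <ᵇ k) _ _ _)
    (cong₂ ℕ._+_ (num-no-peak k flat 0 (not b) n flat)
                 (trans (cong (when b) (numClimb-no-peak k 0 b n)) (when-zero b)))))
    (ℕ.+-identityʳ _))
num-fall-no-peak k (suc h) b n = trans (num-fall-suc k h b 0 n) (trans
  (cong₂ ℕ._+_ (num-fall-no-peak k h (not b) n)
               (trans (cong (when b) (numClimb-no-peak k (suc h) b n)) (when-zero b)))
  (ℕ.+-identityʳ _))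

-- Generating functions of paths

pathGF : ℕ → Mode → ℕ → Bool → Family
pathGF k md h b m n = + num k md h b m n

climb : ℕ → ℕ → Bool → Family
climb k h b m n = + numClimb k h b m n

-- The guard m ≤ n is the vanishing of q^m f below degree m.
numMove-⊗ : ∀ k md h b m n → + numMove k md h b m n ≡ (mono m ⊗ pathGF k md h b m) n
numMove-⊗ k md h b m n with m ℕ.≤? n
... | yes m≤n rewrite Bool.T-≡ .Equivalence.to (ℕ.≤⇒≤ᵇ m≤n) = sym (mono-⊗ m (pathGF k md h b m) n m≤n)
... | no  m≰n rewrite ¬T⇒false (λ t → m≰n (ℕ.≤ᵇ⇒≤ m n t)) =
  sym (mono-⊗-< m (pathGF k md h b m) n (ℕ.≰⇒> m≰n))

pathGF-fall-suc-true : ∀ k h m →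
  pathGF k fall (suc h) true m ≈ (mono m ⊗ pathGF k fall h false m) ⊕ climb k (suc h) true m
pathGF-fall-suc-true k h m = pointwise λ n → trans (cong +_ (num-fall-suc k h true m n))
  (trans (cong (λ z → z ℤ.+ climb k (suc h) true m n) (numMove-⊗ k fall h false m n))
         (sym (⊕-at (mono m ⊗ pathGF k fall h false m) (climb k (suc h) true m) n)))

pathGF-fall-suc-false : ∀ k h m → pathGF k fall (suc h) false m ≈ mono m ⊗ pathGF k fall h true m
pathGF-fall-suc-false k h m = pointwise λ n → trans (cong +_ (num-fall-suc k h false m n))
  (trans (cong +_ (ℕ.+-identityʳ _)) (numMove-⊗ k fall h true m n))

pathGF-flat-fall : ∀ k b m → pathGF k flat 0 b (suc m) ≈ pathGF k fall 0 b (suc m)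
pathGF-flat-fall k b m = pointwise λ n → cong +_ (num-flat-fall k b m n)

pathGF-fall-zero-true : ∀ k m →
  pathGF k fall 0 true (suc m) ≈ (mono (suc m) ⊗ pathGF k fall 0 false (suc m)) ⊕ climb k 0 true (suc m)
pathGF-fall-zero-true k m = ≈-trans
  (pointwise λ n → trans (cong +_ (num-fall-zero k true m n))
    (trans (cong (λ z → z ℤ.+ climb k 0 true (suc m) n) (numMove-⊗ k flat 0 false (suc m) n))
           (sym (⊕-at (mono (suc m) ⊗ pathGF k flat 0 false (suc m)) (climb k 0 true (suc m)) n))))
  (⊕-cong (⊗-cong ≈-refl (pathGF-flat-fall k false m)) ≈-refl)

pathGF-fall-zero-false : ∀ k m → pathGF k fall 0 false (suc m) ≈ mono (suc m) ⊗ pathGF k fall 0 true (suc m)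
pathGF-fall-zero-false k m = ≈-trans
  (pointwise λ n → trans (cong +_ (num-fall-zero k false m n))
    (trans (cong +_ (ℕ.+-identityʳ _)) (numMove-⊗ k flat 0 true (suc m) n)))
  (⊗-cong ≈-refl (pathGF-flat-fall k true m))

pathGF-fall-no-peak : ∀ k h b → pathGF k fall h b 0 ≈ one
pathGF-fall-no-peak k h b = pointwise λ n → trans (cong +_ (num-fall-no-peak k h b n)) (if-+ (n ≡ᵇ 0))
  where
  if-+ : ∀ b → + (if b then 1 else 0) ≡ (if b then + 1 else + 0)
  if-+ true  = refl
  if-+ false = refl

climb-top : ∀ k h b m → k ≤ suc h → climb k h b m ≈ 𝟘
climb-top k h b m k≤ rewrite ¬T⇒false {suc h <ᵇ k} (λ t → ℕ.<⇒≱ (ℕ.<ᵇ⇒< (suc h) k t) k≤) = ≈-refl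

-- The first up step is N (factor 1) or NE (factor q^(m+1), all m + 1 peaks lie ahead). If it ends
-- in a peak, the SE step after it moves the other m peaks and returns to height h with the flag
-- restored: together q^m (1 + q^(m+1)). Otherwise it was NE and the ascent continues.
climb-rec : ∀ k h b m → suc h < k →
  climb k h b (suc m) ≈ mono m ⊗ (one ⊕ mono (suc m)) ⊗ pathGF k fall h (not (not b)) m
                        ⊕ mono (suc m) ⊗ climb k (suc h) (not b) (suc m)
climb-rec k h b m h<k = ≈-trans (pointwise expand) (begin
  mono (suc m) ⊗ pathGF k rise (suc h) (not b) (suc m) ⊕ pathGF k jump (suc h) (not b) (suc m)
    ≈⟨ ⊕-cong (⊗-cong ≈-refl X-rise) X-jump ⟩
  mono (suc m) ⊗ (mono m ⊗ D ⊕ A) ⊕ mono m ⊗ D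
    ≈⟨ solve 4 (λ p q d a → p :* (q :* d :+ a) :+ q :* d := q :* (con 1 :+ p) :* d :+ p :* a) ≈-refl
         (mono (suc m)) (mono m) D A ⟩
  mono m ⊗ (one ⊕ mono (suc m)) ⊗ D ⊕ mono (suc m) ⊗ A ∎)
  where
  open ≈-Reasoning
  open Solver
  D = pathGF k fall h (not (not b)) m
  A = climb k (suc h) (not b) (suc m)
  X-jump : pathGF k jump (suc h) (not b) (suc m) ≈ mono m ⊗ D
  X-jump = pointwise λ n → trans (cong +_ (num-jump-suc k h (not b) m n))
                                 (numMove-⊗ k fall h (not (not b)) m n)
  X-rise : pathGF k rise (suc h) (not b) (suc m) ≈ mono m ⊗ D ⊕ A
  X-rise = pointwise λ n → trans (cong +_ (num-rise-suc k h (not b) m n))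
    (trans (cong (λ z → z ℤ.+ A n) (numMove-⊗ k fall h (not (not b)) m n))
           (sym (⊕-at (mono m ⊗ D) A n)))
  expand : ∀ n → climb k h b (suc m) n
         ≡ (mono (suc m) ⊗ pathGF k rise (suc h) (not b) (suc m) ⊕ pathGF k jump (suc h) (not b) (suc m)) n
  expand n rewrite Bool.T-≡ .Equivalence.to (ℕ.<⇒<ᵇ h<k) =
    trans (cong (λ z → z ℤ.+ pathGF k jump (suc h) (not b) (suc m) n)
                (numMove-⊗ k rise (suc h) (not b) (suc m) n))
          (sym (⊕-at (mono (suc m) ⊗ pathGF k rise (suc h) (not b) (suc m))
                     (pathGF k jump (suc h) (not b) (suc m)) n))

-- Multiplication by a positive power of q makes each coefficient depend on smaller ones only. This
-- replaces induction on the height at height 0, where two E steps lead back to the same state.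
mono-fixpoint-unique : ∀ e r {f g} → f ≈ mono (suc e) ⊗ f ⊕ r → g ≈ mono (suc e) ⊗ g ⊕ r → f ≈ g
mono-fixpoint-unique e r {f} {g} p q = pointwise (<-rec (λ n → f n ≡ g n) step)
  where
  step : ∀ n → (∀ {i} → i < n → f i ≡ g i) → f n ≡ g n
  step n ih = begin
    f n                                ≡⟨ at p n ⟩
    (mono (suc e) ⊗ f ⊕ r) n           ≡⟨ ⊕-at (mono (suc e) ⊗ f) r n ⟩
    (mono (suc e) ⊗ f) n ℤ.+ r n       ≡⟨ cong (λ z → z ℤ.+ r n) (shifted (suc e ℕ.≤? n)) ⟩
    (mono (suc e) ⊗ g) n ℤ.+ r n       ≡⟨ ⊕-at (mono (suc e) ⊗ g) r n ⟨
    (mono (suc e) ⊗ g ⊕ r) n           ≡⟨ at q n ⟨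
    g n                                ∎
    where
    open ≡-Reasoning
    shifted : Dec (suc e ≤ n) → (mono (suc e) ⊗ f) n ≡ (mono (suc e) ⊗ g) n
    shifted (yes e<n) = trans (mono-⊗ (suc e) f n e<n)
      (trans (ih (ℕ.∸-monoʳ-< {n} (s≤s z≤n) e<n)) (sym (mono-⊗ (suc e) g n e<n)))
    shifted (no  e≮n) = trans (mono-⊗-< (suc e) f n (ℕ.≰⇒> e≮n)) (sym (mono-⊗-< (suc e) g n (ℕ.≰⇒> e≮n)))

-- This is q^(m(m-1)/2) (-q;q)_m, built with the factor that `climb-rec` produces per peak; the 1 +
-- q^(m+1) is the choice between an NSE and a NESE peak.
prefactor : Family
prefactor zero    = one
prefactor (suc m) = mono m ⊗ (one ⊕ mono (suc m)) ⊗ prefactor m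

mono-double : ∀ e → mono e ⊗ mono e ≈ mono (2 ℕ.* e)
mono-double e = ≈-trans (mono-+ e e) (≈-reflexive (cong (λ z → mono (e ℕ.+ z)) (sym (ℕ.+-identityʳ e))))

PathsFromHeights : ℕ → ℕ → Set
PathsFromHeights ℓ m = ∀ c h → suc (c ℕ.+ h) ≡ ℓ → pathGF (suc ℓ) fall h true m ≈ prefactor m ⊗ β ℓ c m

-- Two unfoldings of `climb-rec` return to an odd index. After a peak on the second up step the path
-- is at an even index, so a further fall is forced; with the initial NE step it gives q^(m+1) q^m =
-- q^(2m+1), the factor of κ. Two NE steps give q^(2m+2), the factor of θ.
climb-β : ∀ ℓ m → PathsFromHeights ℓ m → ∀ c h → suc (c ℕ.+ h) ≡ ℓ →
          climb (suc ℓ) h true (suc m) ≈ prefactor (suc m) ⊗ α ℓ c (suc m)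
climb-β ℓ m ih zero h refl = begin
  climb (suc ℓ) h true (suc m)
    ≈⟨ climb-rec (suc ℓ) h true m ℕ.≤-refl ⟩
  u ⊗ pathGF (suc ℓ) fall h true m ⊕ mono (suc m) ⊗ climb (suc ℓ) (suc h) false (suc m)
    ≈⟨ ⊕-cong (⊗-cong ≈-refl (ih 0 h refl)) (⊗-cong ≈-refl (climb-top (suc ℓ) (suc h) false (suc m) ℕ.≤-refl)) ⟩
  u ⊗ (prefactor m ⊗ β ℓ 0 m) ⊕ mono (suc m) ⊗ 𝟘
    ≈⟨ solve 4 (λ u p b x → u :* (p :* b) :+ x :* con 0 := u :* p :* b) ≈-refl u (prefactor m) (β ℓ 0 m) (mono (suc m)) ⟩
  u ⊗ prefactor m ⊗ β ℓ 0 m ∎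
  where
  open ≈-Reasoning
  open Solver
  u = mono m ⊗ (one ⊕ mono (suc m))
climb-β ℓ m ih (suc c) h refl = begin
  climb (suc ℓ) h true (suc m)
    ≈⟨ climb-rec (suc ℓ) h true m (s≤s (s≤s (ℕ.m≤n+m h (suc c)))) ⟩
  u ⊗ D ⊕ v ⊗ climb (suc ℓ) (suc h) false (suc m)
    ≈⟨ ⊕-cong ≈-refl (⊗-cong ≈-refl (climb-rec (suc ℓ) (suc h) false m (s≤s (s≤s (s≤s (ℕ.m≤n+m h c)))))) ⟩
  u ⊗ D ⊕ v ⊗ (u ⊗ pathGF (suc ℓ) fall (suc h) false m ⊕ v ⊗ A)
    ≈⟨ ⊕-cong (⊗-cong ≈-refl D-β) (⊗-cong ≈-refl (⊕-cong
         (⊗-cong ≈-refl (≈-trans (pathGF-fall-suc-false (suc ℓ) h m) (⊗-cong ≈-refl D-β))) ≈-refl)) ⟩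
  u ⊗ (prefactor m ⊗ δ) ⊕ v ⊗ (u ⊗ (mono m ⊗ (prefactor m ⊗ δ)) ⊕ v ⊗ A)
    ≈⟨ solve 6 (λ u v w p d a → u :* (p :* d) :+ v :* (u :* (w :* (p :* d)) :+ v :* a)
                 := u :* p :* (d :+ (v :* w) :* d) :+ (v :* v) :* a) ≈-refl u v (mono m) (prefactor m) δ A ⟩
  u ⊗ prefactor m ⊗ (δ ⊕ (v ⊗ mono m) ⊗ δ) ⊕ (v ⊗ v) ⊗ A
    ≈⟨ ⊕-cong (⊗-cong ≈-refl (⊕-cong ≈-refl (⊗-cong odd ≈-refl))) (⊗-cong (mono-double (suc m)) ≈-refl) ⟩
  prefactor (suc m) ⊗ (δ ⊕ mono (suc (2 ℕ.* m)) ⊗ δ) ⊕ mono (2 ℕ.* suc m) ⊗ A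
    ≈⟨ fold c refl ⟩
  prefactor (suc m) ⊗ α ℓ (suc c) (suc m) ∎
  where
  open ≈-Reasoning
  open Solver
  u = mono m ⊗ (one ⊕ mono (suc m))
  v = mono (suc m)
  D = pathGF (suc ℓ) fall h true m
  A = climb (suc ℓ) (2 ℕ.+ h) true (suc m)
  δ = β ℓ (suc c) m
  D-β : D ≈ prefactor m ⊗ δ
  D-β = ih (suc c) h refl
  odd : v ⊗ mono m ≈ mono (suc (2 ℕ.* m))
  odd = ≈-trans (mono-+ (suc m) m) (≈-reflexive (cong (λ z → mono (suc (m ℕ.+ z))) (sym (ℕ.+-identityʳ m))))
  fold : ∀ c′ → c′ ≡ c →
    prefactor (suc m) ⊗ (δ ⊕ mono (suc (2 ℕ.* m)) ⊗ δ) ⊕ mono (2 ℕ.* suc m) ⊗ A ≈ prefactor (suc m) ⊗ α ℓ (suc c) (suc m)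
  -- A third up step would reach height k.
  fold zero     refl = ≈-trans
    (⊕-cong ≈-refl (≈-trans (⊗-cong ≈-refl (climb-top (suc ℓ) (2 ℕ.+ h) true (suc m) ℕ.≤-refl))
                            (⊗-zeroʳ (mono (2 ℕ.* suc m)))))
    (⊕-identityʳ _)
  fold (suc c″) refl = ≈-trans
    (⊕-cong ≈-refl (⊗-cong ≈-refl (climb-β ℓ m ih c″ (2 ℕ.+ h) shift)))
    (solve 4 (λ p d t a → p :* d :+ t :* (p :* a) := p :* (d :+ t :* a)) ≈-refl
       (prefactor (suc m)) (δ ⊕ mono (suc (2 ℕ.* m)) ⊗ δ) (mono (2 ℕ.* suc m)) (α ℓ c″ (suc m)))
    where
    shift : suc (c″ ℕ.+ (2 ℕ.+ h)) ≡ suc (suc (suc c″) ℕ.+ h)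
    shift = cong suc (trans (ℕ.+-suc c″ (suc h)) (cong suc (ℕ.+-suc c″ h)))

module _ (ℓ m : ℕ) (ih : PathsFromHeights ℓ m) where
  private
    v² : Series
    v² = mono (2 ℕ.* suc m)

  -- `c₂` records where two steps without an ascent lead: 2 + c in general, but from heights 1 and 0
  -- the floor stops the descent, and the result is 1 + c or c.
  prefactor-β-rec : ∀ c h → suc (c ℕ.+ h) ≡ ℓ → ∀ c₂ → β ℓ (2 ℕ.+ c) ≋ β ℓ c₂ →
    prefactor (suc m) ⊗ β ℓ c (suc m) ≈ v² ⊗ (prefactor (suc m) ⊗ β ℓ c₂ (suc m)) ⊕ climb (suc ℓ) h true (suc m)
  prefactor-β-rec c h eq c₂ same = begin
    prefactor (suc m) ⊗ β ℓ c (suc m)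
      ≈⟨ ⊗-cong ≈-refl (β-rec ℓ c (ℕ.≤-trans (ℕ.m≤m+n (suc c) h) (ℕ.≤-reflexive eq)) (suc m)) ⟩
    prefactor (suc m) ⊗ (v² ⊗ β ℓ (2 ℕ.+ c) (suc m) ⊕ α ℓ c (suc m))
      ≈⟨ ⊗-cong ≈-refl (⊕-cong (⊗-cong ≈-refl (same (suc m))) ≈-refl) ⟩
    prefactor (suc m) ⊗ (v² ⊗ β ℓ c₂ (suc m) ⊕ α ℓ c (suc m))
      ≈⟨ solve 4 (λ p t b a → p :* (t :* b :+ a) := t :* (p :* b) :+ p :* a) ≈-refl
           (prefactor (suc m)) v² (β ℓ c₂ (suc m)) (α ℓ c (suc m)) ⟩
    v² ⊗ (prefactor (suc m) ⊗ β ℓ c₂ (suc m)) ⊕ prefactor (suc m) ⊗ α ℓ c (suc m)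
      ≈⟨ ⊕-cong ≈-refl (climb-β ℓ m ih c h eq) ⟨
    v² ⊗ (prefactor (suc m) ⊗ β ℓ c₂ (suc m)) ⊕ climb (suc ℓ) h true (suc m) ∎
    where
    open ≈-Reasoning
    open Solver

  twoFalls : ∀ {f g h} → f ≈ mono (suc m) ⊗ g → g ≈ mono (suc m) ⊗ h → f ≈ v² ⊗ h
  twoFalls p q = ≈-trans p (≈-trans (⊗-cong ≈-refl q) (≈-trans
    (≈-sym (⊗-assoc (mono (suc m)) (mono (suc m)) _)) (⊗-cong (mono-double (suc m)) ≈-refl)))

  -- The number of peaks is fixed here and the recursion lowers the height by two. Height 1 goes
  -- through SE and E to height 0; height 0 returns to itself and is settled by the uniqueness of
  -- the fixpoint.
  paths-suc : PathsFromHeights ℓ (suc m)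
  paths-suc c zero eq = mono-fixpoint-unique _ (climb (suc ℓ) 0 true (suc m))
    (≈-trans (pathGF-fall-zero-true (suc ℓ) m)
             (⊕-cong (twoFalls ≈-refl (pathGF-fall-zero-false (suc ℓ) m)) ≈-refl))
    (prefactor-β-rec c 0 eq c λ n → ≈-trans (β-stable ℓ (suc c) (ℕ.≤-trans ℓ≤ (ℕ.n≤1+n _)) n) (β-stable ℓ c ℓ≤ n))
    where
    ℓ≤ : ℓ ≤ suc c
    ℓ≤ = ℕ.≤-reflexive (trans (sym eq) (cong suc (ℕ.+-identityʳ c)))
  paths-suc c (suc zero) eq = ≈-trans (pathGF-fall-suc-true (suc ℓ) 0 (suc m)) (≈-trans
    (⊕-cong (twoFalls ≈-refl (≈-trans (pathGF-fall-zero-false (suc ℓ) m)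
              (⊗-cong ≈-refl (paths-suc (suc c) 0 (trans (cong suc (sym (ℕ.+-suc c 0))) eq))))) ≈-refl)
    (≈-sym (prefactor-β-rec c 1 eq (suc c) (β-stable ℓ (suc c) (ℕ.≤-reflexive
       (trans (sym eq) (cong suc (trans (ℕ.+-suc c 0) (cong suc (ℕ.+-identityʳ c))))))))))
  paths-suc c (suc (suc h)) eq = ≈-trans (pathGF-fall-suc-true (suc ℓ) (suc h) (suc m)) (≈-trans
    (⊕-cong (twoFalls ≈-refl (≈-trans (pathGF-fall-suc-false (suc ℓ) h (suc m))
              (⊗-cong ≈-refl (paths-suc (2 ℕ.+ c) h (trans (cong suc shift) eq))))) ≈-refl)
    (≈-sym (prefactor-β-rec c (2 ℕ.+ h) eq (2 ℕ.+ c) (λ _ → ≈-refl))))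
    where
    shift : 2 ℕ.+ c ℕ.+ h ≡ c ℕ.+ (2 ℕ.+ h)
    shift = sym (trans (ℕ.+-suc c (suc h)) (cong suc (ℕ.+-suc c h)))

paths-β : ∀ ℓ m → PathsFromHeights ℓ m
paths-β ℓ zero    c h eq = ≈-trans (pathGF-fall-no-peak (suc ℓ) h true)
  (≈-sym (≈-trans (⊗-identityˡ (β ℓ c 0)) (β-zero ℓ c)))
paths-β ℓ (suc m) = paths-suc ℓ m (paths-β ℓ m)

-- Index 0 is even, so no ascent starts there: the first step is SE, or E at height 0, where
-- truncated subtraction gives the right height `0 ∸ 1 = 0`.
pathGF-start : ∀ k d m → pathGF k fall d false m ≈ mono m ⊗ pathGF k fall (d ∸ 1) true m
pathGF-start k zero    zero    = ≈-trans (pathGF-fall-no-peak k 0 false)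
  (≈-sym (≈-trans (⊗-identityˡ _) (pathGF-fall-no-peak k 0 true)))
pathGF-start k zero    (suc m) = pathGF-fall-zero-false k m
pathGF-start k (suc d) m       = pathGF-fall-suc-false k d m

pathGF-start-β : ∀ ℓ c m → c ≤ ℓ → pathGF (suc ℓ) fall (ℓ ∸ c) false m ≈ mono m ⊗ (prefactor m ⊗ β ℓ c m)
pathGF-start-β ℓ c m c≤ℓ = ≈-trans (pathGF-start (suc ℓ) (ℓ ∸ c) m) (⊗-cong ≈-refl (below (ℓ ∸ c) ℓ (ℕ.m+[n∸m]≡n c≤ℓ)))
  where
  below : ∀ d ℓ → c ℕ.+ d ≡ ℓ → pathGF (suc ℓ) fall (d ∸ 1) true m ≈ prefactor m ⊗ β ℓ c m
  below (suc d) ℓ       eq = paths-β ℓ m c d (trans (sym (ℕ.+-suc c d)) eq)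
  -- Here k = 1: no ascent fits under the bound, and the equation f = q^(2m+2) f left by the E steps
  -- has only the solution 0. This matches β 0, which vanishes except at N = 0.
  below zero    zero    eq rewrite trans (sym (ℕ.+-identityʳ c)) eq = flatOnly m
    where
    flatOnly : ∀ m → pathGF 1 fall 0 true m ≈ prefactor m ⊗ β 0 0 m
    flatOnly zero    = ≈-trans (pathGF-fall-no-peak 1 0 true) (≈-sym (⊗-identityˡ one))
    flatOnly (suc m) = ≈-trans
      (mono-fixpoint-unique _ 𝟘
        (≈-trans (pathGF-fall-zero-true 1 m) (⊕-cong (≈-trans (⊗-cong ≈-refl (pathGF-fall-zero-false 1 m))
           (≈-trans (≈-sym (⊗-assoc (mono (suc m)) (mono (suc m)) _)) (⊗-cong (mono-double (suc m)) ≈-refl)))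
           (climb-top 1 0 true (suc m) ℕ.≤-refl)))
        (≈-sym (≈-trans (⊕-identityʳ _) (⊗-zeroʳ _))))
      (≈-sym (⊗-zeroʳ (prefactor (suc m))))
  -- Here c = k - 1 and the path starts at height 0. The E step stays there, and height 0 belongs to
  -- c = k - 2; `β-stable` identifies the two values.
  below zero    (suc ℓ) eq rewrite trans (sym (ℕ.+-identityʳ c)) eq =
    ≈-trans (paths-β (suc ℓ) m ℓ 0 (cong suc (ℕ.+-identityʳ ℓ)))
            (⊗-cong ≈-refl (≈-sym (β-stable (suc ℓ) ℓ ℕ.≤-refl m)))

-- The right-hand side

∑-extend : ∀ n b (f : ℕ → ℤ) → n ≤ b → (∀ i → n ≤ i → f i ≡ + 0) → ∑ b f ≡ ∑ n f
∑-extend zero    b       f _         f≡0 = trans (∑-cong b (λ i → f≡0 i z≤n)) (∑-zero b)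
∑-extend (suc n) (suc b) f (s≤s n≤b) f≡0 =
  cong (λ z → f 0 ℤ.+ z) (∑-extend n b (f ∘ suc) n≤b (λ i n≤i → f≡0 (suc i) (s≤s n≤i)))

-- The substitution m = i + M. `b` is separate from `n` because the induction lowers the diagonal
-- bound while the range of `i` stays fixed.
∑-triangle : ∀ n b (h : ℕ → ℕ → ℤ) → n ≤ b → (∀ i M → n ≤ i ℕ.+ M → h i M ≡ + 0) →
             ∑ n (λ M → ∑ b (λ i → h i M)) ≡ ∑ n (λ m → ∑ (suc m) (λ M → h (m ∸ M) M))
∑-triangle zero    b h n≤b h≡0 = refl
∑-triangle (suc n) b h n<b h≡0 = begin
  ∑ b (λ i → h i 0) ℤ.+ ∑ n (λ M → ∑ b (λ i → h i (suc M)))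
    ≡⟨ cong₂ ℤ._+_
         (∑-extend (suc n) b (λ i → h i 0) n<b (λ i n<i → h≡0 i 0 (ℕ.≤-trans n<i (ℕ.m≤m+n i 0))))
         (∑-triangle n b (λ i M → h i (suc M)) (ℕ.<⇒≤ n<b)
           (λ i M n≤ → h≡0 i (suc M) (ℕ.≤-trans (s≤s n≤) (ℕ.≤-reflexive (sym (ℕ.+-suc i M)))))) ⟩
  ∑ (suc n) (λ i → h i 0) ℤ.+ ∑ n (λ m → ∑ (suc m) (λ M → h (m ∸ M) (suc M)))
    ≡⟨ cong (λ z → ∑ (suc n) (λ i → h i 0) ℤ.+ z) (ℤ.+-identityˡ (∑ n (λ m → ∑ (suc m) (λ M → h (m ∸ M) (suc M))))) ⟨
  ∑ (suc n) (λ i → h i 0) ℤ.+ ∑ (suc n) (λ m → ∑ m (λ M → h (m ∸ suc M) (suc M)))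
    ≡⟨ ∑-+ (suc n) (λ i → h i 0) (λ m → ∑ m (λ M → h (m ∸ suc M) (suc M))) ⟨
  ∑ (suc n) (λ m → ∑ (suc m) (λ M → h (m ∸ M) M)) ∎
  where open ≡-Reasoning

sumℤ-++ : ∀ xs ys → sumℤ (xs ++ ys) ≡ sumℤ xs ℤ.+ sumℤ ys
sumℤ-++ []       ys = sym (ℤ.+-identityˡ (sumℤ ys))
sumℤ-++ (x ∷ xs) ys = trans (cong (λ z → x ℤ.+ z) (sumℤ-++ xs ys)) (sym (ℤ.+-assoc x (sumℤ xs) (sumℤ ys)))

sumℤ-tuples : ∀ ℓ B (f : List ℕ → ℤ) → sumℤ (map f (tuples (suc ℓ) B))
            ≡ ∑ (suc B) (λ i → sumℤ (map (f ∘ (i ∷_)) (tuples ℓ B)))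
sumℤ-tuples ℓ B f = blocks id (suc B)
  where
  blocks : ∀ (g : ℕ → ℕ) n →
    sumℤ (map f (concatMap (λ i → map (i ∷_) (tuples ℓ B)) (applyUpTo g n)))
    ≡ ∑ n (λ i → sumℤ (map (f ∘ (g i ∷_)) (tuples ℓ B)))
  blocks g zero    = refl
  blocks g (suc n) = begin
    sumℤ (map f (first ++ rest))
      ≡⟨ cong sumℤ (List.map-++ f first rest) ⟩
    sumℤ (map f first ++ map f rest)
      ≡⟨ sumℤ-++ (map f first) (map f rest) ⟩
    sumℤ (map f first) ℤ.+ sumℤ (map f rest)
      ≡⟨ cong₂ (λ u v → sumℤ u ℤ.+ v) (sym (List.map-∘ (tuples ℓ B))) (blocks (g ∘ suc) n) ⟩
    sumℤ (map (f ∘ (g 0 ∷_)) (tuples ℓ B))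
      ℤ.+ ∑ n (λ i → sumℤ (map (f ∘ (g (suc i) ∷_)) (tuples ℓ B))) ∎
    where
    open ≡-Reasoning
    first = map (g 0 ∷_) (tuples ℓ B)
    rest  = concatMap (λ i → map (i ∷_) (tuples ℓ B)) (applyUpTo (g ∘ suc) n)

sumℤ-tuples-cong : ∀ ℓ B {f g : List ℕ → ℤ} → (∀ ns → length ns ≡ ℓ → f ns ≡ g ns) →
                   sumℤ (map f (tuples ℓ B)) ≡ sumℤ (map g (tuples ℓ B))
sumℤ-tuples-cong zero    B {f} {g} eq = cong (λ z → z ℤ.+ + 0) (eq [] refl)
sumℤ-tuples-cong (suc ℓ) B {f} {g} eq = trans (sumℤ-tuples ℓ B f) (trans
  (∑-cong (suc B) λ i → sumℤ-tuples-cong ℓ B (λ ns len → eq (i ∷ ns) (cong suc len)))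
  (sym (sumℤ-tuples ℓ B g)))

1/product : List ℕ → Series
1/product = foldr (λ n f → 1/[q²] n ⊗ f) one

-- The quadratic and linear exponents of N₂, N₃, …; c is the number of entries
-- before the first one that carries a linear term 2 Nᵢ.
tailExponent : ℕ → List ℕ → ℕ
tailExponent c       []       = 0
tailExponent zero    (n ∷ ns) = sumℕ (n ∷ ns) ℕ.* sumℕ (n ∷ ns) ℕ.+ 2 ℕ.* sumℕ (n ∷ ns) ℕ.+ tailExponent 1 ns
tailExponent (suc c) (n ∷ ns) = sumℕ (n ∷ ns) ℕ.* sumℕ (n ∷ ns) ℕ.+ tailExponent c ns

tailExponent-zero : ∀ ns → tailExponent 0 ns
  ≡ sumℕ ns ℕ.* sumℕ ns ℕ.+ 2 ℕ.* sumℕ ns ℕ.+ tailExponent 1 (drop 1 ns)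
tailExponent-zero []       = refl
tailExponent-zero (n ∷ ns) = refl

tailExponent-suc : ∀ c ns → tailExponent (suc c) ns
  ≡ sumℕ ns ℕ.* sumℕ ns ℕ.+ tailExponent c (drop 1 ns)
tailExponent-suc c []       = refl
tailExponent-suc c (n ∷ ns) = refl

tupleWeight : ℕ → List ℕ → Series
tupleWeight c ns = mono (tailExponent c (drop 1 ns)) ⊗ 1/product ns

VanishesTo : ℕ → Series → Set
VanishesTo n f = ∀ m → m ≤ n → f m ≡ + 0

vanishes-⊗ : ∀ {n f} g → VanishesTo n f → VanishesTo n (f ⊗ g)
vanishes-⊗ {n} {f} g f≡0 m m≤n = begin
  (f ⊗ g) m                          ≡⟨ at (⊗-⊛ f g) m ⟩
  (f ⊛ g) m                          ≡⟨ ⊛-conv f g m ⟩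
  conv f g m                         ≡⟨ ∑-cong< (suc m) (λ { i (s≤s i≤m) →
                                          cong (ℤ._* g (m ∸ i)) (f≡0 i (ℕ.≤-trans i≤m m≤n)) }) ⟩
  ∑ (suc m) (λ i → + 0 ℤ.* g (m ∸ i)) ≡⟨ ∑-cong (suc m) (λ i → ℤ.*-zeroˡ (g (m ∸ i))) ⟩
  ∑ (suc m) (λ _ → + 0)              ≡⟨ ∑-zero (suc m) ⟩
  + 0                                ∎
  where open ≡-Reasoning

-- Setting m = i + M, so that i = m - M, produces one application of Λ. Pairs with i + M > B fall
-- outside the new range; there `g` has no coefficient up to `n`, so the truncation of the tuples to
-- a box is harmless.
∑-Λ : ∀ n B (g f : Family) → (∀ m → B < m → VanishesTo n (g m)) →
  ∑ (suc B) (λ i → ∑ (suc B) (λ M → (g (i ℕ.+ M) ⊗ 1/[q²] i ⊗ (mono (M ℕ.* M) ⊗ f M)) n))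
  ≡ ∑ (suc B) (λ m → (g m ⊗ Λ f m) n)
∑-Λ n B g f g≡0 = begin
  ∑ (suc B) (λ i → ∑ (suc B) (h i))
    ≡⟨ ∑-swap (suc B) (suc B) h ⟩
  ∑ (suc B) (λ M → ∑ (suc B) (λ i → h i M))
    ≡⟨ ∑-triangle (suc B) (suc B) h ℕ.≤-refl (λ i M B< →
         vanishes-⊗ (mono (M ℕ.* M) ⊗ f M) (vanishes-⊗ (1/[q²] i) (g≡0 (i ℕ.+ M) B<)) n ℕ.≤-refl) ⟩
  ∑ (suc B) (λ m → ∑ (suc m) (λ M → h (m ∸ M) M))
    ≡⟨ ∑-cong (suc B) column ⟩
  ∑ (suc B) (λ m → (g m ⊗ Λ f m) n) ∎
  where
  open ≡-Reasoning
  h : ℕ → ℕ → ℤ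
  h i M = (g (i ℕ.+ M) ⊗ 1/[q²] i ⊗ (mono (M ℕ.* M) ⊗ f M)) n
  column : ∀ m → ∑ (suc m) (λ M → h (m ∸ M) M) ≡ (g m ⊗ Λ f m) n
  column m = begin
    ∑ (suc m) (λ M → h (m ∸ M) M)
      ≡⟨ ∑-cong< (suc m) (λ { M (s≤s M≤m) → trans
           (cong (λ j → (g j ⊗ 1/[q²] (m ∸ M) ⊗ (mono (M ℕ.* M) ⊗ f M)) n) (ℕ.m∸n+n≡m M≤m))
           (at (solve 4 (λ g I a x → g :* I :* (a :* x) := g :* (a :* I :* x)) ≈-refl
                  (g m) (1/[q²] (m ∸ M)) (mono (M ℕ.* M)) (f M)) n) }) ⟩
    ∑ (suc m) (λ M → (g m ⊗ (mono (M ℕ.* M) ⊗ 1/[q²] (m ∸ M) ⊗ f M)) n)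
      ≡⟨ ∑ˢ-at (suc m) (λ M → g m ⊗ (mono (M ℕ.* M) ⊗ 1/[q²] (m ∸ M) ⊗ f M)) n ⟨
    ∑ˢ (suc m) (λ M → g m ⊗ (mono (M ℕ.* M) ⊗ 1/[q²] (m ∸ M) ⊗ f M)) n
      ≡⟨ at (∑ˢ-⊗ (suc m) (g m) (λ M → mono (M ℕ.* M) ⊗ 1/[q²] (m ∸ M) ⊗ f M)) n ⟩
    (g m ⊗ Λ f m) n ∎
    where open Solver

-- Induction on `ℓ` with an arbitrary weight `g` of N₁. Once n₁ = i is peeled off, g (i + N₂), 1 /
-- (q²;q²)_i and the exponent of N₂ together form a weight of N₂ alone, to which the statement for
-- the shorter tuple applies.
sumℤ-tuples-β : ∀ n B ℓ c (g : Family) → (∀ m → B < m → VanishesTo n (g m)) →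
  sumℤ (map (λ ns → (g (sumℕ ns) ⊗ tupleWeight c ns) n) (tuples ℓ B))
  ≡ ∑ (suc B) (λ m → (g m ⊗ β ℓ c m) n)
sumℤ-tuples-β n B zero c g g≡0 = cong₂ ℤ._+_
  (at (⊗-cong {g 0} ≈-refl (⊗-identityˡ one)) n)
  (sym (trans (∑-cong B (λ m → at (⊗-zeroʳ (g (suc m))) n)) (∑-zero B)))
sumℤ-tuples-β n B (suc ℓ) zero g g≡0 = trans (sumℤ-tuples ℓ B _) (trans
  (∑-cong (suc B) λ i → trans
    (sumℤ-tuples-cong ℓ B (λ ns _ → at (peel i ns) n))
    (trans (sumℤ-tuples-β n B ℓ 1 (gᵢ i) (λ M B<M → vanishes-⊗ _ (vanishes-⊗ _ (g≡0 _ (ℕ.≤-trans B<M (ℕ.m≤n+m M i))))))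
           (∑-cong (suc B) λ M → at (regroup (g (i ℕ.+ M)) (1/[q²] i) (mono (M ℕ.* M)) (mono (2 ℕ.* M)) (β ℓ 1 M)) n)))
  (∑-Λ n B g (θ (β ℓ 1)) g≡0))
  where
  open Solver
  gᵢ : ℕ → Family
  gᵢ i M = g (i ℕ.+ M) ⊗ 1/[q²] i ⊗ (mono (M ℕ.* M) ⊗ mono (2 ℕ.* M))
  regroup : ∀ g I a t x → g ⊗ I ⊗ (a ⊗ t) ⊗ x ≈ g ⊗ I ⊗ (a ⊗ (t ⊗ x))
  regroup = solve 5 (λ g I a t x → g :* I :* (a :* t) :* x := g :* I :* (a :* (t :* x))) ≈-refl
  peel : ∀ i ns → g (i ℕ.+ sumℕ ns) ⊗ tupleWeight 0 (i ∷ ns) ≈ gᵢ i (sumℕ ns) ⊗ tupleWeight 1 ns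
  peel i ns = ≈-trans
    (⊗-cong ≈-refl (⊗-cong (≈-trans (≈-reflexive (cong mono (tailExponent-zero ns))) (≈-sym (≈-trans
       (⊗-cong (mono-+ (M ℕ.* M) (2 ℕ.* M)) ≈-refl)
       (mono-+ (M ℕ.* M ℕ.+ 2 ℕ.* M) (tailExponent 1 (drop 1 ns)))))) ≈-refl))
    (solve 6 (λ g a t e I w → g :* ((a :* t :* e) :* (I :* w)) := g :* I :* (a :* t) :* (e :* w)) ≈-refl
       (g (i ℕ.+ M)) (mono (M ℕ.* M)) (mono (2 ℕ.* M)) (mono (tailExponent 1 (drop 1 ns))) (1/[q²] i) (1/product ns))
    where M = sumℕ ns
sumℤ-tuples-β n B (suc ℓ) (suc c) g g≡0 = trans (sumℤ-tuples ℓ B _) (trans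
  (∑-cong (suc B) λ i → trans
    (sumℤ-tuples-cong ℓ B (λ ns _ → at (peel i ns) n))
    (trans (sumℤ-tuples-β n B ℓ c (gᵢ i) (λ M B<M → vanishes-⊗ _ (vanishes-⊗ _ (g≡0 _ (ℕ.≤-trans B<M (ℕ.m≤n+m M i))))))
           (∑-cong (suc B) λ M → at (⊗-assoc (g (i ℕ.+ M) ⊗ 1/[q²] i) (mono (M ℕ.* M)) (β ℓ c M)) n)))
  (∑-Λ n B g (β ℓ c) g≡0))
  where
  open Solver
  gᵢ : ℕ → Family
  gᵢ i M = g (i ℕ.+ M) ⊗ 1/[q²] i ⊗ mono (M ℕ.* M)
  peel : ∀ i ns → g (i ℕ.+ sumℕ ns) ⊗ tupleWeight (suc c) (i ∷ ns) ≈ gᵢ i (sumℕ ns) ⊗ tupleWeight c ns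
  peel i ns = ≈-trans
    (⊗-cong ≈-refl (⊗-cong (≈-trans (≈-reflexive (cong mono (tailExponent-suc c ns))) (≈-sym
       (mono-+ (M ℕ.* M) (tailExponent c (drop 1 ns))))) ≈-refl))
    (solve 5 (λ g a e I w → g :* ((a :* e) :* (I :* w)) := g :* I :* a :* (e :* w)) ≈-refl
       (g (i ℕ.+ M)) (mono (M ℕ.* M)) (mono (tailExponent c (drop 1 ns))) (1/[q²] i) (1/product ns))
    where M = sumℕ ns

∑ℕ : ℕ → (ℕ → ℕ) → ℕ
∑ℕ zero    f = 0
∑ℕ (suc n) f = f 0 ℕ.+ ∑ℕ n (f ∘ suc)

∑ℕ-cong : ∀ n {f g : ℕ → ℕ} → (∀ i → f i ≡ g i) → ∑ℕ n f ≡ ∑ℕ n g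
∑ℕ-cong zero    eq = refl
∑ℕ-cong (suc n) eq = cong₂ ℕ._+_ (eq 0) (∑ℕ-cong n (eq ∘ suc))

∑ℕ-zero : ∀ n → ∑ℕ n (λ _ → 0) ≡ 0
∑ℕ-zero zero    = refl
∑ℕ-zero (suc n) = ∑ℕ-zero n

sumℕ-applyUpTo : ∀ (f g : ℕ → ℕ) n → sumℕ (map f (applyUpTo g n)) ≡ ∑ℕ n (f ∘ g)
sumℕ-applyUpTo f g zero    = refl
sumℕ-applyUpTo f g (suc n) = cong (f (g 0) ℕ.+_) (sumℕ-applyUpTo f (g ∘ suc) n)

sumDrop : List ℕ → ℕ → ℕ
sumDrop ns i = sumℕ (drop i ns)

sumDrop-[] : ∀ i → sumDrop [] i ≡ 0
sumDrop-[] zero    = refl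
sumDrop-[] (suc i) = refl

sumDrop-beyond : ∀ ns i → length ns ≤ i → sumDrop ns i ≡ 0
sumDrop-beyond []       i       _         = sumDrop-[] i
sumDrop-beyond (n ∷ ns) (suc i) (s≤s len) = sumDrop-beyond ns i len

-- `J` may be any bound reaching past the list, since missing partial sums are 0. Removing the head
-- turns the later linear positions 2, 4, ... into 1, 3, ..., which is the reset of `c` to 1.
tailExponent-∑ : ∀ c ns J → length ns ≤ J →
  ∑ℕ (length ns) (λ i → sumDrop ns i ℕ.* sumDrop ns i) ℕ.+ ∑ℕ J (λ j → 2 ℕ.* sumDrop ns (c ℕ.+ 2 ℕ.* j))
  ≡ tailExponent c ns
tailExponent-∑ c       []       J       _         =
  trans (∑ℕ-cong J (λ j → cong (2 ℕ.*_) (sumDrop-[] (c ℕ.+ 2 ℕ.* j)))) (∑ℕ-zero J)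
tailExponent-∑ zero    (n ∷ ns) (suc J) (s≤s len) = trans
  (cong (λ z → M ℕ.* M ℕ.+ A ℕ.+ (2 ℕ.* M ℕ.+ z)) (∑ℕ-cong J λ j →
     cong (λ i → 2 ℕ.* sumDrop ns i) (ℕ.+-suc j (j ℕ.+ 0))))
  (trans (regroup (M ℕ.* M) A (2 ℕ.* M) (∑ℕ J (λ j → 2 ℕ.* sumDrop ns (1 ℕ.+ 2 ℕ.* j))))
         (cong (M ℕ.* M ℕ.+ 2 ℕ.* M ℕ.+_) (tailExponent-∑ 1 ns J len)))
  where
  M = sumℕ (n ∷ ns)
  A = ∑ℕ (length ns) (λ i → sumDrop ns i ℕ.* sumDrop ns i)
  regroup : ∀ a b c d → a ℕ.+ b ℕ.+ (c ℕ.+ d) ≡ a ℕ.+ c ℕ.+ (b ℕ.+ d)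
  regroup = Data.Nat.Tactic.RingSolver.solve-∀
tailExponent-∑ (suc c) (n ∷ ns) J       len = trans
  (ℕ.+-assoc (sumℕ (n ∷ ns) ℕ.* sumℕ (n ∷ ns)) _ _)
  (cong (sumℕ (n ∷ ns) ℕ.* sumℕ (n ∷ ns) ℕ.+_) (tailExponent-∑ c ns J (ℕ.<⇒≤ len)))

triangular : ℕ → ℕ
triangular m = (m ℕ.* suc m) / 2

exponent-tail : ∀ ℓ c ns → length ns ≡ ℓ →
  exponent (suc ℓ) (suc c) ns ≡ triangular (sumℕ ns) ℕ.+ tailExponent c (drop 1 ns)
exponent-tail ℓ c ns len = begin
  triangular (sumℕ ns)
    ℕ.+ sumℕ (map (λ i → Nof ns i ℕ.* Nof ns i) (map (2 ℕ.+_) (upTo (ℓ ∸ 1))))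
    ℕ.+ sumℕ (map linear (upTo (suc ℓ)))
    ≡⟨ cong₂ (λ x y → triangular (sumℕ ns) ℕ.+ x ℕ.+ y)
         (trans (cong sumℕ (sym (List.map-∘ (upTo (ℓ ∸ 1)))))
                (sumℕ-applyUpTo (λ i → sumDrop ns (suc i) ℕ.* sumDrop ns (suc i)) id (ℓ ∸ 1)))
         (sumℕ-applyUpTo linear id (suc ℓ)) ⟩
  triangular (sumℕ ns)
    ℕ.+ ∑ℕ (ℓ ∸ 1) (λ i → sumDrop ns (suc i) ℕ.* sumDrop ns (suc i)) ℕ.+ ∑ℕ (suc ℓ) linear
    ≡⟨ ℕ.+-assoc (triangular (sumℕ ns)) _ _ ⟩
  triangular (sumℕ ns)
    ℕ.+ (∑ℕ (ℓ ∸ 1) (λ i → sumDrop ns (suc i) ℕ.* sumDrop ns (suc i)) ℕ.+ ∑ℕ (suc ℓ) linear)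
    ≡⟨ cong (triangular (sumℕ ns) ℕ.+_) (trans
         (cong₂ ℕ._+_ (cong (λ l → ∑ℕ l (λ i → sumDrop ns (suc i) ℕ.* sumDrop ns (suc i))) length-tail)
                      (∑ℕ-cong (suc ℓ) linear-sumDrop))
         (trans (cong₂ ℕ._+_
                  (∑ℕ-cong (length (drop 1 ns)) (λ i → cong (λ z → z ℕ.* z) (drop-tail ns i)))
                  (∑ℕ-cong (suc ℓ) (λ j → cong (2 ℕ.*_) (drop-tail ns (c ℕ.+ 2 ℕ.* j)))))
                (tailExponent-∑ c (drop 1 ns) (suc ℓ) tail≤))) ⟩
  triangular (sumℕ ns) ℕ.+ tailExponent c (drop 1 ns) ∎
  where
  open ≡-Reasoning
  linear : ℕ → ℕ
  linear j = if (suc c ℕ.+ 1 ℕ.+ 2 ℕ.* j) ≤ᵇ ℓ then 2 ℕ.* Nof ns (suc c ℕ.+ 1 ℕ.+ 2 ℕ.* j) else 0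
  length-tail : ℓ ∸ 1 ≡ length (drop 1 ns)
  length-tail = trans (cong (_∸ 1) (sym len)) (sym (List.length-drop 1 ns))
  tail≤ : length (drop 1 ns) ≤ suc ℓ
  tail≤ = ℕ.≤-trans (ℕ.≤-reflexive (sym length-tail)) (ℕ.≤-trans (ℕ.m∸n≤m ℓ 1) (ℕ.n≤1+n ℓ))
  drop-tail : ∀ ns i → sumDrop ns (suc i) ≡ sumDrop (drop 1 ns) i
  drop-tail []       i = sym (sumDrop-[] i)
  drop-tail (n ∷ ns) i = refl
  index : ∀ j → c ℕ.+ 1 ℕ.+ 2 ℕ.* j ≡ suc (c ℕ.+ 2 ℕ.* j)
  index j = cong (ℕ._+ 2 ℕ.* j) (ℕ.+-comm c 1)
  -- Where the guard in `exponent` fails, the partial sum is empty, so both sides are 0.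
  linear-sumDrop : ∀ j → linear j ≡ 2 ℕ.* sumDrop ns (suc (c ℕ.+ 2 ℕ.* j))
  linear-sumDrop j rewrite index j with suc (c ℕ.+ 2 ℕ.* j) <ᵇ ℓ in eq
  ... | true  = refl
  ... | false = cong (2 ℕ.*_) (sym (sumDrop-beyond ns (suc (c ℕ.+ 2 ℕ.* j)) (ℕ.≤-trans
      (ℕ.≤-reflexive len) (ℕ.≮⇒≥ λ lt → subst T eq (ℕ.<⇒<ᵇ lt)))))

triangular-suc : ∀ m → triangular (suc m) ≡ suc m ℕ.+ triangular m
triangular-suc m = begin
  (suc m ℕ.* suc (suc m)) / 2            ≡⟨ cong (_/ 2) (expand m) ⟩
  (m ℕ.* suc m ℕ.+ suc m ℕ.* 2) / 2      ≡⟨ +-distrib-/-∣ʳ (m ℕ.* suc m) (divides (suc m) refl) ⟩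
  triangular m ℕ.+ (suc m ℕ.* 2) / 2     ≡⟨ cong (triangular m ℕ.+_) (m*n/n≡m (suc m) 2) ⟩
  triangular m ℕ.+ suc m                 ≡⟨ ℕ.+-comm (triangular m) (suc m) ⟩
  suc m ℕ.+ triangular m                 ∎
  where
  open ≡-Reasoning
  expand : ∀ m → suc m ℕ.* suc (suc m) ≡ m ℕ.* suc m ℕ.+ suc m ℕ.* 2
  expand = Data.Nat.Tactic.RingSolver.solve-∀

oneMinus-neg : ∀ e → oneMinus (ℤ.- (+ 1)) e ≈ one ⊕ mono e
oneMinus-neg e = pointwise λ n → trans (flip (one n) (mono e n)) (sym (⊕-at one (mono e) n))
  where
  flip : ∀ a b → a ℤ.- (ℤ.- (+ 1)) ℤ.* b ≡ a ℤ.+ b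
  flip = Data.Integer.Tactic.RingSolver.solve-∀

-- N(N+1)/2 = N + N(N-1)/2; the separated q^N is the forced first step of `pathGF-start`.
triangular-prefactor : ∀ m → mono (triangular m) ⊗ qPoch (ℤ.- (+ 1)) 1 1 m ≈ mono m ⊗ prefactor m
triangular-prefactor zero    = ≈-refl
triangular-prefactor (suc m) = begin
  mono (triangular (suc m)) ⊗ (q ⊛ oneMinus (ℤ.- (+ 1)) (1 ℕ.+ 1 ℕ.* m))
    ≈⟨ ⊗-cong (≈-trans (≈-reflexive (cong mono (triangular-suc m))) (≈-sym (mono-+ (suc m) (triangular m))))
              (≈-trans (≈-sym (⊗-⊛ q _)) (⊗-cong ≈-refl (≈-trans (oneMinus-neg (1 ℕ.+ 1 ℕ.* m))
                (⊕-cong ≈-refl (≈-reflexive (cong (mono ∘ suc) (ℕ.+-identityʳ m))))))) ⟩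
  (mono (suc m) ⊗ mono (triangular m)) ⊗ (q ⊗ (one ⊕ mono (suc m)))
    ≈⟨ solve 4 (λ s t q u → (s :* t) :* (q :* u) := s :* u :* (t :* q)) ≈-refl
         (mono (suc m)) (mono (triangular m)) q (one ⊕ mono (suc m)) ⟩
  mono (suc m) ⊗ (one ⊕ mono (suc m)) ⊗ (mono (triangular m) ⊗ q)
    ≈⟨ ⊗-cong ≈-refl (triangular-prefactor m) ⟩
  mono (suc m) ⊗ (one ⊕ mono (suc m)) ⊗ (mono m ⊗ prefactor m)
    ≈⟨ solve 4 (λ s u t p → s :* u :* (t :* p) := s :* (t :* u :* p)) ≈-refl
         (mono (suc m)) (one ⊕ mono (suc m)) (mono m) (prefactor m) ⟩
  mono (suc m) ⊗ prefactor (suc m) ∎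
  where
  open ≈-Reasoning
  open Solver
  q = qPoch (ℤ.- (+ 1)) 1 1 m

summand-tupleWeight : ∀ ℓ c ns → length ns ≡ ℓ →
  summand (suc ℓ) (suc c) ns ≈ (mono (sumℕ ns) ⊗ prefactor (sumℕ ns)) ⊗ tupleWeight c ns
summand-tupleWeight ℓ c ns len = begin
  mono (exponent (suc ℓ) (suc c) ns) ⊛ q ⊛ foldr (λ n f → 1/[q²] n ⊛ f) one ns
    ≈⟨ ⊛-cong (⊛-cong (≈-reflexive (cong mono (exponent-tail ℓ c ns len))) ≈-refl) (product-⊗ ns) ⟩
  mono (triangular M ℕ.+ r) ⊛ q ⊛ 1/product ns
    ≈⟨ ≈-trans (⊗-cong (⊗-⊛ (mono (triangular M ℕ.+ r)) q) ≈-refl) (⊗-⊛ _ (1/product ns)) ⟨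
  mono (triangular M ℕ.+ r) ⊗ q ⊗ 1/product ns
    ≈⟨ ⊗-cong (⊗-cong (mono-+ (triangular M) r) ≈-refl) ≈-refl ⟨
  (mono (triangular M) ⊗ mono r) ⊗ q ⊗ 1/product ns
    ≈⟨ solve 4 (λ t r q w → (t :* r) :* q :* w := (t :* q) :* (r :* w)) ≈-refl
         (mono (triangular M)) (mono r) q (1/product ns) ⟩
  (mono (triangular M) ⊗ q) ⊗ tupleWeight c ns
    ≈⟨ ⊗-cong (triangular-prefactor M) ≈-refl ⟩
  (mono M ⊗ prefactor M) ⊗ tupleWeight c ns ∎
  where
  open ≈-Reasoning
  open Solver
  M = sumℕ ns
  r = tailExponent c (drop 1 ns)
  q = qPoch (ℤ.- (+ 1)) 1 1 M
  product-⊗ : ∀ ns → foldr (λ n f → 1/[q²] n ⊛ f) one ns ≈ 1/product ns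
  product-⊗ []       = ≈-refl
  product-⊗ (n ∷ ns) = ≈-trans (⊛-cong {f = 1/[q²] n} ≈-refl (product-⊗ ns)) (≈-sym (⊗-⊛ (1/[q²] n) (1/product ns)))

rhsCoeff-β : ∀ ℓ c n → rhsCoeff (suc ℓ) (suc c) n ≡ ∑ (suc n) (λ m → (mono m ⊗ (prefactor m ⊗ β ℓ c m)) n)
rhsCoeff-β ℓ c n = trans
  (sumℤ-tuples-cong ℓ n (λ ns len → at (summand-tupleWeight ℓ c ns len) n))
  (trans (sumℤ-tuples-β n n ℓ c (λ m → mono m ⊗ prefactor m)
           (λ m n<m i i≤n → mono-⊗-< m (prefactor m) i (ℕ.≤-<-trans i≤n n<m)))
         (∑-cong (suc n) (λ m → at (⊗-assoc (mono m) (prefactor m) (β ℓ c m)) n)))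

-- Peaks and ascents

odd : ℕ → Bool
odd zero    = false
odd (suc n) = not (odd n)

data _⟶[_]_ : Vertex → Step → Vertex → Set where
  ne : ∀ {x y} → (x , y)     ⟶[ NE ] (suc x , suc y)
  se : ∀ {x y} → (x , suc y) ⟶[ SE ] (suc x , y)
  nn : ∀ {x y} → (x , y)     ⟶[ N ]  (x , suc y)
  ee : ∀ {x}   → (x , 0)     ⟶[ E ]  (suc x , 0)

Path : ℕ → (ℕ → Vertex) → (ℕ → Step) → Set
Path L v st = ∀ i → i < L → v i ⟶[ st i ] v (suc i)

module Peaks (L : ℕ) (v : ℕ → Vertex) (st : ℕ → Step) (valid : Path L v st) where

  x y : ℕ → ℕ
  x i = proj₁ (v i)
  y i = proj₂ (v i)

  data Kind (i : ℕ) : Set where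
    up    : T (isUp (st i)) → y (suc i) ≡ suc (y i) → Kind i
    down  : st i ≡ SE → y i ≡ suc (y (suc i)) → Kind i
    along : st i ≡ E → y i ≡ 0 → y (suc i) ≡ 0 → Kind i

  kind : ∀ i → i < L → Kind i
  kind i i<L = from refl refl refl (valid i i<L)
    where
    from : ∀ {a s b} → v i ≡ a → st i ≡ s → v (suc i) ≡ b → a ⟶[ s ] b → Kind i
    from p q r ne = up (subst (T ∘ isUp) (sym q) tt) (trans (cong proj₂ r) (cong (suc ∘ proj₂) (sym p)))
    from p q r nn = up (subst (T ∘ isUp) (sym q) tt) (trans (cong proj₂ r) (cong (suc ∘ proj₂) (sym p)))
    from p q r se = down q (trans (cong proj₂ p) (cong (suc ∘ proj₂) (sym r)))
    from p q r ee = along q (cong proj₂ p) (cong proj₂ r)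

  up-rises : ∀ i → i < L → T (isUp (st i)) → y (suc i) ≡ suc (y i)
  up-rises i i<L u with kind i i<L
  ... | up _ eq     = eq
  ... | down eq _   = ⊥-elim (subst (T ∘ isUp) eq u)
  ... | along eq _ _ = ⊥-elim (subst (T ∘ isUp) eq u)

  SE-falls : ∀ i → i < L → st i ≡ SE → y i ≡ suc (y (suc i))
  SE-falls i i<L eq with kind i i<L
  ... | up u _       = ⊥-elim (subst (T ∘ isUp) eq u)
  ... | down _ e     = e
  ... | along eq′ _ _ with trans (sym eq) eq′
  ...   | ()

  -- Up and down steps change index and height by one each; only E breaks the invariance. The parity
  -- of index plus height is what travels from a base to its peak.
  odd-step : ∀ i → i < L → st i ≢ E → odd (suc i ℕ.+ y (suc i)) ≡ odd (i ℕ.+ y i)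
  odd-step i i<L ¬E with kind i i<L
  ... | along eq _ _ = contradiction eq ¬E
  ... | up _ eq rewrite eq | ℕ.+-suc i (y i) = Bool.not-involutive (odd (i ℕ.+ y i))
  ... | down _ eq rewrite eq | ℕ.+-suc i (y (suc i)) = refl

  odd-stretch : ∀ d i → d ℕ.+ i ≤ L → (∀ j → i ≤ j → j < d ℕ.+ i → st j ≢ E) →
                odd (d ℕ.+ i ℕ.+ y (d ℕ.+ i)) ≡ odd (i ℕ.+ y i)
  odd-stretch zero    i _  _  = refl
  odd-stretch (suc d) i ≤L ¬E = trans
    (odd-step (d ℕ.+ i) ≤L (¬E (d ℕ.+ i) (ℕ.m≤n+m i d) ℕ.≤-refl))
    (odd-stretch d i (ℕ.<⇒≤ ≤L) (λ j i≤j j< → ¬E j i≤j (ℕ.m<n⇒m<1+n j<)))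

  odd-interval : ∀ {i p} → i ≤ p → p ≤ L → (∀ j → i ≤ j → j < p → st j ≢ E) →
                 odd (p ℕ.+ y p) ≡ odd (i ℕ.+ y i)
  odd-interval {i} {p} i≤p p≤L ¬E =
    subst (λ z → odd (z ℕ.+ y z) ≡ odd (i ℕ.+ y i)) p≡
      (odd-stretch (p ∸ i) i (subst (_≤ L) (sym p≡) p≤L)
        (λ j i≤j j< → ¬E j i≤j (subst (j <_) p≡ j<)))
    where
    p≡ : p ∸ i ℕ.+ i ≡ p
    p≡ = ℕ.m∸n+n≡m i≤p

  above-¬E : ∀ {b i} → i < L → b < y i → st i ≢ E
  above-¬E {b} {i} i<L b<y eq with kind i i<L
  ... | up u _         = subst (T ∘ isUp) eq u
  ... | down eq′ _ with trans (sym eq) eq′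
  ...   | ()
  above-¬E {b} {i} i<L b<y eq | along _ y≡0 _ = ℕ.n≮0 (subst (b <_) y≡0 b<y)

  up-¬E : ∀ {i} → T (isUp (st i)) → st i ≢ E
  up-¬E u eq = subst (T ∘ isUp) eq u

  Peakᵥ : ℕ → Set
  Peakᵥ zero    = ⊥
  Peakᵥ (suc j) = suc j < L × T (isUp (st j)) × st (suc j) ≡ SE

  Starts : ℕ → Set
  Starts zero    = T true
  Starts (suc j) = ¬ T (isUp (st j))

  AscentStart : ℕ → Set
  AscentStart i = i < L × T (isUp (st i)) × Starts i

  Dominated : ℕ → ℕ → ℕ → Set
  Dominated p i i′ = ∀ q → Peakᵥ q → i < q → q < i′ → y q ≤ y p × (y q ≡ y p → p ≤ q)

  -- The condition on a candidate h for the relative height, in terms of the base level b = y p - h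
  -- and with indices in place of abscissae. The two versions agree because the step after a peak is
  -- SE, so the abscissa strictly increases there.
  record Reach (p b : ℕ) : Set where
    constructor reach
    field
      {left right} : ℕ
      left≤  : left ≤ p
      <right : p < right
      right≤ : right ≤ L
      y-left  : y left ≡ b
      y-right : y right ≡ b
      dominated : Dominated p left right

  peak<L : ∀ p → Peakᵥ p → p < L
  peak<L (suc j) (lt , _) = lt

  peak-falls : ∀ p → Peakᵥ p → st p ≡ SE
  peak-falls (suc j) (_ , _ , eq) = eq

  reach-one : ∀ p → Peakᵥ p → 1 ≤ y p × Reach p (y p ∸ 1)
  reach-one (suc j) (j<L , u , eq) =
    subst (1 ≤_) (sym y-up) (s≤s z≤n) ,
    reach (ℕ.n≤1+n j) ℕ.≤-refl j<L
      (sym (cong (_∸ 1) y-up)) (sym (cong (_∸ 1) (SE-falls (suc j) j<L eq)))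
      (λ { q _ j<q q<2+j → only q (ℕ.≤-antisym (ℕ.s≤s⁻¹ q<2+j) j<q) })
    where
    y-up : y (suc j) ≡ suc (y j)
    y-up = up-rises j (ℕ.<⇒≤ j<L) u
    only : ∀ q → q ≡ suc j → y q ≤ y (suc j) × (y q ≡ y (suc j) → suc j ≤ q)
    only q refl = ℕ.≤-refl , λ _ → ℕ.≤-refl

  descend : ∀ {b} i → i < L → b < y i → y (suc i) ≤ b → st i ≡ SE × y (suc i) ≡ b
  descend i i<L b<y y≤b with kind i i<L
  ... | up _ eq      = ⊥-elim (ℕ.<⇒≱ b<y (ℕ.≤-trans (ℕ.n≤1+n _) (subst (_≤ _) eq y≤b)))
  ... | down s eq    = s , ℕ.≤-antisym y≤b (ℕ.s≤s⁻¹ (subst (_ <_) eq b<y))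
  ... | along _ eq _ = ⊥-elim (ℕ.n≮0 (subst (_ <_) eq b<y))

  ascend : ∀ {b} i → i < L → y i ≤ b → b < y (suc i) → T (isUp (st i)) × y i ≡ b
  ascend i i<L y≤b b<y with kind i i<L
  ... | up u eq      = u , ℕ.≤-antisym y≤b (ℕ.s≤s⁻¹ (subst (_ <_) eq b<y))
  ... | down _ eq    = ⊥-elim (ℕ.<⇒≱ b<y (ℕ.≤-trans (ℕ.n≤1+n _) (subst (_≤ _) eq y≤b)))
  ... | along _ _ eq = ⊥-elim (ℕ.n≮0 (subst (_ <_) eq b<y))

  record LastAt (b p : ℕ) : Set where
    constructor lastAt
    field
      {u}   : ℕ
      u<p   : u < p
      up-u  : T (isUp (st u))
      y-u   : y u ≡ b
      above : ∀ j → u < j → j ≤ p → b < y j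

  last-at : ∀ b p → p ≤ L → b < y p → LastAt b p ⊎ (∀ j → j ≤ p → b < y j)
  last-at b zero    p≤L b<y = inj₂ λ { zero _ → b<y }
  last-at b (suc p) p<L b<y with b ℕ.<? y p
  ... | no  b≮yp with ascend p p<L (ℕ.≮⇒≥ b≮yp) b<y
  ...   | u , y≡b = inj₁ (lastAt ℕ.≤-refl u y≡b
                      (λ j p<j j≤ → subst (λ z → b < y z) (ℕ.≤-antisym p<j j≤) b<y))
  last-at b (suc p) p<L b<y | yes b<yp with last-at b p (ℕ.<⇒≤ p<L) b<yp
  ... | inj₁ (lastAt u<p u y≡b above) = inj₁ (lastAt (ℕ.m<n⇒m<1+n u<p) u y≡b λ j u<j j≤ →
          extend above j u<j (ℕ.m≤n⇒m<n∨m≡n j≤))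
    where
    extend : ∀ {u} → (∀ j → u < j → j ≤ p → b < y j) → ∀ j → u < j → j < suc p ⊎ j ≡ suc p → b < y j
    extend above j u<j (inj₁ (s≤s j≤p)) = above j u<j j≤p
    extend above j u<j (inj₂ refl)      = b<y
  ... | inj₂ above = inj₂ λ j j≤ → extend j (ℕ.m≤n⇒m<n∨m≡n j≤)
    where
    extend : ∀ j → j < suc p ⊎ j ≡ suc p → b < y j
    extend j (inj₁ (s≤s j≤p)) = above j j≤p
    extend j (inj₂ refl)      = b<y

  record FirstAt (b p : ℕ) : Set where
    constructor firstAt
    field
      {w′}  : ℕ
      p≤w′  : p ≤ w′
      w′<L  : w′ < L
      SE-w′ : st w′ ≡ SE
      y-w   : y (suc w′) ≡ b
      above : ∀ j → p ≤ j → j ≤ w′ → b < y j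

  first-at : ∀ b d p → d ℕ.+ p ≤ L → b < y p → y (d ℕ.+ p) ≤ b → FirstAt b p
  first-at b zero    p _  b<y y≤b = ⊥-elim (ℕ.<⇒≱ b<y y≤b)
  first-at b (suc d) p ≤L b<y y≤b with b ℕ.<? y (suc p)
  ... | no b≮ with descend p (ℕ.≤-trans (s≤s (ℕ.m≤n+m p d)) ≤L) b<y (ℕ.≮⇒≥ b≮)
  ...   | s , eq = firstAt ℕ.≤-refl (ℕ.≤-trans (s≤s (ℕ.m≤n+m p d)) ≤L) s eq
                     (λ j p≤j j≤p → subst (λ z → b < y z) (ℕ.≤-antisym p≤j j≤p) b<y)
  first-at b (suc d) p ≤L b<y y≤b | yes b<y′
    with first-at b d (suc p) (subst (_≤ L) (sym (ℕ.+-suc d p)) ≤L) b<y′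
                  (subst (λ z → y z ≤ b) (sym (ℕ.+-suc d p)) y≤b)
  ... | firstAt p<w w<L s eq above = firstAt (ℕ.<⇒≤ p<w) w<L s eq λ j p≤j j≤w →
          extend above j j≤w (ℕ.m≤n⇒m<n∨m≡n p≤j)
    where
    extend : ∀ {w} → (∀ j → suc p ≤ j → j ≤ w → b < y j) → ∀ j → j ≤ w → p < j ⊎ p ≡ j → b < y j
    extend above j j≤w (inj₁ p<j)  = above j p<j j≤w
    extend above j j≤w (inj₂ refl) = b<y

  -- Take the last vertex u before p at level b and the first return to b after p. If no up step
  -- precedes u, the ascent starts at u. Otherwise the left end could be lowered by one level, so by
  -- maximality the return is not followed by SE; nor by E, since b > 0; nor is it the end of the
  -- path. So an ascent starts at the return. Between the two vertices the path stays above b and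
  -- has no E step, hence the equal parities.
  ascent-below : ∀ p b → Peakᵥ p → Reach p b → b < y p → (∀ b′ → suc b′ ≡ b → ¬ Reach p b′) →
                 y L ≡ 0 → Σ ℕ λ i → AscentStart i × y i ≡ b × odd (i ℕ.+ y i) ≡ odd (p ℕ.+ y p)
  ascent-below p b pk (reach {i} {i′} i≤p p<i′ i′≤L yi yi′ dom) b<yp maximal yL
    with last-at b p (ℕ.<⇒≤ (peak<L p pk)) b<yp
  ... | inj₂ above = ⊥-elim (ℕ.<-irrefl (sym yi) (above i i≤p))
  ... | inj₁ (lastAt {u} u<p up-u yu above)
    with first-at b (i′ ∸ p) p
           (subst (_≤ L) (sym (ℕ.m∸n+n≡m (ℕ.<⇒≤ p<i′))) i′≤L) b<yp
           (ℕ.≤-reflexive (trans (cong y (ℕ.m∸n+n≡m (ℕ.<⇒≤ p<i′))) yi′))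
  ... | firstAt {w} p≤w w<L SE-w yw above′ = choose u refl
    where
    p<L = peak<L p pk
    i≤u : i ≤ u
    i≤u = ℕ.≮⇒≥ λ u<i → ℕ.<-irrefl (sym yi) (above i u<i i≤p)
    w<i′ : w < i′
    w<i′ = ℕ.≰⇒> λ i′≤w → ℕ.<-irrefl (sym yi′) (above′ i′ (ℕ.<⇒≤ p<i′) i′≤w)
    u-odd : odd (u ℕ.+ y u) ≡ odd (p ℕ.+ y p)
    u-odd = sym (odd-interval (ℕ.<⇒≤ u<p) (ℕ.<⇒≤ p<L) λ j u≤j j<p →
      stay j j<p (ℕ.m≤n⇒m<n∨m≡n u≤j))
      where
      stay : ∀ j → j < p → u < j ⊎ u ≡ j → st j ≢ E
      stay j j<p (inj₁ u<j)  = above-¬E (ℕ.<-trans j<p p<L) (above j u<j (ℕ.<⇒≤ j<p))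
      stay j j<p (inj₂ refl) = up-¬E up-u
    w-odd : odd (suc w ℕ.+ y (suc w)) ≡ odd (p ℕ.+ y p)
    w-odd = odd-interval (ℕ.m≤n⇒m≤1+n p≤w) w<L λ { j p≤j (s≤s j≤w) →
      above-¬E (ℕ.≤-<-trans j≤w w<L) (above′ j p≤j j≤w) }
    u<L = ℕ.<-trans u<p p<L
    at-u : Starts u → Σ ℕ λ i → AscentStart i × y i ≡ b × odd (i ℕ.+ y i) ≡ odd (p ℕ.+ y p)
    at-u s = u , (u<L , up-u , s) , yu , u-odd
    choose : ∀ u₀ → u₀ ≡ u → Σ ℕ λ i → AscentStart i × y i ≡ b × odd (i ℕ.+ y i) ≡ odd (p ℕ.+ y p)
    choose zero     refl = at-u tt
    choose (suc u′) refl with kind u′ (ℕ.<⇒≤ u<L)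
    ... | down s _    = at-u λ up′ → subst (T ∘ isUp) s up′
    ... | along s _ _ = at-u λ up′ → subst (T ∘ isUp) s up′
    ... | up up-u′ y-up = suc w , (w<L′ , up-w , λ up′ → subst (T ∘ isUp) SE-w up′) , yw , w-odd
      where
      b≡ : suc (y u′) ≡ b
      b≡ = trans (sym y-up) yu
      w<L′ : suc w < L
      w<L′ = ℕ.≤∧≢⇒< w<L λ w≡L → ℕ.1+n≢0 (trans b≡ (trans (sym yw) (trans (cong y w≡L) yL)))
      -- Extending one step on both sides meets no new peak, because the path
      -- rises at u and has just fallen at suc w.
      extended : st (suc w) ≡ SE → Reach p (y u′)
      extended s = reach (ℕ.≤-trans (ℕ.n≤1+n u′) (ℕ.<⇒≤ u<p)) (ℕ.m≤n⇒m≤1+n (s≤s p≤w)) w<L′ refl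
        (ℕ.suc-injective (trans (sym (SE-falls (suc w) w<L′ s)) (trans yw (sym b≡))))
        λ q pkq u′<q q<2+w → dom q pkq
          (ℕ.≤-<-trans i≤u (ℕ.≤∧≢⇒< u′<q λ { refl → ⊥-elim (subst (T ∘ isUp) (peak-falls q pkq) up-u) }))
          (ℕ.<-≤-trans (ℕ.≤∧≢⇒< (ℕ.s≤s⁻¹ q<2+w) (λ { refl → subst (T ∘ isUp) SE-w (proj₁ (proj₂ pkq)) })) w<i′)
      up-w : T (isUp (st (suc w)))
      up-w with kind (suc w) w<L′
      ... | up u _      = u
      ... | down s _    = ⊥-elim (maximal (y u′) b≡ (extended s))
      ... | along _ e _ = ⊥-elim (ℕ.1+n≢0 (trans b≡ (trans (sym yw) e)))

  record Argmax (u d : ℕ) : Set where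
    constructor argmax
    field
      {p}  : ℕ
      u<p  : u < p
      p≤   : p ≤ suc d ℕ.+ u
      max  : ∀ j → u < j → j ≤ suc d ℕ.+ u → y j ≤ y p
      left : ∀ j → u < j → j < p → y j < y p

  leftmost-argmax : ∀ u d → Argmax u d
  leftmost-argmax u zero = argmax ℕ.≤-refl ℕ.≤-refl
    (λ j u<j j≤ → ℕ.≤-reflexive (cong y (ℕ.≤-antisym j≤ u<j)))
    (λ j u<j j<p → ⊥-elim (ℕ.<⇒≱ u<j (ℕ.s≤s⁻¹ j<p)))
  leftmost-argmax u (suc d) with leftmost-argmax u d
  ... | argmax {p} u<p p≤ max left with y (2 ℕ.+ d ℕ.+ u) ℕ.≤? y p
  ...   | yes y≤ = argmax u<p (ℕ.m≤n⇒m≤1+n p≤)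
                     (λ j u<j j≤ → extend j u<j (ℕ.m≤n⇒m<n∨m≡n j≤)) left
    where
    extend : ∀ j → u < j → j < 2 ℕ.+ d ℕ.+ u ⊎ j ≡ 2 ℕ.+ d ℕ.+ u → y j ≤ y p
    extend j u<j (inj₁ (s≤s j≤)) = max j u<j j≤
    extend j u<j (inj₂ refl)     = y≤
  ...   | no y≰ = argmax (ℕ.≤-trans u<p (ℕ.m≤n⇒m≤1+n p≤)) ℕ.≤-refl
                    (λ j u<j j≤ → extend j u<j (ℕ.m≤n⇒m<n∨m≡n j≤))
                    (λ j u<j j< → ℕ.≤-<-trans (max j u<j (ℕ.s≤s⁻¹ j<)) (ℕ.≰⇒> y≰))
    where
    extend : ∀ j → u < j → j < 2 ℕ.+ d ℕ.+ u ⊎ j ≡ 2 ℕ.+ d ℕ.+ u → y j ≤ y (2 ℕ.+ d ℕ.+ u)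
    extend j u<j (inj₁ (s≤s j≤)) = ℕ.≤-trans (max j u<j j≤) (ℕ.<⇒≤ (ℕ.≰⇒> y≰))
    extend j u<j (inj₂ refl)     = ℕ.≤-refl

  record Summit (u w : ℕ) : Set where
    constructor summit
    field
      {p}  : ℕ
      pk   : Peakᵥ p
      u<p  : u < p
      p<w  : p < w
      max  : ∀ j → u < j → j < w → y j ≤ y p
      left : ∀ j → u < j → j < p → y j < y p

  summit-between : ∀ {b} u w → suc u < w → w ≤ L → y u ≡ b → y w ≡ b →
                   (∀ j → u < j → j < w → b < y j) → Summit u w
  summit-between {b} u w u+1<w w≤L yu yw above = build (leftmost-argmax u (w ∸ (2 ℕ.+ u)))
    where
    top : suc (suc (w ∸ (2 ℕ.+ u)) ℕ.+ u) ≡ w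
    top = trans (cong suc (sym (ℕ.+-suc (w ∸ (2 ℕ.+ u)) u)))
                (trans (sym (ℕ.+-suc (w ∸ (2 ℕ.+ u)) (suc u))) (ℕ.m∸n+n≡m u+1<w))
    build : Argmax u (w ∸ (2 ℕ.+ u)) → Summit u w
    build (argmax {suc j} (s≤s u≤j) p≤ max left) = summit
      (p<L , ascends , falls) (s≤s u≤j) p<w (λ i u<i i<w → max i u<i (ℕ.s≤s⁻¹ (subst (i <_) (sym top) i<w))) left
      where
      p<w : suc j < w
      p<w = subst (suc j <_) top (s≤s p≤)
      p<L = ℕ.<-≤-trans p<w w≤L
      b<y : b < y (suc j)
      b<y = above (suc j) (s≤s u≤j) p<w
      lower : y j < y (suc j)
      lower with ℕ.m≤n⇒m<n∨m≡n u≤j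
      ... | inj₁ u<j  = left j u<j ℕ.≤-refl
      ... | inj₂ refl = subst (_< y (suc j)) (sym yu) b<y
      ascends : T (isUp (st j))
      ascends with kind j (ℕ.<⇒≤ p<L)
      ... | up u _       = u
      ... | down _ e     = ⊥-elim (ℕ.<⇒≱ lower (ℕ.≤-trans (ℕ.n≤1+n _) (ℕ.≤-reflexive (sym e))))
      ... | along _ e e′ = ⊥-elim (ℕ.<-irrefl (trans e (sym e′)) lower)
      not-higher : y (2 ℕ.+ j) ≤ y (suc j)
      not-higher with ℕ.m≤n⇒m<n∨m≡n p<w
      ... | inj₁ lt = max (2 ℕ.+ j) (s≤s (ℕ.m≤n⇒m≤1+n u≤j)) (ℕ.s≤s⁻¹ (subst (2 ℕ.+ j <_) (sym top) lt))
      ... | inj₂ eq = ℕ.≤-trans (ℕ.≤-reflexive (trans (cong y eq) yw)) (ℕ.<⇒≤ b<y)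
      falls : st (suc j) ≡ SE
      falls with kind (suc j) p<L
      ... | up _ e      = ⊥-elim (ℕ.1+n≰n (subst (_≤ y (suc j)) e not-higher))
      ... | down e _    = e
      ... | along _ e _ = ⊥-elim (ℕ.n≮0 (subst (b <_) e b<y))

  -- Leftmost matters: the definition forbids peaks of equal height further left inside the
  -- interval.
  summit-reach : ∀ {b u w} → w ≤ L → y u ≡ b → y w ≡ b → (s : Summit u w) → Reach (Summit.p s) b
  summit-reach w≤L yu yw (summit pk u<p p<w max left) = reach (ℕ.<⇒≤ u<p) p<w w≤L yu yw
    λ q _ u<q q<w → max q u<q q<w , λ eq → ℕ.≮⇒≥ λ q<p → ℕ.<-irrefl eq (left q u<q q<p)

  record BasePeak (i : ℕ) : Set where
    constructor basePeak
    field
      {p}     : ℕ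
      pk      : Peakᵥ p
      reaches : Reach p (y i)
      above   : y i < y p
      lowest  : ∀ b → b < y i → ¬ Reach p b
      parity  : odd (p ℕ.+ y p) ≡ odd (i ℕ.+ y i)

  -- An interval witnessing a lower base for one summit has to cross both excursions, so it contains
  -- the other summit, which violates domination by being higher, or equally high and further left.
  -- A tie therefore goes to the right summit. If no left excursion exists, either the level is 0 or
  -- no earlier vertex lies below it, and the right summit cannot have a lower base.
  base-peak : ∀ i → AscentStart i → y L ≡ 0 → BasePeak i
  base-peak i (i<L , up-i , starts) yL
    with first-at (y i) (L ∸ suc i) (suc i) (ℕ.≤-reflexive (ℕ.m∸n+n≡m i<L))
           (ℕ.≤-reflexive (sym (up-rises i i<L up-i)))
           (subst (_≤ y i) (sym (trans (cong y (ℕ.m∸n+n≡m i<L)) yL)) z≤n)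
  ... | firstAt {w} i<w w<L SE-w yw above = build i refl starts
    where
    b = y i
    above′ : ∀ j → i < j → j < suc w → b < y j
    above′ j i<j (s≤s j≤w) = above j i<j j≤w
    right : Summit i (suc w)
    right = summit-between i (suc w) (s≤s i<w) w<L refl yw above′
    open Summit right using (p; pk; p<w) renaming (u<p to i<p)
    right-odd : odd (p ℕ.+ y p) ≡ odd (i ℕ.+ y i)
    right-odd = odd-interval (ℕ.<⇒≤ i<p) (ℕ.<⇒≤ (peak<L p pk)) λ j i≤j j<p →
      stay j j<p (ℕ.m≤n⇒m<n∨m≡n i≤j)
      where
      stay : ∀ j → j < p → i < j ⊎ i ≡ j → st j ≢ E
      stay j j<p (inj₁ i<j)  = above-¬E (ℕ.<-trans j<p (peak<L p pk)) (above′ j i<j (ℕ.<-trans j<p p<w))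
      stay j j<p (inj₂ refl) = up-¬E up-i
    use-right : (∀ b′ → b′ < b → ¬ Reach p b′) → BasePeak i
    use-right low = basePeak pk (summit-reach w<L refl yw right) (above′ p i<p p<w) low right-odd
    left-of-i : ∀ {b′ j} → b′ < b → y j ≡ b′ → j ≤ p → j < i
    left-of-i {b′} {j} b′<b yj j≤p = ℕ.≰⇒> λ i≤j → lower j (ℕ.m≤n⇒m<n∨m≡n i≤j) yj j≤p
      where
      lower : ∀ j → i < j ⊎ i ≡ j → y j ≡ b′ → j ≤ p → ⊥
      lower j (inj₁ i<j)  yj j≤p = ℕ.<-asym b′<b (subst (b <_) yj (above′ j i<j (ℕ.≤-<-trans j≤p p<w)))
      lower j (inj₂ refl) yj j≤p = ℕ.<-irrefl (sym yj) b′<b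
    build : ∀ i₀ → i₀ ≡ i → Starts i₀ → BasePeak i
    build zero refl _ = use-right λ b′ b′<b r →
      ℕ.n≮0 (left-of-i b′<b (Reach.y-left r) (Reach.left≤ r))
    build (suc i′) refl ¬up with kind i′ (ℕ.<⇒≤ i<L)
    ... | up u _       = ⊥-elim (¬up u)
    ... | along _ _ b≡0 = use-right λ b′ b′<b _ → ℕ.n≮0 (subst (b′ <_) b≡0 b′<b)
    ... | down SE-i′ falls with last-at b i′ (ℕ.<⇒≤ (ℕ.<⇒≤ i<L)) (ℕ.≤-reflexive (sym falls))
    ...   | inj₂ higher = use-right λ b′ b′<b r → ℕ.<-asym b′<b
              (subst (b <_) (Reach.y-left r)
                (higher _ (ℕ.s≤s⁻¹ (left-of-i b′<b (Reach.y-left r) (Reach.left≤ r)))))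
    ...   | inj₁ (lastAt {u} u<i′ up-u yu higher) = compare
      where
      higher′ : ∀ j → u < j → j < i → b < y j
      higher′ j u<j (s≤s j≤) = higher j u<j j≤
      left : Summit u i
      left = summit-between u i (s≤s u<i′) (ℕ.<⇒≤ i<L) yu refl higher′
      open Summit left using () renaming (p to p₂; pk to pk₂; u<p to u<p₂; p<w to p₂<i)
      compare : BasePeak i
      compare with y p ℕ.≤? y p₂
      ... | yes y≤ = use-right λ { b′ b′<b r@(reach {i₁} i₁≤p p<i₂ _ y₁ _ dom) →
              let i₁<u = ℕ.≤∧≢⇒< (ℕ.≮⇒≥ λ u<i₁ → ℕ.<-asym b′<b
                                     (subst (b <_) y₁ (higher′ i₁ u<i₁ (left-of-i b′<b y₁ i₁≤p))))
                                 (λ i₁≡u → ℕ.<-irrefl (trans (sym y₁) (trans (cong y i₁≡u) yu)) b′<b)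
                  (y₂≤ , first) = dom p₂ pk₂ (ℕ.<-trans i₁<u u<p₂) (ℕ.<-trans (ℕ.<-trans p₂<i i<p) p<i₂)
              in ℕ.<⇒≱ (ℕ.<-trans p₂<i i<p) (first (ℕ.≤-antisym y₂≤ y≤)) }
      ... | no  y≰ = basePeak pk₂ (summit-reach (ℕ.<⇒≤ i<L) yu refl left) (higher′ p₂ u<p₂ p₂<i) low left-odd
        where
        low : ∀ b′ → b′ < b → ¬ Reach p₂ b′
        low b′ b′<b (reach {i₁} {i₂} i₁≤p₂ p₂<i₂ _ y₁ y₂ dom) =
          y≰ (proj₁ (dom p pk (ℕ.≤-<-trans i₁≤p₂ (ℕ.<-trans p₂<i i<p)) (ℕ.<-trans p<w w<i₂)))
          where
          i<i₂ : i < i₂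
          i<i₂ = ℕ.≤∧≢⇒<
            (ℕ.≮⇒≥ λ i₂<i → ℕ.<-asym b′<b (subst (b <_) y₂ (higher′ i₂ (ℕ.<-trans u<p₂ p₂<i₂) i₂<i)))
            (λ i≡i₂ → ℕ.<-irrefl (trans (sym y₂) (cong y (sym i≡i₂))) b′<b)
          w<i₂ : suc w < i₂
          w<i₂ = ℕ.≤∧≢⇒<
            (ℕ.≮⇒≥ λ i₂<w → ℕ.<-asym b′<b (subst (b <_) y₂ (above′ i₂ i<i₂ i₂<w)))
            (λ w≡i₂ → ℕ.<-irrefl (trans (sym y₂) (trans (cong y (sym w≡i₂)) yw)) b′<b)
        left-odd : odd (p₂ ℕ.+ y p₂) ≡ odd (i ℕ.+ y i)
        left-odd = sym (odd-interval (ℕ.<⇒≤ p₂<i) (ℕ.<⇒≤ i<L) λ j p₂≤j j<i →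
          above-¬E (ℕ.<-trans j<i i<L) (higher′ j (ℕ.<-≤-trans u<p₂ p₂≤j) j<i))

-- The automaton and the paths of the definition

data Walk : ℕ → ℕ → List Step → List Vertex → Set where
  stop : ∀ {x y} → Walk x y [] []
  ne   : ∀ {x y s ws} → Walk (suc x) (suc y) s ws → Walk x y (NE ∷ s) ((suc x , suc y) ∷ ws)
  se   : ∀ {x y s ws} → Walk (suc x) y s ws → Walk x (suc y) (SE ∷ s) ((suc x , y) ∷ ws)
  nn   : ∀ {x y s ws} → Walk x (suc y) s ws → Walk x y (N ∷ s) ((x , suc y) ∷ ws)
  ee   : ∀ {x s ws} → Walk (suc x) 0 s ws → Walk x 0 (E ∷ s) ((suc x , 0) ∷ ws)

Walk⇒walk : ∀ {x y s ws} → Walk x y s ws → walk x y s ≡ just ((x , y) ∷ ws)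
Walk⇒walk stop           = refl
Walk⇒walk (ne w)         rewrite Walk⇒walk w = refl
Walk⇒walk (se w)         rewrite Walk⇒walk w = refl
Walk⇒walk {y = zero}  (nn w) rewrite Walk⇒walk w = refl
Walk⇒walk {y = suc y} (nn w) rewrite Walk⇒walk w = refl
Walk⇒walk (ee w)         rewrite Walk⇒walk w = refl

walk⇒Walk : ∀ x y s {vs} → walk x y s ≡ just vs →
            Σ (List Vertex) λ ws → vs ≡ (x , y) ∷ ws × Walk x y s ws
walk⇒Walk x y       []       refl = [] , refl , stop
walk⇒Walk x y       (NE ∷ s) eq with walk (suc x) (suc y) s in eq′
walk⇒Walk x y       (NE ∷ s) refl | just vs with walk⇒Walk (suc x) (suc y) s eq′
... | ws , refl , w = _ , refl , ne w
walk⇒Walk x (suc y) (SE ∷ s) eq with walk (suc x) y s in eq′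
walk⇒Walk x (suc y) (SE ∷ s) refl | just vs with walk⇒Walk (suc x) y s eq′
... | ws , refl , w = _ , refl , se w
walk⇒Walk x zero    (N ∷ s)  eq with walk x 1 s in eq′
walk⇒Walk x zero    (N ∷ s)  refl | just vs with walk⇒Walk x 1 s eq′
... | ws , refl , w = _ , refl , nn w
walk⇒Walk x (suc y) (N ∷ s)  eq with walk x (2 ℕ.+ y) s in eq′
walk⇒Walk x (suc y) (N ∷ s)  refl | just vs with walk⇒Walk x (2 ℕ.+ y) s eq′
... | ws , refl , w = _ , refl , nn w
walk⇒Walk x zero    (E ∷ s)  eq with walk (suc x) zero s in eq′
walk⇒Walk x zero    (E ∷ s)  refl | just vs with walk⇒Walk (suc x) zero s eq′
... | ws , refl , w = _ , refl , ee w

stepOf : Mode → Step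
stepOf fall = SE
stepOf flat = E
stepOf rise = NE
stepOf jump = N

-- In the following functions t₀ is the step before the suffix s; a path
-- beginning with s is treated as if it were preceded by SE.
tops : Step → List Step → ℕ
tops t₀ []      = 0
tops t₀ (t ∷ s) = (if isUp t₀ ∧ isSE t then 1 else 0) ℕ.+ tops t s

drift : Step → List Step → ℕ
drift t₀ []      = 0
drift t₀ (t ∷ s) = (if isN t then 0 else tops t s) ℕ.+ drift t s

oddAscents : Bool → Bool → List Step → Bool
oddAscents u b []      = true
oddAscents u b (t ∷ s) = (not (isUp t) ∨ (u ∨ b)) ∧ oddAscents (isUp t) (not b) s

below : ℕ → List Vertex → Bool
below k = all (λ v → proj₂ v <ᵇ k)

record Valid (k x : ℕ) (md : Mode) (h : ℕ) (b : Bool) (s : List Step) (ws : List Vertex) : Set where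
  constructor conditions
  field
    is-walk : Walk x h s ws
    ends-0  : T (finalHeight0 ((x , h) ∷ ws))
    ends-SE : T (lastIsSE (stepOf md ∷ s))
    N-SE    : T (nFollowedBySE (stepOf md ∷ s))
    bounded : T (below k ws)
    ascents : T (oddAscents (isUp (stepOf md)) b s)

if-∧-false : ∀ a → (if a ∧ false then 1 else 0) ≡ 0
if-∧-false a = cong (λ c → if c then 1 else 0) (Bool.∧-zeroʳ a)

climb-valid : ∀ {b c} md t s → T (mayClimb md b ∧ c) → T (isUp t) →
  (T (nFollowedBySE (t ∷ s)) → T (nFollowedBySE (stepOf md ∷ t ∷ s)))
  × T (not (isUp t) ∨ (isUp (stepOf md) ∨ b))
climb-valid {true} fall NE s p u = id , tt
climb-valid {true} fall N  s p u = id , tt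
climb-valid {true} flat NE s p u = id , tt
climb-valid {true} flat N  s p u = id , tt
climb-valid        rise NE s p u = id , tt
climb-valid        rise N  s p u = id , tt

≤ᵇ-∸ : ∀ {m n c t d} → T ((m ≤ᵇ n) ∧ c) → m ≡ t → n ∸ m ≡ d → n ≡ t ℕ.+ d
≤ᵇ-∸ {m} {n} p refl refl = sym (ℕ.m+[n∸m]≡n (ℕ.≤ᵇ⇒≤ m n (T-∧ˡ p)))

-- The counters are forced by the word, so distinct values of `m` accept disjoint sets of words;
-- `count-rhs` relies on this.
acc-sound : ∀ k x md h b m n s → h < k → T (acc k md h b m n s) →
  (m ≡ tops (stepOf md) s × n ≡ drift (stepOf md) s) × Σ (List Vertex) (Valid k x md h b s)
acc-sound k x fall zero b zero zero [] h<k t = (refl , refl) , [] , conditions stop tt tt tt tt tt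
acc-sound k x md h b m n (NE ∷ s) h<k t
  with T-∧ˡ {mayClimb md b ∧ (suc h <ᵇ k)} t | T-∧ʳ {mayClimb md b ∧ (suc h <ᵇ k)} t
... | t₁ | t₂
  with acc-sound k (suc x) rise (suc h) (not b) m (n ∸ m) s
         (ℕ.<ᵇ⇒< (suc h) k (T-∧ʳ {mayClimb md b} t₁)) (T-∧ʳ {m ≤ᵇ n} t₂)
     | climb-valid {b} md NE s t₁ tt
... | (m≡ , n≡) , ws , conditions w fin las nf low asc | nf′ , up =
  (trans m≡ (cong (ℕ._+ tops NE s) (sym (if-∧-false (isUp (stepOf md))))) , ≤ᵇ-∸ t₂ m≡ n≡)
  , _ , conditions (ne w) fin las (nf′ nf) (T-∧-intro (T-∧ʳ {mayClimb md b} t₁) low) (T-∧-intro up asc)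
acc-sound k x md h b m n (N ∷ s) h<k t
  with T-∧ˡ {mayClimb md b ∧ (suc h <ᵇ k)} t | T-∧ʳ {mayClimb md b ∧ (suc h <ᵇ k)} t
... | t₁ | t₂
  with acc-sound k x jump (suc h) (not b) m n s (ℕ.<ᵇ⇒< (suc h) k (T-∧ʳ {mayClimb md b} t₁)) t₂
     | climb-valid {b} md N s t₁ tt
... | (m≡ , n≡) , ws , conditions w fin las nf low asc | nf′ , up =
  (trans m≡ (cong (ℕ._+ tops N s) (sym (if-∧-false (isUp (stepOf md))))) , n≡)
  , _ , conditions (nn w) fin las (nf′ nf) (T-∧-intro (T-∧ʳ {mayClimb md b} t₁) low) (T-∧-intro up asc)
acc-sound k x md zero b m n (E ∷ s) h<k t
  with T-∧ʳ {level md} t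
... | t₂
  with acc-sound k (suc x) flat zero (not b) m (n ∸ m) s h<k (T-∧ʳ {m ≤ᵇ n} t₂)
... | (m≡ , n≡) , ws , conditions w fin las nf low asc =
  (trans m≡ (cong (ℕ._+ tops E s) (sym (if-∧-false (isUp (stepOf md))))) , ≤ᵇ-∸ t₂ m≡ n≡)
  , _ , conditions (ee w) fin las (N-SE′ md (T-∧ˡ t)) (T-∧-intro (ℕ.<⇒<ᵇ h<k) low) asc
  where
  N-SE′ : ∀ md → T (level md) → T (nFollowedBySE (stepOf md ∷ E ∷ s))
  N-SE′ fall _ = nf
  N-SE′ flat _ = nf
acc-sound k x flat zero    b m n (SE ∷ s) h<k ()
acc-sound k x fall (suc h) b m n (SE ∷ s) h<k t
  with acc-sound k (suc x) fall h (not b) m (n ∸ m) s (ℕ.<⇒≤ h<k) (T-∧ʳ {m ≤ᵇ n} t)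
... | (m≡ , n≡) , ws , conditions w fin las nf low asc =
  (m≡ , ≤ᵇ-∸ t m≡ n≡) , _ , conditions (se w) fin las nf (T-∧-intro (ℕ.<⇒<ᵇ (ℕ.<⇒≤ h<k)) low) asc
acc-sound k x rise zero    b zero    n (SE ∷ s) h<k ()
acc-sound k x rise (suc h) b zero    n (SE ∷ s) h<k ()
acc-sound k x jump zero    b zero    n (SE ∷ s) h<k ()
acc-sound k x jump (suc h) b zero    n (SE ∷ s) h<k ()
acc-sound k x rise (suc h) b (suc m) n (SE ∷ s) h<k t
  with acc-sound k (suc x) fall h (not b) m (n ∸ m) s (ℕ.<⇒≤ h<k) (T-∧ʳ {m ≤ᵇ n} t)
... | (m≡ , n≡) , ws , conditions w fin las nf low asc =
  (cong suc m≡ , ≤ᵇ-∸ t m≡ n≡) , _ , conditions (se w) fin las nf (T-∧-intro (ℕ.<⇒<ᵇ (ℕ.<⇒≤ h<k)) low) asc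
acc-sound k x jump (suc h) b (suc m) n (SE ∷ s) h<k t
  with acc-sound k (suc x) fall h (not b) m (n ∸ m) s (ℕ.<⇒≤ h<k) (T-∧ʳ {m ≤ᵇ n} t)
... | (m≡ , n≡) , ws , conditions w fin las nf low asc =
  (cong suc m≡ , ≤ᵇ-∸ t m≡ n≡) , _ , conditions (se w) fin las nf (T-∧-intro (ℕ.<⇒<ᵇ (ℕ.<⇒≤ h<k)) low) asc

-- The invariant of reachable states. It excludes SE after E at positive height and E after NE at
-- height 0, which `acc` rejects although `Valid` alone would admit them.
HeightOf : Mode → ℕ → Set
HeightOf fall h = T true
HeightOf flat h = h ≡ 0
HeightOf rise h = 1 ≤ h
HeightOf jump h = 1 ≤ h

≤ᵇ-+ : ∀ m n → T (m ≤ᵇ m ℕ.+ n)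
≤ᵇ-+ m n = ℕ.≤⇒≤ᵇ (ℕ.m≤m+n m n)

acc-move : ∀ {k md h b} m d s → T (acc k md h b m d s) →
           T ((m ≤ᵇ m ℕ.+ d) ∧ acc k md h b m (m ℕ.+ d ∸ m) s)
acc-move {k} {md} {h} {b} m d s t =
  T-∧-intro (≤ᵇ-+ m d) (subst (λ n → T (acc k md h b m n s)) (sym (ℕ.m+n∸m≡n m d)) t)

N-SE-tail : ∀ md s → T (nFollowedBySE (stepOf md ∷ s)) → T (nFollowedBySE s)
N-SE-tail fall s       nf = nf
N-SE-tail flat s       nf = nf
N-SE-tail rise s       nf = nf
N-SE-tail jump (t ∷ s) nf = T-∧ʳ {isSE t} nf

valid-climb : ∀ {b} md t s → T (isUp t) → T (nFollowedBySE (stepOf md ∷ t ∷ s)) →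
              T (not (isUp t) ∨ (isUp (stepOf md) ∨ b)) → T (mayClimb md b)
valid-climb fall NE s u nf up = up
valid-climb fall N  s u nf up = up
valid-climb flat NE s u nf up = up
valid-climb flat N  s u nf up = up
valid-climb rise NE s u nf up = tt
valid-climb rise N  s u nf up = tt

acc-complete : ∀ {k x} md {h b} s {ws} → HeightOf md h → Valid k x md h b s ws →
               T (acc k md h b (tops (stepOf md) s) (drift (stepOf md) s) s)
acc-complete fall {zero} [] inv (conditions stop fin las nf low asc) = tt
acc-complete {k} md {h} {b} (NE ∷ s) inv (conditions (ne w) fin las nf low asc)
  rewrite if-∧-false (isUp (stepOf md)) =
  T-∧-intro (T-∧-intro (valid-climb {b} md NE s tt nf (T-∧ˡ asc)) (T-∧ˡ low))
    (acc-move {k} {rise} (tops NE s) (drift NE s) s (acc-complete rise s (s≤s z≤n)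
      (conditions w fin las (N-SE-tail md (NE ∷ s) nf) (T-∧ʳ {suc h <ᵇ k} low)
        (T-∧ʳ {not true ∨ (isUp (stepOf md) ∨ b)} asc))))
acc-complete {k} md {h} {b} (N ∷ s) inv (conditions (nn w) fin las nf low asc)
  rewrite if-∧-false (isUp (stepOf md)) =
  T-∧-intro (T-∧-intro (valid-climb {b} md N s tt nf (T-∧ˡ asc)) (T-∧ˡ low))
    (acc-complete jump s (s≤s z≤n)
      (conditions w fin las (N-SE-tail md (N ∷ s) nf) (T-∧ʳ {suc h <ᵇ k} low)
        (T-∧ʳ {not true ∨ (isUp (stepOf md) ∨ b)} asc)))
acc-complete {k} fall (E ∷ s) inv (conditions (ee w) fin las nf low asc) =
  acc-move {k} {flat} (tops E s) (drift E s) s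
    (acc-complete flat s refl (conditions w fin las nf (T-∧ʳ {0 <ᵇ k} low) asc))
acc-complete {k} flat (E ∷ s) inv (conditions (ee w) fin las nf low asc) =
  acc-move {k} {flat} (tops E s) (drift E s) s
    (acc-complete flat s refl (conditions w fin las nf (T-∧ʳ {0 <ᵇ k} low) asc))
acc-complete {k} fall {suc h} (SE ∷ s) inv (conditions (se w) fin las nf low asc) =
  acc-move {k} {fall} (tops SE s) (drift SE s) s
    (acc-complete fall s tt (conditions w fin las nf (T-∧ʳ {h <ᵇ k} low) asc))
acc-complete {k} rise {suc h} (SE ∷ s) inv (conditions (se w) fin las nf low asc) =
  acc-move {k} {fall} (tops SE s) (drift SE s) s
    (acc-complete fall s tt (conditions w fin las nf (T-∧ʳ {h <ᵇ k} low) asc))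
acc-complete {k} jump {suc h} (SE ∷ s) inv (conditions (se w) fin las nf low asc) =
  acc-move {k} {fall} (tops SE s) (drift SE s) s
    (acc-complete fall s tt (conditions w fin las nf (T-∧ʳ {h <ᵇ k} low) asc))

-- Major index, NSE peaks and parity along a word

headPeak : ℕ → Step → List Step → Vertex → List Peak
headPeak i t₀ []      (x , y) = []
headPeak i t₀ (t ∷ _) (x , y) = if isUp t₀ ∧ isSE t then peak i x y (isN t₀) ∷ [] else []

headPeak-SE : ∀ i s v → headPeak i SE s v ≡ []
headPeak-SE i []      v = refl
headPeak-SE i (_ ∷ _) v = refl

headPeak-E : ∀ i s v → headPeak i E s v ≡ []
headPeak-E i []      v = refl
headPeak-E i (_ ∷ _) v = refl

peaksFrom-∷ : ∀ j t s v w vs →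
  peaksFrom j (t ∷ s) (v ∷ w ∷ vs) ≡ headPeak (suc j) t s w ++ peaksFrom (suc j) s (w ∷ vs)
peaksFrom-∷ j t []      v w vs = refl
peaksFrom-∷ j t (_ ∷ s) v w vs = refl

majorIndex-∷ : ∀ i t₀ t s x y ps → majorIndex (headPeak i t₀ (t ∷ s) (x , y) ++ ps)
             ≡ (if isUp t₀ ∧ isSE t then 1 else 0) ℕ.* x ℕ.+ majorIndex ps
majorIndex-∷ i t₀ t s x y ps with isUp t₀ ∧ isSE t
... | true  = cong (ℕ._+ majorIndex ps) (sym (ℕ.+-identityʳ x))
... | false = refl

right-step : ∀ e x d m → e ℕ.* x ℕ.+ (d ℕ.+ m ℕ.* suc x) ≡ m ℕ.+ d ℕ.+ (e ℕ.+ m) ℕ.* x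
right-step = Data.Nat.Tactic.RingSolver.solve-∀

-- Double counting: the abscissa of a peak is `x` plus the number of moves to the right before it,
-- so every such move counts the peaks after it.
majorIndex-drift : ∀ {x y s ws} j t₀ → Walk x y s ws →
  majorIndex (headPeak j t₀ s (x , y) ++ peaksFrom j s ((x , y) ∷ ws)) ≡ drift t₀ s ℕ.+ tops t₀ s ℕ.* x
majorIndex-drift j t₀ stop = refl
majorIndex-drift {x} {y} j t₀ (ne {s = s} {ws} w) = trans
  (majorIndex-∷ j t₀ NE s x y _)
  (trans (cong ((if isUp t₀ ∧ isSE NE then 1 else 0) ℕ.* x ℕ.+_) (trans
           (cong majorIndex (peaksFrom-∷ j NE s (x , y) (suc x , suc y) ws)) (majorIndex-drift (suc j) NE w)))
         (right-step (if isUp t₀ ∧ isSE NE then 1 else 0) x (drift NE s) (tops NE s)))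
majorIndex-drift {x} {suc y} j t₀ (se {s = s} {ws} w) = trans
  (majorIndex-∷ j t₀ SE s x (suc y) _)
  (trans (cong ((if isUp t₀ ∧ isSE SE then 1 else 0) ℕ.* x ℕ.+_) (trans
           (cong majorIndex (peaksFrom-∷ j SE s (x , suc y) (suc x , y) ws)) (majorIndex-drift (suc j) SE w)))
         (right-step (if isUp t₀ ∧ isSE SE then 1 else 0) x (drift SE s) (tops SE s)))
majorIndex-drift {x} j t₀ (ee {s = s} {ws} w) = trans
  (majorIndex-∷ j t₀ E s x 0 _)
  (trans (cong ((if isUp t₀ ∧ isSE E then 1 else 0) ℕ.* x ℕ.+_) (trans
           (cong majorIndex (peaksFrom-∷ j E s (x , 0) (suc x , 0) ws)) (majorIndex-drift (suc j) E w)))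
         (right-step (if isUp t₀ ∧ isSE E then 1 else 0) x (drift E s) (tops E s)))
majorIndex-drift {x} {y} j t₀ (nn {s = s} {ws} w) = trans
  (majorIndex-∷ j t₀ N s x y _)
  (trans (cong ((if isUp t₀ ∧ isSE N then 1 else 0) ℕ.* x ℕ.+_) (trans
           (cong majorIndex (peaksFrom-∷ j N s (x , y) (x , suc y) ws)) (majorIndex-drift (suc j) N w)))
         (vertical-step (if isUp t₀ ∧ isSE N then 1 else 0) x (drift N s) (tops N s)))
  where
  vertical-step : ∀ e x d m → e ℕ.* x ℕ.+ (d ℕ.+ m ℕ.* x) ≡ d ℕ.+ (e ℕ.+ m) ℕ.* x
  vertical-step = Data.Nat.Tactic.RingSolver.solve-∀

majorIndex-peaks : ∀ {y s ws} → Walk 0 y s ws → majorIndex (peaks s ((0 , y) ∷ ws)) ≡ drift SE s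
majorIndex-peaks {y} {s} {ws} w = begin
  majorIndex (peaks s ((0 , y) ∷ ws))
    ≡⟨ cong (λ ps → majorIndex (ps ++ peaks s ((0 , y) ∷ ws))) (headPeak-SE 0 s (0 , y)) ⟨
  majorIndex (headPeak 0 SE s (0 , y) ++ peaks s ((0 , y) ∷ ws))
    ≡⟨ majorIndex-drift 0 SE w ⟩
  drift SE s ℕ.+ tops SE s ℕ.* 0
    ≡⟨ cong (drift SE s ℕ.+_) (ℕ.*-zeroʳ (tops SE s)) ⟩
  drift SE s ℕ.+ 0
    ≡⟨ ℕ.+-identityʳ (drift SE s) ⟩
  drift SE s ∎
  where open ≡-Reasoning

W-∷ : ∀ q ps X → W (q ∷ ps) X ≡ (if nse q ∧ (px q ≤ᵇ X) then 1 else 0) ℕ.+ W ps X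
W-∷ q ps X with nse q ∧ (px q ≤ᵇ X)
... | true  = refl
... | false = refl

W-headPeak-NE : ∀ i s v ps X → W (headPeak i NE s v ++ ps) X ≡ W ps X
W-headPeak-NE i []       v       ps X = refl
W-headPeak-NE i (SE ∷ s) (x , y) ps X = W-∷ (peak i x y false) ps X
W-headPeak-NE i (NE ∷ s) v       ps X = refl
W-headPeak-NE i (N ∷ s)  v       ps X = refl
W-headPeak-NE i (E ∷ s)  v       ps X = refl

W-headPeak-beyond : ∀ i t s {x y} ps {X} → X < x → W (headPeak i t s (x , y) ++ ps) X ≡ W ps X
W-headPeak-beyond i t []       ps X<x = refl
W-headPeak-beyond i t (t′ ∷ s) {x} {y} ps {X} X<x with isUp t ∧ isSE t′
... | false = refl
... | true  = trans (W-∷ (peak i x y (isN t)) ps X)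
  (cong (ℕ._+ W ps X) (trans
    (cong (λ c → if isN t ∧ c then 1 else 0) (¬T⇒false (λ p → ℕ.<⇒≱ X<x (ℕ.≤ᵇ⇒≤ x X p))))
    (if-∧-false (isN t))))

W-beyond : ∀ {x y s ws} j {X} → Walk x y s ws → X < x → W (peaksFrom j s ((x , y) ∷ ws)) X ≡ 0
W-beyond j stop X<x = refl
W-beyond {x} {y} j (ne {s = s} {ws} w) X<x rewrite peaksFrom-∷ j NE s (x , y) (suc x , suc y) ws =
  trans (W-headPeak-beyond (suc j) NE s _ (ℕ.m<n⇒m<1+n X<x)) (W-beyond (suc j) w (ℕ.m<n⇒m<1+n X<x))
W-beyond {x} {suc y} j (se {s = s} {ws} w) X<x rewrite peaksFrom-∷ j SE s (x , suc y) (suc x , y) ws =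
  trans (W-headPeak-beyond (suc j) SE s _ (ℕ.m<n⇒m<1+n X<x)) (W-beyond (suc j) w (ℕ.m<n⇒m<1+n X<x))
W-beyond {x} {y} j (nn {s = s} {ws} w) X<x rewrite peaksFrom-∷ j N s (x , y) (x , suc y) ws =
  trans (W-headPeak-beyond (suc j) N s _ X<x) (W-beyond (suc j) w X<x)
W-beyond {x} j (ee {s = s} {ws} w) X<x rewrite peaksFrom-∷ j E s (x , 0) (suc x , 0) ws =
  trans (W-headPeak-beyond (suc j) E s _ (ℕ.m<n⇒m<1+n X<x)) (W-beyond (suc j) w (ℕ.m<n⇒m<1+n X<x))

vertexAt : List Vertex → ℕ → Vertex
vertexAt []       _       = 0 , 0
vertexAt (v ∷ vs) zero    = v
vertexAt (v ∷ vs) (suc i) = vertexAt vs i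

stepAt : List Step → ℕ → Step
stepAt []      _       = E
stepAt (t ∷ s) zero    = t
stepAt (t ∷ s) (suc i) = stepAt s i

walk-x≤ : ∀ {x y s ws} i → Walk x y s ws → i ≤ length s → x ≤ proj₁ (vertexAt ((x , y) ∷ ws) i)
walk-x≤ zero    w      _         = ℕ.≤-refl
walk-x≤ (suc i) (ne w) (s≤s i≤)  = ℕ.<⇒≤ (walk-x≤ i w i≤)
walk-x≤ (suc i) (se w) (s≤s i≤)  = ℕ.<⇒≤ (walk-x≤ i w i≤)
walk-x≤ (suc i) (nn w) (s≤s i≤)  = walk-x≤ i w i≤
walk-x≤ (suc i) (ee w) (s≤s i≤)  = ℕ.<⇒≤ (walk-x≤ i w i≤)

-- Every step either moves right or is the N step of exactly one NSE peak.
x+W : ∀ {x y s ws} j i → Walk x y s ws → T (nFollowedBySE s) → i < length s → stepAt s i ≡ SE →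
      let X = proj₁ (vertexAt ((x , y) ∷ ws) i) in X ℕ.+ W (peaksFrom j s ((x , y) ∷ ws)) X ≡ x ℕ.+ i
x+W {x} {suc y} j zero (se {s = s} {ws} w) nf i< eq
  rewrite peaksFrom-∷ j SE s (x , suc y) (suc x , y) ws =
  cong (x ℕ.+_) (trans (W-headPeak-beyond (suc j) SE s _ ℕ.≤-refl) (W-beyond (suc j) w ℕ.≤-refl))
x+W {x} {y} j (suc i) (ne {s = s} {ws} w) nf (s≤s i<) eq
  rewrite peaksFrom-∷ j NE s (x , y) (suc x , suc y) ws =
  trans (cong (X ℕ.+_) (W-headPeak-NE (suc j) s (suc x , suc y) (peaksFrom (suc j) s ((suc x , suc y) ∷ ws)) X))
        (trans (x+W (suc j) i w nf i< eq) (sym (ℕ.+-suc x i)))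
  where X = proj₁ (vertexAt ((suc x , suc y) ∷ ws) i)
x+W {x} {suc y} j (suc i) (se {s = s} {ws} w) nf (s≤s i<) eq
  rewrite peaksFrom-∷ j SE s (x , suc y) (suc x , y) ws =
  trans (cong (X ℕ.+_) (cong (λ ps → W (ps ++ peaksFrom (suc j) s ((suc x , y) ∷ ws)) X) (headPeak-SE (suc j) s _)))
        (trans (x+W (suc j) i w nf i< eq) (sym (ℕ.+-suc x i)))
  where
  X = proj₁ (vertexAt ((suc x , y) ∷ ws) i)
x+W {x} j (suc i) (ee {s = s} {ws} w) nf (s≤s i<) eq
  rewrite peaksFrom-∷ j E s (x , 0) (suc x , 0) ws =
  trans (cong (X ℕ.+_) (cong (λ ps → W (ps ++ peaksFrom (suc j) s ((suc x , 0) ∷ ws)) X) (headPeak-E (suc j) s _)))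
        (trans (x+W (suc j) i w nf i< eq) (sym (ℕ.+-suc x i)))
  where
  X = proj₁ (vertexAt ((suc x , 0) ∷ ws) i)
x+W {x} {y} j (suc i) (nn {s = SE ∷ s} {ws} w) nf (s≤s i<) eq
  rewrite peaksFrom-∷ j N (SE ∷ s) (x , y) (x , suc y) ws =
  trans (cong (X ℕ.+_) (trans (W-∷ (peak (suc j) x (suc y) true) ps X)
          (cong (λ c → (if c then 1 else 0) ℕ.+ W ps X) (Bool.T-≡ .Equivalence.to (ℕ.≤⇒≤ᵇ (walk-x≤ i w (ℕ.<⇒≤ i<)))))))
        (trans (ℕ.+-suc X (W ps X)) (trans (cong suc (x+W (suc j) i w nf i< eq)) (sym (ℕ.+-suc x i))))
  where
  X = proj₁ (vertexAt ((x , suc y) ∷ ws) i)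
  ps = peaksFrom (suc j) (SE ∷ s) ((x , suc y) ∷ ws)

odd-%2 : ∀ n → (n % 2 ≡ᵇ 1) ≡ odd n
odd-%2 zero          = refl
odd-%2 (suc zero)    = refl
odd-%2 (suc (suc n)) = trans (odd-%2 n) (sym (Bool.not-involutive (odd n)))

odd-⊖ : ∀ m n → odd ℤ.∣ m ℤ.⊖ n ∣ ≡ odd (m ℕ.+ n)
odd-⊖ m       zero    = cong odd (sym (ℕ.+-identityʳ m))
odd-⊖ zero    (suc n) = refl
odd-⊖ (suc m) (suc n) = trans (cong (odd ∘ ℤ.∣_∣) (ℤ.[1+m]⊖[1+n]≡m⊖n m n))
  (trans (odd-⊖ m n) (trans (sym (Bool.not-involutive _)) (cong (not ∘ odd) (sym (ℕ.+-suc m n)))))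

-- Only the parity matters, so the integer subtractions may become additions of naturals.
isEvenPeak-odd : ∀ vs ps p → isEvenPeak vs ps p ≡ odd (px p ℕ.+ (relHeight vs ps p ℕ.+ W ps (px p)))
isEvenPeak-odd vs ps p = trans (odd-%2 ℤ.∣ + px p ℤ.- + r ℤ.- + w ∣) (trans (cong (odd ∘ ℤ.∣_∣) regroup) (odd-⊖ (px p) (r ℕ.+ w)))
  where
  r = relHeight vs ps p
  w = W ps (px p)
  assoc : ∀ a b c → a ℤ.- b ℤ.- c ≡ a ℤ.- (b ℤ.+ c)
  assoc = Data.Integer.Tactic.RingSolver.solve-∀
  regroup : + px p ℤ.- + r ℤ.- + w ≡ px p ℤ.⊖ (r ℕ.+ w)
  regroup = trans (assoc (+ px p) (+ r) (+ w)) (ℤ.m-n≡m⊖n (px p) (r ℕ.+ w))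

odd-cancelʳ : ∀ a b c → odd (a ℕ.+ c) ≡ odd (b ℕ.+ c) → odd a ≡ odd b
odd-cancelʳ a b zero    eq rewrite ℕ.+-identityʳ a | ℕ.+-identityʳ b = eq
odd-cancelʳ a b (suc c) eq rewrite ℕ.+-suc a c | ℕ.+-suc b c = odd-cancelʳ a b c (Bool.not-injective eq)

flips : Bool → ℕ → Bool
flips b zero    = b
flips b (suc i) = flips (not b) i

flips-not : ∀ b i → flips (not b) i ≡ not (flips b i)
flips-not b zero    = refl
flips-not b (suc i) = flips-not (not b) i

flips-odd : ∀ i → flips false i ≡ odd i
flips-odd zero    = refl
flips-odd (suc i) = trans (flips-not false i) (cong not (flips-odd i))

StartsAt : Bool → List Step → ℕ → Set
StartsAt u s zero    = ¬ T u
StartsAt u s (suc i) = ¬ T (isUp (stepAt s i))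

OddStarts : Bool → Bool → List Step → Set
OddStarts u b s = ∀ i → i < length s → T (isUp (stepAt s i)) → StartsAt u s i → T (flips b i)

oddAscents⇒ : ∀ u b s → T (oddAscents u b s) → OddStarts u b s
oddAscents⇒ u b (t ∷ s) asc zero    _        up ¬u = first up ¬u (T-∧ˡ asc)
  where
  first : ∀ {c u b} → T c → ¬ T u → T (not c ∨ (u ∨ b)) → T b
  first {true} {true}  _ ¬u _ = ⊥-elim (¬u tt)
  first {true} {false} _ _  p = p
oddAscents⇒ u b (t ∷ s) asc (suc i) (s≤s i<) up start =
  oddAscents⇒ (isUp t) (not b) s (T-∧ʳ {not (isUp t) ∨ (u ∨ b)} asc) i i< up (shift i start)
  where
  shift : ∀ i → StartsAt u (t ∷ s) (suc i) → StartsAt (isUp t) s i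
  shift zero    p = p
  shift (suc i) p = p

oddAscents⇐ : ∀ u b s → OddStarts u b s → T (oddAscents u b s)
oddAscents⇐ u b []      _  = tt
oddAscents⇐ u b (t ∷ s) os = T-∧-intro
  (first (os 0 (s≤s z≤n)))
  (oddAscents⇐ (isUp t) (not b) s (λ i i< up start → os (suc i) (s≤s i<) up (shift i start)))
  where
  first : ∀ {c u b} → (T c → ¬ T u → T b) → T (not c ∨ (u ∨ b))
  first {false}        _ = tt
  first {true} {true}  _ = tt
  first {true} {false} f = f tt id
  shift : ∀ i → StartsAt (isUp t) s i → StartsAt u (t ∷ s) (suc i)
  shift zero    p = p
  shift (suc i) p = p

-- The value 0 is also the default when no positive candidate satisfies `P`, hence the guard in the
-- last component.
largest-spec : ∀ B P → (∀ h → largest B P < h → h ≤ B → ¬ T (P h))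
             × largest B P ≤ B × (1 ≤ largest B P → T (P (largest B P)))
largest-spec zero    P = (λ { h 0<h h≤0 _ → ℕ.<⇒≱ 0<h h≤0 }) , z≤n , λ ()
largest-spec (suc B) P with P (suc B) in eq
... | true  = (λ h B<h h≤B _ → ℕ.<⇒≱ B<h h≤B) , ℕ.≤-refl , λ _ → subst T (sym eq) tt
... | false with largest-spec B P
...   | above , ≤B , holds = (λ h l<h h≤ → beyond h l<h (ℕ.m≤n⇒m<n∨m≡n h≤)) , ℕ.m≤n⇒m≤1+n ≤B , holds
  where
  beyond : ∀ h → largest B P < h → h < suc B ⊎ h ≡ suc B → ¬ T (P h)
  beyond h l<h (inj₁ (s≤s h≤B)) = above h l<h h≤B
  beyond h l<h (inj₂ refl)      = λ p → subst T eq p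

any-indexed⇒ : ∀ (f : ℕ × Vertex → Bool) (g : ℕ → ℕ) vs →
  T (any f (List.zip (applyUpTo g (length vs)) vs)) → Σ ℕ λ i → i < length vs × T (f (g i , vertexAt vs i))
any-indexed⇒ f g (v ∷ vs) t with f (g 0 , v) in eq
... | true  = 0 , s≤s z≤n , subst T (sym eq) tt
... | false with any-indexed⇒ f (g ∘ suc) vs t
...   | i , i< , p = suc i , s≤s i< , p

T-∨ʳ : ∀ a {b} → T b → T (a ∨ b)
T-∨ʳ true  _ = tt
T-∨ʳ false p = p

T-∨ˡ : ∀ {a b} → T a → T (a ∨ b)
T-∨ˡ {true} _ = tt

any-indexed⇐ : ∀ (f : ℕ × Vertex → Bool) (g : ℕ → ℕ) vs i → i < length vs → T (f (g i , vertexAt vs i)) →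
  T (any f (List.zip (applyUpTo g (length vs)) vs))
any-indexed⇐ f g (v ∷ vs) zero    _        p = T-∨ˡ p
any-indexed⇐ f g (v ∷ vs) (suc i) (s≤s i<) p =
  T-∨ʳ (f (g 0 , v)) (any-indexed⇐ f (g ∘ suc) vs i i< p)

all-++⇒ : ∀ {A : Set} (f : A → Bool) xs {ys} → T (all f (xs ++ ys)) → T (all f xs) × T (all f ys)
all-++⇒ f []       t = tt , t
all-++⇒ f (x ∷ xs) t with all-++⇒ f xs (T-∧ʳ {f x} t)
... | p , q = T-∧-intro (T-∧ˡ t) p , q

all-++⇐ : ∀ {A : Set} (f : A → Bool) xs {ys} → T (all f xs) → T (all f ys) → T (all f (xs ++ ys))
all-++⇐ f []       p q = q
all-++⇐ f (x ∷ xs) p q = T-∧-intro (T-∧ˡ p) (all-++⇐ f xs (T-∧ʳ {f x} p) q)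

peakAt : ℕ → List Step → List Vertex → ℕ → Peak
peakAt j s vs i = peak (suc (j ℕ.+ i)) (proj₁ (vertexAt vs (suc i))) (proj₂ (vertexAt vs (suc i))) (isN (stepAt s i))

all-peaks⇒ : ∀ f j s v ws → length s ≤ length ws → T (all f (peaksFrom j s (v ∷ ws))) →
  ∀ i → suc i < length s → T (isUp (stepAt s i)) → stepAt s (suc i) ≡ SE → T (f (peakAt j s (v ∷ ws) i))
all-peaks⇒ f j (t ∷ SE ∷ s) v (w ∷ ws) (s≤s len) a zero i< up refl with isUp t
... | true rewrite ℕ.+-identityʳ j = T-∧ˡ a
all-peaks⇒ f j (t ∷ []) v (w ∷ ws) (s≤s len) a (suc i) (s≤s ()) up eq
all-peaks⇒ f j (t ∷ t′ ∷ s) v (w ∷ ws) (s≤s len) a (suc i) (s≤s i<) up eq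
  rewrite ℕ.+-suc j i =
  all-peaks⇒ f (suc j) (t′ ∷ s) w ws len (proj₂ (all-++⇒ f (headPeak (suc j) t (t′ ∷ s) w) a)) i i< up eq

all-peaks⇐ : ∀ f j s v ws → length s ≤ length ws →
  (∀ i → suc i < length s → T (isUp (stepAt s i)) → stepAt s (suc i) ≡ SE → T (f (peakAt j s (v ∷ ws) i))) →
  T (all f (peaksFrom j s (v ∷ ws)))
all-peaks⇐ f j []           v ws       len       h = tt
all-peaks⇐ f j (t ∷ [])     v (w ∷ ws) (s≤s len) h = tt
all-peaks⇐ f j (t ∷ t′ ∷ s) v (w ∷ ws) (s≤s len) h =
  all-++⇐ f (headPeak (suc j) t (t′ ∷ s) w) (head-ok t t′ (h 0 (s≤s (s≤s z≤n))))
    (all-peaks⇐ f (suc j) (t′ ∷ s) w ws len λ i i< up eq →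
      subst (λ m → T (f (peak (suc m) (proj₁ (vertexAt ws i)) (proj₂ (vertexAt ws i)) (isN (stepAt (t′ ∷ s) i)))))
        (ℕ.+-suc j i) (h (suc i) (s≤s i<) up eq))
  where
  head-ok : ∀ t t′ → (T (isUp t) → t′ ≡ SE → T (f (peakAt j (t ∷ t′ ∷ s) (v ∷ w ∷ ws) 0))) →
            T (all f (headPeak (suc j) t (t′ ∷ s) w))
  head-ok t NE h₀ rewrite Bool.∧-zeroʳ (isUp t) = tt
  head-ok t N  h₀ rewrite Bool.∧-zeroʳ (isUp t) = tt
  head-ok t E  h₀ rewrite Bool.∧-zeroʳ (isUp t) = tt
  head-ok t SE h₀ with isUp t
  ... | false = tt
  ... | true rewrite ℕ.+-identityʳ j = T-∧-intro (h₀ tt refl) tt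

-- Relative heights

walk-path : ∀ {x y s ws} → Walk x y s ws → Path (length s) (vertexAt ((x , y) ∷ ws)) (stepAt s)
walk-path (ne w) zero    _         = ne
walk-path (ne w) (suc i) (s≤s i<L) = walk-path w i i<L
walk-path (se w) zero    _         = se
walk-path (se w) (suc i) (s≤s i<L) = walk-path w i i<L
walk-path (nn w) zero    _         = nn
walk-path (nn w) (suc i) (s≤s i<L) = walk-path w i i<L
walk-path (ee w) zero    _         = ee
walk-path (ee w) (suc i) (s≤s i<L) = walk-path w i i<L

walk-length : ∀ {x y s ws} → Walk x y s ws → length ws ≡ length s
walk-length stop   = refl
walk-length (ne w) = cong suc (walk-length w)
walk-length (se w) = cong suc (walk-length w)
walk-length (nn w) = cong suc (walk-length w)
walk-length (ee w) = cong suc (walk-length w)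

walk-ends-0 : ∀ {x y s ws} → Walk x y s ws → T (finalHeight0 ((x , y) ∷ ws)) →
              proj₂ (vertexAt ((x , y) ∷ ws) (length s)) ≡ 0
walk-ends-0 {y = y} stop   t = ℕ.≡ᵇ⇒≡ y 0 t
walk-ends-0 (ne w) t = walk-ends-0 w t
walk-ends-0 (se w) t = walk-ends-0 w t
walk-ends-0 (nn w) t = walk-ends-0 w t
walk-ends-0 (ee w) t = walk-ends-0 w t

T-∨-elim : ∀ {a b} → T (not a ∨ b) → T a → T b
T-∨-elim {true} p _ = p

T-∨-intro : ∀ {a b} → (T a → T b) → T (not a ∨ b)
T-∨-intro {false} _ = tt
T-∨-intro {true}  f = f tt

notDominating : Peak → ℕ → ℕ → Peak → Bool
notDominating p i i′ q =
  not ((i <ᵇ idx q) ∧ (idx q <ᵇ i′)) ∨ ((py q ≤ᵇ py p) ∧ (not (py q ≡ᵇ py p) ∨ (px p ≤ᵇ px q)))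

relOKAt : List Vertex → List Peak → Peak → ℕ → ℕ → ℕ → Bool
relOKAt vs ps p h i i′ =
  (i <ᵇ i′) ∧ (proj₂ (vertexAt vs i) ≡ᵇ (py p ∸ h)) ∧ (proj₂ (vertexAt vs i′) ≡ᵇ (py p ∸ h))
  ∧ (proj₁ (vertexAt vs i) ≤ᵇ px p) ∧ (px p <ᵇ proj₁ (vertexAt vs i′)) ∧ all (notDominating p i i′) ps

relOK⇒ : ∀ vs ps p h → T (relOK vs ps p h) →
  Σ ℕ λ i → Σ ℕ λ i′ → i < length vs × i′ < length vs × T (relOKAt vs ps p h i i′)
relOK⇒ vs ps p h t with any-indexed⇒ _ id vs t
... | i , i< , t₁ with any-indexed⇒ _ id vs t₁
...   | i′ , i′< , t₂ = i , i′ , i< , i′< , t₂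

relOK⇐ : ∀ vs ps p h i i′ → i < length vs → i′ < length vs → T (relOKAt vs ps p h i i′) → T (relOK vs ps p h)
relOK⇐ vs ps p h i i′ i< i′< t = any-indexed⇐ _ id vs i i< (any-indexed⇐ _ id vs i′ i′< t)

module WalkPeaks {d s ws} (w : Walk 0 d s ws) where
  vs : List Vertex
  vs = (0 , d) ∷ ws

  ps : List Peak
  ps = peaks s vs

  open Peaks (length s) (vertexAt vs) (stepAt s) (walk-path w)

  x-step : ∀ i → i < length s → x i ≤ x (suc i)
  x-step i i<L with vertexAt vs i | stepAt s i | vertexAt vs (suc i) | walk-path w i i<L
  ... | _ | _ | _ | ne = ℕ.n≤1+n _
  ... | _ | _ | _ | se = ℕ.n≤1+n _
  ... | _ | _ | _ | nn = ℕ.≤-refl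
  ... | _ | _ | _ | ee = ℕ.n≤1+n _

  x-SE : ∀ i → i < length s → stepAt s i ≡ SE → x i < x (suc i)
  x-SE i i<L eq with vertexAt vs i | stepAt s i | vertexAt vs (suc i) | walk-path w i i<L
  x-SE i i<L refl | _ | _ | _ | se = ℕ.≤-refl

  x-mono : ∀ {i j} → i ℕ.≤′ j → j ≤ length s → x i ≤ x j
  x-mono ℕ.≤′-refl        _   = ℕ.≤-refl
  x-mono (ℕ.≤′-step {j} i≤j) j≤L = ℕ.≤-trans (x-mono i≤j (ℕ.<⇒≤ j≤L)) (x-step j j≤L)

  -- Abscissae are only weakly increasing because of N steps; the SE step at the peak makes the
  -- comparison strict, and so turns the abscissa conditions of the definition into index
  -- conditions.
  x-after-peak : ∀ {p j} → Peakᵥ p → p < j → j ≤ length s → x p < x j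
  x-after-peak {p} pk p<j j≤L = ℕ.<-≤-trans (x-SE p (peak<L p pk) (peak-falls p pk)) (x-mono (ℕ.≤⇒≤′ p<j) j≤L)

  length-vs : length vs ≡ suc (length s)
  length-vs = cong suc (walk-length w)

  thePeak : ℕ → Peak
  thePeak = peakAt 0 s vs

  relOK⇒Reach : ∀ j h → Peakᵥ (suc j) → T (relOK vs ps (thePeak j) h) → Reach (suc j) (y (suc j) ∸ h)
  relOK⇒Reach j h pk t
    with relOK⇒ vs ps (thePeak j) h t
  ... | i , i′ , i< , i′< , t₂
    with T-∧ʳ {i <ᵇ i′} t₂
  ... | t₃ with T-∧ʳ {y i ≡ᵇ (y (suc j) ∸ h)} t₃
  ... | t₄ with T-∧ʳ {y i′ ≡ᵇ (y (suc j) ∸ h)} t₄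
  ... | t₅ with T-∧ʳ {x i ≤ᵇ x (suc j)} t₅
  ... | t₆ = reach
    (ℕ.≮⇒≥ λ p<i → ℕ.<⇒≱ (x-after-peak pk p<i (index≤ i<)) (ℕ.≤ᵇ⇒≤ (x i) (x (suc j)) (T-∧ˡ t₅)))
    (ℕ.≰⇒> λ i′≤p → ℕ.<⇒≱ (ℕ.<ᵇ⇒< (x (suc j)) (x i′) (T-∧ˡ t₆))
                          (x-mono (ℕ.≤⇒≤′ i′≤p) (ℕ.<⇒≤ (peak<L (suc j) pk))))
    (index≤ i′<)
    (ℕ.≡ᵇ⇒≡ (y i) _ (T-∧ˡ t₃)) (ℕ.≡ᵇ⇒≡ (y i′) _ (T-∧ˡ t₄)) dom
    where
    index≤ : ∀ {i} → i < length vs → i ≤ length s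
    index≤ {i} i< = ℕ.s≤s⁻¹ (subst (i <_) length-vs i<)
    dom : Dominated (suc j) i i′
    dom (suc q) pkq@(q<L , up-q , SE-q) i<q q<i′ = ℕ.≤ᵇ⇒≤ _ _ (T-∧ˡ here) , λ yq≡ →
      ℕ.≮⇒≥ λ q<p → ℕ.<⇒≱ (x-after-peak pkq q<p (ℕ.<⇒≤ (peak<L (suc j) pk)))
        (ℕ.≤ᵇ⇒≤ _ _ (T-∨-elim {y (suc q) ≡ᵇ y (suc j)} (T-∧ʳ {y (suc q) ≤ᵇ y (suc j)} here) (ℕ.≡⇒≡ᵇ _ _ yq≡)))
      where
      here = T-∨-elim {(i <ᵇ suc q) ∧ (suc q <ᵇ i′)}
        (all-peaks⇒ (notDominating (thePeak j) i i′) 0 s (0 , d) ws (ℕ.≤-reflexive (sym (walk-length w)))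
                    (T-∧ʳ {x (suc j) <ᵇ x i′} t₆) q q<L up-q SE-q)
        (T-∧-intro (ℕ.<⇒<ᵇ i<q) (ℕ.<⇒<ᵇ q<i′))

  Reach⇒relOK : ∀ j h → Peakᵥ (suc j) → Reach (suc j) (y (suc j) ∸ h) → T (relOK vs ps (thePeak j) h)
  Reach⇒relOK j h pk (reach {i} {i′} i≤p p<i′ i′≤L yi yi′ dom) =
    relOK⇐ vs ps (thePeak j) h i i′
      (index< (ℕ.≤-trans i≤p (ℕ.<⇒≤ (peak<L (suc j) pk)))) (index< i′≤L)
        (T-∧-intro (ℕ.<⇒<ᵇ (ℕ.≤-<-trans i≤p p<i′)) (T-∧-intro (ℕ.≡⇒≡ᵇ _ _ yi) (T-∧-intro (ℕ.≡⇒≡ᵇ _ _ yi′)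
          (T-∧-intro (ℕ.≤⇒≤ᵇ (x-mono (ℕ.≤⇒≤′ i≤p) (ℕ.<⇒≤ (peak<L (suc j) pk))))
            (T-∧-intro (ℕ.<⇒<ᵇ (x-after-peak pk p<i′ i′≤L))
              (all-peaks⇐ (notDominating (thePeak j) i i′) 0 s (0 , d) ws (ℕ.≤-reflexive (sym (walk-length w))) each))))))
    where
    index< : ∀ {i} → i ≤ length s → i < length vs
    index< {i} i≤ = subst (i <_) (sym length-vs) (s≤s i≤)
    each : ∀ q → suc q < length s → T (isUp (stepAt s q)) → stepAt s (suc q) ≡ SE →
      T (notDominating (thePeak j) i i′ (thePeak q))
    each q q<L up-q SE-q = T-∨-intro {(i <ᵇ suc q) ∧ (suc q <ᵇ i′)} λ t →
      let (y≤ , first) = dom (suc q) (q<L , up-q , SE-q) (ℕ.<ᵇ⇒< i (suc q) (T-∧ˡ t))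
                             (ℕ.<ᵇ⇒< (suc q) i′ (T-∧ʳ {i <ᵇ suc q} t))
      in T-∧-intro (ℕ.≤⇒≤ᵇ y≤) (T-∨-intro {y (suc q) ≡ᵇ y (suc j)} λ e →
           ℕ.≤⇒≤ᵇ (x-mono (ℕ.≤⇒≤′ (first (ℕ.≡ᵇ⇒≡ _ _ e))) (ℕ.<⇒≤ q<L)))

  height : ℕ → ℕ
  height j = relHeight vs ps (thePeak j)

  module _ (nf : T (nFollowedBySE s)) (yL : y (length s) ≡ 0) where

    -- By `x+W` the abscissa plus W is the index j + 1 of the peak, so the peak is even iff j + 1 +
    -- r is odd. Adding the base height y i = y (j+1) - r gives j + 1 + y (j+1), which has the
    -- parity of i + y i; then y i cancels.
    even-base : ∀ j i → Peakᵥ (suc j) → height j ≤ y (suc j) → y i ≡ y (suc j) ∸ height j →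
      odd (suc j ℕ.+ y (suc j)) ≡ odd (i ℕ.+ y i) → isEvenPeak vs ps (thePeak j) ≡ odd i
    even-base j i pk r≤ yi par = trans (isEvenPeak-odd vs ps (thePeak j)) (trans
      (cong odd (trans (rotate (x (suc j)) (height j) (W ps (x (suc j))))
                       (cong (ℕ._+ height j) (x+W 0 (suc j) w nf (peak<L (suc j) pk) (peak-falls (suc j) pk)))))
      (odd-cancelʳ (suc j ℕ.+ height j) i (y i) (trans (cong odd (trans
         (ℕ.+-assoc (suc j) (height j) (y i))
         (cong (suc j ℕ.+_) (trans (cong (height j ℕ.+_) yi) (ℕ.m+[n∸m]≡n r≤))))) par)))
      where
      rotate : ∀ a b c → a ℕ.+ (b ℕ.+ c) ≡ a ℕ.+ c ℕ.+ b
      rotate = Data.Nat.Tactic.RingSolver.solve-∀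

    even⇒odd : T (all (isEvenPeak vs ps) ps) → OddStarts false false s
    even⇒odd ev i i<L up-i start = subst T (sym (flips-odd i)) (from (base-peak i (i<L , up-i , starts i start) yL))
      where
      starts : ∀ i → StartsAt false s i → Starts i
      starts zero    _ = tt
      starts (suc i) p = p
      from : BasePeak i → T (odd i)
      from (basePeak {suc j} pk@(j<L , up-j , SE-j) reaches above lowest par) =
        subst T (even-base j i pk (ℕ.≤-trans (ℕ.≤-reflexive height≡) (ℕ.m∸n≤m _ (y i)))
                   (sym (trans (cong (y (suc j) ∸_) height≡) (ℕ.m∸[m∸n]≡n (ℕ.<⇒≤ above)))) par)
          (all-peaks⇒ (isEvenPeak vs ps) 0 s (0 , d) ws (ℕ.≤-reflexive (sym (walk-length w))) ev j j<L up-j SE-j)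
        where
        Y = y (suc j)
        spec = largest-spec Y (relOK vs ps (thePeak j))
        -- The difference is a candidate by `reaches`; a larger relative height would have its base
        -- below `y i`, against `lowest`.
        height≡ : height j ≡ Y ∸ y i
        height≡ = ℕ.≤-antisym
          (ℕ.≮⇒≥ λ lt → lowest (Y ∸ height j)
            (ℕ.<-≤-trans (ℕ.∸-monoʳ-< {Y} lt (proj₁ (proj₂ spec))) (ℕ.≤-reflexive (ℕ.m∸[m∸n]≡n (ℕ.<⇒≤ above))))
            (relOK⇒Reach j (height j) pk (proj₂ (proj₂ spec) (ℕ.≤-trans (s≤s z≤n) lt))))
          (ℕ.≮⇒≥ λ lt → proj₁ spec (Y ∸ y i) lt (ℕ.m∸n≤m Y (y i))
            (Reach⇒relOK j (Y ∸ y i) pk (subst (Reach (suc j)) (sym (ℕ.m∸[m∸n]≡n (ℕ.<⇒≤ above))) reaches)))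

    odd⇒even : OddStarts false false s → T (all (isEvenPeak vs ps) ps)
    odd⇒even os = all-peaks⇐ (isEvenPeak vs ps) 0 s (0 , d) ws (ℕ.≤-reflexive (sym (walk-length w)))
      λ j j<L up-j SE-j → each j (j<L , up-j , SE-j)
      where
      each : ∀ j → Peakᵥ (suc j) → T (isEvenPeak vs ps (thePeak j))
      each j pk = conclude (ascent-below (suc j) (Y ∸ r) pk
          (relOK⇒Reach j r pk (proj₂ (proj₂ spec) 1≤r)) (ℕ.∸-monoʳ-< {Y} 1≤r r≤Y) maximal yL)
        where
        Y = y (suc j)
        r = height j
        spec = largest-spec Y (relOK vs ps (thePeak j))
        r≤Y = proj₁ (proj₂ spec)
        -- The up step and the SE step around the peak always give the candidate 1, so `largest` has
        -- returned a true candidate and not its default 0.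
        1≤r : 1 ≤ r
        1≤r = ℕ.≮⇒≥ λ r<1 → proj₁ spec 1 r<1 (proj₁ (reach-one (suc j) pk))
                               (Reach⇒relOK j 1 pk (proj₂ (reach-one (suc j) pk)))
        maximal : ∀ b → suc b ≡ Y ∸ r → ¬ Reach (suc j) b
        maximal b eq re = proj₁ spec (suc r) ℕ.≤-refl
          (ℕ.m∸n≢0⇒n<m λ e → ℕ.1+n≢0 (trans eq e)) (Reach⇒relOK j (suc r) pk (subst (Reach (suc j)) b≡ re))
          where
          b≡ : b ≡ Y ∸ suc r
          b≡ = trans (cong ℕ.pred eq) (ℕ.pred[m∸n]≡m∸[1+n] Y r)
        conclude : (Σ ℕ λ i → AscentStart i × y i ≡ Y ∸ r × odd (i ℕ.+ y i) ≡ odd (suc j ℕ.+ Y)) →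
                   T (isEvenPeak vs ps (thePeak j))
        conclude (i , (i<L , up-i , starts) , yi , par) =
          subst T (trans (flips-odd i) (sym (even-base j i pk r≤Y yi (sym par)))) (os i i<L up-i (starts′ i starts))
          where
          starts′ : ∀ i → Starts i → StartsAt false s i
          starts′ zero    _ = id
          starts′ (suc i) p = p

-- The counted paths as accepted words

isHOn : ℕ → ℕ → List Step → List Vertex → Bool
isHOn k n s vs =
  finalHeight0 vs ∧ lastIsSE s ∧ nFollowedBySE s ∧ notStartN s ∧ below k vs
  ∧ (majorIndex (peaks s vs) ≡ᵇ n) ∧ all (isEvenPeak vs (peaks s vs)) (peaks s vs)

isH-walk : ∀ k a n s {vs} → walk 0 (k ∸ a) s ≡ just vs → isH k a n s ≡ isHOn k n s vs
isH-walk k a n s eq with walk 0 (k ∸ a) s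
isH-walk k a n s refl | just vs = refl

isH⇒walk : ∀ k a n s → T (isH k a n s) → Σ (List Vertex) λ vs → walk 0 (k ∸ a) s ≡ just vs
isH⇒walk k a n s t with walk 0 (k ∸ a) s
... | just vs = vs , refl

lastIsSE-SE : ∀ s → lastIsSE (SE ∷ s) ≡ lastIsSE s
lastIsSE-SE []      = refl
lastIsSE-SE (_ ∷ _) = refl

isH⇒acc : ∀ k a n s → T (isH k a n s) → T (acc k fall (k ∸ a) false (tops SE s) n s)
isH⇒acc k a n s t with isH⇒walk k a n s t
... | vs , eq with walk⇒Walk 0 (k ∸ a) s eq
...   | ws , refl , w = subst (λ m → T (acc k fall (k ∸ a) false (tops SE s) m s))
    (trans (sym (majorIndex-peaks w)) (ℕ.≡ᵇ⇒≡ _ n (T-∧ˡ t₆)))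
    (acc-complete fall s tt (conditions w (T-∧ˡ t₁) (subst T (sym (lastIsSE-SE s)) (T-∧ˡ t₂)) nf
      (T-∧ʳ {k ∸ a <ᵇ k} (T-∧ˡ t₅))
      (oddAscents⇐ false false s (even⇒odd nf (walk-ends-0 w (T-∧ˡ t₁)) (T-∧ʳ {majorIndex (peaks s _) ≡ᵇ n} t₆)))))
  where
  open WalkPeaks w using (even⇒odd)
  t₁ : T (isHOn k n s ((0 , k ∸ a) ∷ ws))
  t₁ = subst T (isH-walk k a n s eq) t
  t₂ = T-∧ʳ {finalHeight0 ((0 , k ∸ a) ∷ ws)} t₁
  t₃ = T-∧ʳ {lastIsSE s} t₂
  nf = T-∧ˡ t₃
  t₄ = T-∧ʳ {nFollowedBySE s} t₃
  t₅ = T-∧ʳ {notStartN s} t₄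
  t₆ = T-∧ʳ {below k ((0 , k ∸ a) ∷ ws)} t₅

acc⇒isH : ∀ k a m n s → 1 ≤ a → a ≤ k → T (acc k fall (k ∸ a) false m n s) → T (isH k a n s)
acc⇒isH k a m n s 1≤a a≤k t = go (acc-sound k 0 fall (k ∸ a) false m n s k∸a<k t)
  where
  k∸a<k : k ∸ a < k
  k∸a<k = ℕ.∸-monoʳ-< {k} 1≤a a≤k
  go : (m ≡ tops SE s × n ≡ drift SE s) × Σ (List Vertex) (Valid k 0 fall (k ∸ a) false s) → T (isH k a n s)
  go ((_ , n≡) , ws , conditions w fin las nf low asc) =
    subst T (sym (isH-walk k a n s (Walk⇒walk w)))
      (T-∧-intro fin (T-∧-intro (subst T (lastIsSE-SE s) las) (T-∧-intro nf (T-∧-intro (not-N s asc)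
        (T-∧-intro (T-∧-intro (ℕ.<⇒<ᵇ k∸a<k) low)
          (T-∧-intro (ℕ.≡⇒≡ᵇ _ n (trans (majorIndex-peaks w) (sym n≡)))
            (odd⇒even nf (walk-ends-0 w fin) (oddAscents⇒ false false s asc))))))))
    where
    open WalkPeaks w using (odd⇒even)
    -- An initial N step would be an ascent starting at index 0, which is even.
    not-N : ∀ s → T (oddAscents false false s) → T (notStartN s)
    not-N []       _ = tt
    not-N (NE ∷ s) _ = tt
    not-N (SE ∷ s) _ = tt
    not-N (E ∷ s)  _ = tt

-- The flag `false` rules out an ascent, so the first step moves right and already costs `m`. This
-- bounds the number of peaks by the major index.
acc-peaks≤ : ∀ {k h} m n s → T (acc k fall h false m n s) → m ≤ n
acc-peaks≤ {h = zero}  zero n []       t = z≤n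
acc-peaks≤ {h = zero}  m    n (E ∷ s)  t = ℕ.≤ᵇ⇒≤ m n (T-∧ˡ t)
acc-peaks≤ {h = suc h} m    n (SE ∷ s) t = ℕ.≤ᵇ⇒≤ m n (T-∧ˡ t)

-- Summing over the number of peaks and counting words

∑ℕ-+ : ∀ K (f g : ℕ → ℕ) → ∑ℕ K (λ m → f m ℕ.+ g m) ≡ ∑ℕ K f ℕ.+ ∑ℕ K g
∑ℕ-+ zero    f g = refl
∑ℕ-+ (suc K) f g = trans (cong (f 0 ℕ.+ g 0 ℕ.+_) (∑ℕ-+ K (f ∘ suc) (g ∘ suc)))
                         (interchange (f 0) (g 0) (∑ℕ K (f ∘ suc)) (∑ℕ K (g ∘ suc)))
  where
  interchange : ∀ a b c d → a ℕ.+ b ℕ.+ (c ℕ.+ d) ≡ a ℕ.+ c ℕ.+ (b ℕ.+ d)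
  interchange = Data.Nat.Tactic.RingSolver.solve-∀

∑ℕ-single : ∀ K t (f : ℕ → ℕ) → (∀ m → m ≢ t → f m ≡ 0) → (K ≤ t → f t ≡ 0) → ∑ℕ K f ≡ f t
∑ℕ-single zero    t       f others beyond = sym (beyond z≤n)
∑ℕ-single (suc K) zero    f others beyond = trans
  (cong (f 0 ℕ.+_) (trans (∑ℕ-cong K (λ m → others (suc m) (λ ()))) (∑ℕ-zero K))) (ℕ.+-identityʳ (f 0))
∑ℕ-single (suc K) (suc t) f others beyond rewrite others 0 (λ ()) =
  ∑ℕ-single K t (f ∘ suc) (λ m m≢t → others (suc m) (m≢t ∘ ℕ.suc-injective)) (beyond ∘ s≤s)

cnt-∑ : ∀ ℓ K P (Q : ℕ → List Step → Bool) →
  (∀ s → (if P s then 1 else 0) ≡ ∑ℕ K (λ m → if Q m s then 1 else 0)) →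
  cnt ℓ P ≡ ∑ℕ K (λ m → cnt ℓ (Q m))
cnt-∑ zero    K P Q eq = eq []
cnt-∑ (suc ℓ) K P Q eq = trans
  (cong₂ ℕ._+_ (eq []) (cong₂ ℕ._+_ (part NE) (cong₂ ℕ._+_ (part SE) (cong₂ ℕ._+_ (part N) (part E)))))
  (sym (trans (∑ℕ-+ K _ _) (cong (e ℕ.+_) (trans (∑ℕ-+ K _ _) (cong (c NE ℕ.+_) (trans (∑ℕ-+ K _ _)
    (cong (c SE ℕ.+_) (∑ℕ-+ K _ _))))))))
  where
  e = ∑ℕ K (λ m → if Q m [] then 1 else 0)
  c : Step → ℕ
  c t = ∑ℕ K (λ m → cnt ℓ (Q m ∘ (t ∷_)))
  part : ∀ t → cnt ℓ (P ∘ (t ∷_)) ≡ c t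
  part t = cnt-∑ ℓ K (P ∘ (t ∷_)) (λ m → Q m ∘ (t ∷_)) (λ s → eq (t ∷ s))

Words : (List Step → Bool) → Set
Words P = Σ (List Step) (λ s → T (P s))

T-irr : ∀ {b} (p q : T b) → p ≡ q
T-irr {true} tt tt = refl

T↔Fin : ∀ b → T b ↔ Fin (if b then 1 else 0)
T↔Fin true  = mk↔ₛ′ (λ _ → Fin.zero) (λ _ → tt) (λ { Fin.zero → refl ; (Fin.suc ()) }) (λ _ → refl)
T↔Fin false = mk↔ₛ′ (λ ()) (λ ()) (λ ()) (λ ())

Words-split : ∀ P → Words P ↔
  (T (P []) ⊎ (Words (P ∘ (NE ∷_)) ⊎ (Words (P ∘ (SE ∷_)) ⊎ (Words (P ∘ (N ∷_)) ⊎ Words (P ∘ (E ∷_))))))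
Words-split P = mk↔ₛ′ to from to-from from-to
  where
  to : Words P → _
  to ([] , p)     = inj₁ p
  to (NE ∷ s , p) = inj₂ (inj₁ (s , p))
  to (SE ∷ s , p) = inj₂ (inj₂ (inj₁ (s , p)))
  to (N ∷ s , p)  = inj₂ (inj₂ (inj₂ (inj₁ (s , p))))
  to (E ∷ s , p)  = inj₂ (inj₂ (inj₂ (inj₂ (s , p))))
  from : _ → Words P
  from (inj₁ p)                             = [] , p
  from (inj₂ (inj₁ (s , p)))                = NE ∷ s , p
  from (inj₂ (inj₂ (inj₁ (s , p))))         = SE ∷ s , p
  from (inj₂ (inj₂ (inj₂ (inj₁ (s , p)))))  = N ∷ s , p
  from (inj₂ (inj₂ (inj₂ (inj₂ (s , p)))))  = E ∷ s , p
  to-from : ∀ z → to (from z) ≡ z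
  to-from (inj₁ p)                      = refl
  to-from (inj₂ (inj₁ _))               = refl
  to-from (inj₂ (inj₂ (inj₁ _)))        = refl
  to-from (inj₂ (inj₂ (inj₂ (inj₁ _)))) = refl
  to-from (inj₂ (inj₂ (inj₂ (inj₂ _)))) = refl
  from-to : ∀ z → from (to z) ≡ z
  from-to ([] , p)     = refl
  from-to (NE ∷ s , p) = refl
  from-to (SE ∷ s , p) = refl
  from-to (N ∷ s , p)  = refl
  from-to (E ∷ s , p)  = refl

Words↔Fin : ∀ ℓ P → (∀ s → T (P s) → length s ≤ ℓ) → Words P ↔ Fin (cnt ℓ P)
Words↔Fin zero P bound = ↔-trans only-[] (T↔Fin (P []))
  where
  only-[] : Words P ↔ T (P [])
  only-[] = mk↔ₛ′
    (λ { ([] , p) → p ; (t ∷ s , p) → ⊥-elim (ℕ.n≮0 (bound (t ∷ s) p)) })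
    ([] ,_) (λ _ → refl)
    (λ { ([] , p) → refl ; (t ∷ s , p) → ⊥-elim (ℕ.n≮0 (bound (t ∷ s) p)) })
Words↔Fin (suc ℓ) P bound = ↔-trans (Words-split P)
  (join (T↔Fin (P [])) (join (part NE) (join (part SE) (join (part N) (part E)))))
  where
  join : ∀ {A B : Set} {m n} → A ↔ Fin m → B ↔ Fin n → (A ⊎ B) ↔ Fin (m ℕ.+ n)
  join f g = ↔-trans (f ⊎-↔ g) (↔-sym Fin.+↔⊎)
  part : ∀ t → Words (P ∘ (t ∷_)) ↔ Fin (cnt ℓ (P ∘ (t ∷_)))
  part t = Words↔Fin ℓ (P ∘ (t ∷_)) (λ s p → ℕ.s≤s⁻¹ (bound (t ∷ s) p))

Words-cong : ∀ {P Q} → (∀ s → T (P s) → T (Q s)) → (∀ s → T (Q s) → T (P s)) → Words P ↔ Words Q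
Words-cong f g = mk↔ₛ′ (λ (s , p) → s , f s p) (λ (s , q) → s , g s q)
  (λ (s , q) → cong (s ,_) (T-irr _ q)) (λ (s , p) → cong (s ,_) (T-irr _ p))

+-∑ℕ : ∀ K (f : ℕ → ℕ) → + ∑ℕ K f ≡ ∑ K (λ m → + f m)
+-∑ℕ zero    f = refl
+-∑ℕ (suc K) f = cong (λ z → + f 0 ℤ.+ z) (+-∑ℕ K (f ∘ suc))

-- Each word contributes for the single value m = `tops SE s`, which is at most n when the word is
-- accepted; so the sum over m ≤ n misses nothing, and `lenBound d n n` is a length budget valid for
-- all these m.
count-rhs : ∀ ℓ c n → c ≤ ℓ → let d = ℓ ∸ c in
  + cnt (lenBound d n n) (λ s → acc (suc ℓ) fall d false (tops SE s) n s) ≡ rhsCoeff (suc ℓ) (suc c) n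
count-rhs ℓ c n c≤ℓ = begin
  + cnt B (λ s → A (tops SE s) s)
    ≡⟨ cong +_ (cnt-∑ B (suc n) (λ s → A (tops SE s) s) A indicator) ⟩
  + ∑ℕ (suc n) (λ m → cnt B (A m))
    ≡⟨ +-∑ℕ (suc n) (λ m → cnt B (A m)) ⟩
  ∑ (suc n) (λ m → + cnt B (A m))
    ≡⟨ ∑-cong< (suc n) (λ { m (s≤s m≤n) → trans
         (cong +_ (cnt-acc (suc ℓ) fall d false m n (lenBound-mono (ℕ.≤-refl {d}) m≤n (ℕ.≤-refl {n}))))
         (at (pathGF-start-β ℓ c m c≤ℓ) n) }) ⟩
  ∑ (suc n) (λ m → (mono m ⊗ (prefactor m ⊗ β ℓ c m)) n)
    ≡⟨ rhsCoeff-β ℓ c n ⟨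
  rhsCoeff (suc ℓ) (suc c) n ∎
  where
  open ≡-Reasoning
  d = ℓ ∸ c
  B = lenBound d n n
  A : ℕ → List Step → Bool
  A m s = acc (suc ℓ) fall d false m n s
  A-tops : ∀ m s → T (A m s) → m ≡ tops SE s
  A-tops m s t = proj₁ (proj₁ (acc-sound (suc ℓ) 0 fall d false m n s (s≤s (ℕ.m∸n≤m ℓ c)) t))
  if-false : ∀ {b} → ¬ T b → (if b then 1 else 0) ≡ 0
  if-false ¬t = cong (λ b → if b then 1 else 0) (¬T⇒false ¬t)
  indicator : ∀ s → (if A (tops SE s) s then 1 else 0) ≡ ∑ℕ (suc n) (λ m → if A m s then 1 else 0)
  indicator s = sym (∑ℕ-single (suc n) (tops SE s) (λ m → if A m s then 1 else 0)
    (λ m m≢ → if-false (λ t → m≢ (A-tops m s t)))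
    (λ n<tops → if-false (λ t → ℕ.<⇒≱ n<tops (acc-peaks≤ (tops SE s) n s t))))

theorem1p5 : (k a : ℕ) → 1 ≤ a → a ≤ k → (n : ℕ) →
    Σ ℕ (λ m → (HPaths k a n ↔ Fin m) × (+ m ≡ rhsCoeff k a n))
theorem1p5 (suc ℓ) (suc c) 1≤a (s≤s c≤ℓ) n =
  cnt (lenBound d n n) Q , ↔-trans (Words-cong to from) (Words↔Fin (lenBound d n n) Q bound) , count-rhs ℓ c n c≤ℓ
  where
  d = ℓ ∸ c
  -- Using the number of peaks of the word itself as the counter merges the automata for all m into
  -- one predicate.
  Q : List Step → Bool
  Q s = acc (suc ℓ) fall d false (tops SE s) n s
  to : ∀ s → T (isH (suc ℓ) (suc c) n s) → T (Q s)
  to = isH⇒acc (suc ℓ) (suc c) n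
  from : ∀ s → T (Q s) → T (isH (suc ℓ) (suc c) n s)
  from s = acc⇒isH (suc ℓ) (suc c) (tops SE s) n s 1≤a (s≤s c≤ℓ)
  bound : ∀ s → T (Q s) → length s ≤ lenBound d n n
  bound s t = ℕ.≤-trans (acc-length fall d false (tops SE s) n s t)
    (lenBound-mono (ℕ.≤-refl {d}) (acc-peaks≤ (tops SE s) n s t) (ℕ.≤-refl {n}))
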